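{- Let $n,k$ be positive integers. There exists a ${}^{2}\mathrm{H}(n;k)$ if and only if $n\geq k\geq 3$ and $nk\not\equiv 1\pmod 4$.
   Context: A partially filled (p.f.) array is a matrix in which some cells may be empty. ${}^{2}\mathrm{H}(n;k)$ denotes an $n\times n$ p.f. array with entries in $\mathbb{Z}_{nk+1}$ such that: (a) each row and each column has exactly $k$ filled cells; (b) the multiset $\{\pm x : x \text{ an entry of a filled cell}\}$ (with multiplicity over all filled cells) contains each nonzero element of $\mathbb{Z}_{nk+1}$ exactly $2$ times; (c) the entries of every row and every column sum to $0$ in $\mathbb{Z}_{nk+1}$. (This is the case $\lambda=2$, $t=1$, $m=n$, $s=k$ of a $\lambda$-fold Heffter array over $\mathbb{Z}_{2nk/\lambda+t}$ relative to the subgroup of order $t$.) -}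

module Defs where

open import Data.Nat using (ℕ; suc; _+_; _*_; _∸_; _≟_)
open import Data.Nat.ListAction using (sum)
open import Data.Nat.DivMod using (_%_)
open import Data.Fin using (Fin; toℕ)
open import Data.Maybe using (Maybe)
open import Data.List using (List; length; map; mapMaybe; concatMap; filter; allFin)
open import Relation.Unary using (Pred; Decidable)
open import Level using (Level)
open import Data.Product using (Σ; _×_)
open import Relation.Binary.PropositionalEquality using (_≡_; _≢_)

-- The cyclic group Z_{nk+1} is represented by Fin (suc (n * k)) with
-- arithmetic taken modulo suc (n * k) on the underlying naturals.

-- An n × n partially filled array with entries in Z_{nk+1};
-- nothing = empty cell, just x = filled cell with entry x.
PFArray : ℕ → ℕ → Set
PFArray n k = Fin n → Fin n → Maybe (Fin (suc (n * k)))

rowEntries : ∀ {n k} → PFArray n k → Fin n → List (Fin (suc (n * k)))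
rowEntries {n} A i = mapMaybe (λ j → A i j) (allFin n)

colEntries : ∀ {n k} → PFArray n k → Fin n → List (Fin (suc (n * k)))
colEntries {n} A j = mapMaybe (λ i → A i j) (allFin n)

allEntries : ∀ {n k} → PFArray n k → List (Fin (suc (n * k)))
allEntries {n} A = concatMap (rowEntries A) (allFin n)

negℕ : ∀ {m} → Fin (suc m) → ℕ
negℕ {m} x = (suc m ∸ toℕ x) % suc m

sumMod : ∀ {m} → List (Fin (suc m)) → ℕ
sumMod {m} xs = sum (map toℕ xs) % suc m

count : ∀ {a p} {A : Set a} {P : Pred A p} → Decidable P → List A → ℕ
count P? xs = length (filter P? xs)

pmMultiplicity : ∀ {n k} → PFArray n k → Fin (suc (n * k)) → ℕ
pmMultiplicity A g =
  count (λ x → toℕ x ≟ toℕ g) (allEntries A)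
  + count (λ x → negℕ x ≟ toℕ g) (allEntries A)

Is2H : (n k : ℕ) → PFArray n k → Set
Is2H n k A =
  ((i : Fin n) → length (rowEntries A i) ≡ k)
  × ((j : Fin n) → length (colEntries A j) ≡ k)
  × ((g : Fin (suc (n * k))) → toℕ g ≢ 0 → pmMultiplicity A g ≡ 2)
  × ((i : Fin n) → sumMod (rowEntries A i) ≡ 0)
  × ((j : Fin n) → sumMod (colEntries A j) ≡ 0)

Exists2H : ℕ → ℕ → Set
Exists2H n k = Σ (PFArray n k) (Is2H n k)

{-# OPTIONS --safe #-}
module Submission where

-- An array is a list of layers (cyclic diagonals) carrying integers, all row and column sums being
-- zero. Since an entry ± v accounts for the residues v and -v, it suffices that the absolute values
-- are 1, …, nk once each, or 1, …, nk/2 twice each. The two patterns survive the addition of four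
-- layers x, -x′, -y, y′ with large entries, where y and y′ are rotated translates of x and x′, so that
-- only k = 0, 3, 5 and 6 have to be settled. For k = 3, and for k = 5 with n odd, the layers derive from
-- a cyclic sequence of numbers with prescribed distances between neighbours, composed of zigzags
-- a, b, a + 1, b - 1, …; the remaining cases are built from pairs ± and 2 × 2 squares.
--
-- Conversely, k ≤ 2 forces entries 0 or a residue used three times, and for nk ≡ 1 (mod 4) the number
-- of odd entries would be both even and odd.
open import Defs
open import Level using (0ℓ)
open import Data.Bool using (Bool; true; false; not; if_then_else_)
open import Data.Bool.Properties using (not-involutive)
open import Data.Nat hiding (∣_-_∣)
open import Data.Nat.Properties
open import Data.Nat.DivMod
open import Data.Nat.Divisibility using (divides; n∣m⇒m%n≡0)
open import Data.Nat.ListAction using (sum)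
open import Data.Nat.ListAction.Properties using (sum-++)
open import Data.Nat.Tactic.RingSolver using (solve-∀)
open import Data.Integer as ℤ using (ℤ; +_; -[1+_]; ∣_∣)
import Data.Integer.Properties as ℤ
import Data.Integer.Tactic.RingSolver as ℤ
open import Data.Fin as Fin using (Fin; toℕ; fromℕ<) renaming (zero to fzero; suc to fsuc)
open import Data.Fin.Properties using (toℕ-fromℕ<; toℕ<n)
open import Data.Maybe using (Maybe; just; nothing; maybe′) renaming (map to mapM)
open import Data.List using (List; []; _∷_; _++_; length; map; mapMaybe; concatMap; allFin; tabulate)
open import Data.List.Properties using (map-tabulate; map-++; length-++; length-mapMaybe; length-tabulate)
open import Data.List.Relation.Unary.All as All using (All; []; _∷_)
import Data.List.Relation.Unary.All.Properties as All
open import Data.List.Relation.Unary.AllPairs using (AllPairs; []; _∷_)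
import Data.List.Relation.Unary.AllPairs.Properties as AllPairs
open import Data.Product using (_×_; _,_; proj₁; proj₂; ∃)
open import Data.Sum using (_⊎_; inj₁; inj₂)
open import Function using (_∘_)
open import Function.Bundles using (_⇔_; mk⇔)
open import Relation.Nullary using (¬_; yes; no; does; contradiction)
open import Relation.Nullary.Decidable using (dec-true; dec-false)
open import Relation.Unary using (Pred; Decidable)
open import Relation.Binary.PropositionalEquality

-- Parity dictates the two patterns. The rows sum to zero in the integers, so the absolute values
-- have an even total: using 1, ..., nk once each requires nk ≡ 0 or 3 (mod 4), and using every
-- value twice requires nk even. Together these cover exactly the cases nk ≢ 1 (mod 4).
--
-- Parity also isolates the case k = n ≡ 2 (mod 4). The six layers made of pairs ± have shifts with
-- an even sum, and so has every group of four further layers; but for k = n all shifts 0, ..., n -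
-- 1 are in use, and n(n - 1)/2 is then odd. Hence a second construction for six layers, whose
-- entries depend on the parity of the row index.
--
-- Entries are compared as multisets by summing an arbitrary function over them. Rotating, reversing
-- or reflecting a layer, or passing from an integer to its residue, thus becomes an identity
-- between finite sums.

-- Finite sums

∑ : (ℕ → ℕ) → ℕ → ℕ
∑ f zero    = 0
∑ f (suc n) = f 0 + ∑ (f ∘ suc) n

∑-cong : ∀ {f g} n → (∀ i → i < n → f i ≡ g i) → ∑ f n ≡ ∑ g n
∑-cong zero    e = refl
∑-cong (suc n) e = cong₂ _+_ (e 0 (s≤s z≤n)) (∑-cong n λ i i<n → e (suc i) (s≤s i<n))

∑-ext : ∀ {f g} n → (∀ i → f i ≡ g i) → ∑ f n ≡ ∑ g n
∑-ext n e = ∑-cong n λ i _ → e i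

∑-zero : ∀ n → ∑ (λ _ → 0) n ≡ 0
∑-zero zero    = refl
∑-zero (suc n) = ∑-zero n

∑-split : ∀ f m n → ∑ f (m + n) ≡ ∑ f m + ∑ (λ i → f (m + i)) n
∑-split f zero    n = refl
∑-split f (suc m) n = trans (cong (λ t → f 0 + t) (∑-split (f ∘ suc) m n)) (sym (+-assoc (f 0) _ _))

∑-snoc : ∀ f n → ∑ f (suc n) ≡ ∑ f n + f n
∑-snoc f zero    = +-comm (f 0) 0
∑-snoc f (suc n) = trans (cong (λ t → f 0 + t) (∑-snoc (f ∘ suc) n)) (sym (+-assoc (f 0) _ _))

interchange : ∀ a b c d → (a + b) + (c + d) ≡ (a + c) + (b + d)
interchange = solve-∀

∑-distrib : ∀ f g n → ∑ (λ i → f i + g i) n ≡ ∑ f n + ∑ g n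
∑-distrib f g zero    = refl
∑-distrib f g (suc n) =
  trans (cong (λ t → f 0 + g 0 + t) (∑-distrib (f ∘ suc) (g ∘ suc) n)) (interchange (f 0) (g 0) _ _)

∑-reverse : ∀ f n → ∑ (λ i → f (n ∸ suc i)) n ≡ ∑ f n
∑-reverse f zero    = refl
∑-reverse f (suc n) =
  trans (cong (λ t → f n + t) (∑-reverse f n)) (trans (+-comm (f n) _) (sym (∑-snoc f n)))

-- A rotation by one drops the term `f s` and gains `f (n + s)`, which is equal to it by
-- periodicity.
∑-rotate : ∀ f n s → (∀ i → f (i + n) ≡ f i) → ∑ (λ i → f (i + s)) n ≡ ∑ f n
∑-rotate f n zero    per = ∑-ext n λ i → cong f (+-identityʳ i)
∑-rotate f n (suc s) per = trans (∑-ext n λ i → cong f (+-suc i s)) (trans step (∑-rotate f n s per))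
  where
  step : ∑ (λ i → f (suc i + s)) n ≡ ∑ (λ i → f (i + s)) n
  step = +-cancelˡ-≡ (f s) _ _ (trans (∑-snoc (λ i → f (i + s)) n)
    (trans (cong (λ t → ∑ (λ i → f (i + s)) n + t) (trans (cong f (+-comm n s)) (per s))) (+-comm _ (f s))))

∑-single : ∀ c n v → c < n → ∑ (λ j → if does (c ≟ j) then v else 0) n ≡ v
∑-single zero    (suc n) v _         = trans (cong (λ t → v + t) (∑-zero n)) (+-identityʳ v)
∑-single (suc c) (suc n) v (s≤s c<n) = ∑-single c n v c<n

∑-allFin : ∀ (f : ℕ → ℕ) n → sum (map (λ i → f (toℕ i)) (allFin n)) ≡ ∑ f n
∑-allFin f n = trans (cong sum (map-tabulate {n = n} (λ i → i) (λ i → f (toℕ i)))) (go f n)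
  where
  go : ∀ f n → sum (tabulate {n = n} (λ i → f (toℕ i))) ≡ ∑ f n
  go f zero    = refl
  go f (suc n) = cong (λ t → f 0 + t) (go (f ∘ suc) n)

sum-mapMaybe : ∀ {A B : Set} (ω : B → ℕ) (h : A → Maybe B) xs →
  sum (map ω (mapMaybe h xs)) ≡ sum (map (maybe′ ω 0 ∘ h) xs)
sum-mapMaybe ω h []       = refl
sum-mapMaybe ω h (x ∷ xs) with h x
... | just y  = cong (λ t → ω y + t) (sum-mapMaybe ω h xs)
... | nothing = sum-mapMaybe ω h xs

sum-concatMap : ∀ {A B : Set} (ω : B → ℕ) (h : A → List B) xs →
  sum (map ω (concatMap h xs)) ≡ sum (map (λ x → sum (map ω (h x))) xs)
sum-concatMap ω h []       = refl
sum-concatMap ω h (x ∷ xs) = trans (go (h x)) (cong (λ t → sum (map ω (h x)) + t) (sum-concatMap ω h xs))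
  where
  go : ∀ ys → sum (map ω (ys ++ concatMap h xs)) ≡ sum (map ω ys) + sum (map ω (concatMap h xs))
  go []       = refl
  go (y ∷ ys) = trans (cong (λ t → ω y + t) (go ys)) (sym (+-assoc (ω y) _ _))

length≡sum : ∀ {A : Set} (xs : List A) → length xs ≡ sum (map (λ _ → 1) xs)
length≡sum []       = refl
length≡sum (x ∷ xs) = cong suc (length≡sum xs)

count≡sum : ∀ {A : Set} {P : Pred A 0ℓ} (P? : Decidable P) xs →
  count P? xs ≡ sum (map (λ x → if does (P? x) then 1 else 0) xs)
count≡sum P? []       = refl
count≡sum P? (x ∷ xs) with does (P? x)
... | true  = cong suc (count≡sum P? xs)
... | false = count≡sum P? xs

sum-map-cong : ∀ {A : Set} {f g : A → ℕ} → (∀ x → f x ≡ g x) → ∀ xs → sum (map f xs) ≡ sum (map g xs)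
sum-map-cong e []       = refl
sum-map-cong e (x ∷ xs) = cong₂ _+_ (e x) (sum-map-cong e xs)

sum-map-0 : ∀ {A : Set} (xs : List A) → sum (map (λ _ → 0) xs) ≡ 0
sum-map-0 []       = refl
sum-map-0 (x ∷ xs) = sum-map-0 xs

sum-map-+ : ∀ {A : Set} (f g : A → ℕ) xs →
  sum (map f xs) + sum (map g xs) ≡ sum (map (λ x → f x + g x) xs)
sum-map-+ f g []       = refl
sum-map-+ f g (x ∷ xs) = trans (interchange (f x) _ (g x) _) (cong (λ t → f x + g x + t) (sum-map-+ f g xs))

-- Arrays composed of cyclic diagonals

-- The layer (s , f) fills cell (i , i + s mod n) with f i; f is to be n-periodic.
Layer : Set
Layer = ℕ × (ℕ → ℤ)

sumℤ : (Layer → ℤ) → List Layer → ℤ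
sumℤ g []       = + 0
sumℤ g (l ∷ ls) = g l ℤ.+ sumℤ g ls

rowSum : ℕ → List Layer → ℤ
rowSum i = sumℤ λ (l : Layer) → proj₂ l i

-- The sum of the entries in column i + B, provided that all shifts are at most B.
colSum : ℕ → ℕ → List Layer → ℤ
colSum B i = sumℤ λ (l : Layer) → proj₂ l (i + (B ∸ proj₁ l))

weight : (ℕ → ℕ) → ℕ → List Layer → ℕ
weight w n ls = sum (map (λ (l : Layer) → ∑ (λ i → w ∣ proj₂ l i ∣) n) ls)

-- `weights` is a multiset equality tested by all functions `w`: the absolute values are 1, ...,
-- `h`, each taken `μ` times. In this form it is additive in the layers, and an indicator put for
-- `w` gives the multiplicity of a residue.
record Design (n k μ h : ℕ) : Set where
  field
    layers   : List Layer
    size     : length layers ≡ k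
    bounded  : All (λ (l : Layer) → proj₁ l < n) layers
    distinct : AllPairs (λ l l′ → proj₁ l ≢ proj₁ l′) layers
    periodic : All (λ (l : Layer) → ∀ i → proj₂ l (i + n) ≡ proj₂ l i) layers
    rows     : ∀ i → rowSum i layers ≡ + 0
    cols     : ∀ i → colSum n i layers ≡ + 0
    weights  : ∀ w → weight w n layers ≡ μ * ∑ (w ∘ suc) h

module _ {n : ℕ} .{{_ : NonZero n}} where

  %-cancelˡ : ∀ i {s t} → s < n → t < n → (i + s) % n ≡ (i + t) % n → s ≡ t
  %-cancelˡ i {s} {t} s<n t<n e = trans (sym (recover s s<n)) (trans (cong (λ x → (r + x) % n) e) (recover t t<n))
    where
    -- A natural number that represents -i modulo n.
    r = i * n ∸ i
    recover : ∀ s → s < n → (r + (i + s) % n) % n ≡ s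
    recover s s<n = begin
      (r + (i + s) % n) % n             ≡⟨ %-distribˡ-+ r _ n ⟩
      (r % n + (i + s) % n % n) % n     ≡⟨ cong (λ x → (r % n + x) % n) (m%n%n≡m%n (i + s) n) ⟩
      (r % n + (i + s) % n) % n         ≡⟨ %-distribˡ-+ r (i + s) n ⟨
      (r + (i + s)) % n                 ≡⟨ cong (_% n) (trans (sym (+-assoc r i s)) (trans (cong (_+ s) (m∸n+n≡m (m≤m*n i n))) (+-comm _ s))) ⟩
      (s + i * n) % n                   ≡⟨ [m+kn]%n≡m%n s i n ⟩
      s % n                             ≡⟨ m<n⇒m%n≡m s<n ⟩
      s                                 ∎
      where open ≡-Reasoning

  cell : List Layer → ℕ → ℕ → Maybe ℤ
  cell []             i j = nothing
  cell ((s , f) ∷ ls) i j = if does ((i + s) % n ≟ j) then just (f i) else cell ls i j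

  cell-fresh : ∀ ls i {j} → All (λ (l : Layer) → (i + proj₁ l) % n ≢ j) ls → cell ls i j ≡ nothing
  cell-fresh []       i []       = refl
  cell-fresh (l ∷ ls) i {j} (p ∷ ps) rewrite dec-false ((i + proj₁ l) % n ≟ j) p = cell-fresh ls i ps

  indicator : ℕ → ℕ → ℕ → ℕ
  indicator v c j = if does (c ≟ j) then v else 0

  -- Layers with distinct shifts below n never claim the same cell, so the first match made by
  -- `cell` is a genuine sum over the layers.
  cell-∷ : ∀ (ω : ℤ → ℕ) {s f ls} i j → s < n → All (λ (l : Layer) → proj₁ l < n) ls → All (λ (l : Layer) → s ≢ proj₁ l) ls →
    maybe′ ω 0 (cell ((s , f) ∷ ls) i j) ≡ indicator (ω (f i)) ((i + s) % n) j + maybe′ ω 0 (cell ls i j)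
  cell-∷ ω {s} {f} {ls} i j s<n bs ns with (i + s) % n ≟ j
  ... | no  p rewrite dec-false ((i + s) % n ≟ j) p = refl
  ... | yes e rewrite dec-true ((i + s) % n ≟ j) e | cell-fresh ls i {j}
    (All.zipWith (λ (b , p) q → p (%-cancelˡ i s<n b (trans e (sym q)))) (bs , ns)) = sym (+-identityʳ _)

  row-∑ : ∀ (ω : ℤ → ℕ) ls i → All (λ (l : Layer) → proj₁ l < n) ls → AllPairs (λ l l′ → proj₁ l ≢ proj₁ l′) ls →
    ∑ (λ j → maybe′ ω 0 (cell ls i j)) n ≡ sum (map (λ (l : Layer) → ω (proj₂ l i)) ls)
  row-∑ ω []             i []       []       = ∑-zero n
  row-∑ ω ((s , f) ∷ ls) i (b ∷ bs) (d ∷ ds) =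
    trans (∑-ext n λ j → cell-∷ ω {f = f} i j b bs d)
    (trans (∑-distrib _ _ n)
    (cong₂ _+_ (∑-single ((i + s) % n) n _ (m%n<n (i + s) n)) (row-∑ ω ls i bs ds)))

  column-row : ∀ {i j s} → i < n → j < n → s < n → (i + s) % n ≡ j → (j + (n ∸ s)) % n ≡ i
  column-row {i} {j} {s} i<n j<n s<n refl = begin
    ((i + s) % n + (n ∸ s)) % n             ≡⟨ %-distribˡ-+ _ (n ∸ s) n ⟩
    ((i + s) % n % n + (n ∸ s) % n) % n     ≡⟨ cong (λ x → (x + (n ∸ s) % n) % n) (m%n%n≡m%n (i + s) n) ⟩
    ((i + s) % n + (n ∸ s) % n) % n         ≡⟨ %-distribˡ-+ (i + s) (n ∸ s) n ⟨
    (i + s + (n ∸ s)) % n                   ≡⟨ cong (_% n) (trans (+-assoc i s _) (cong (λ t → i + t) (m+[n∸m]≡n (<⇒≤ s<n)))) ⟩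
    (i + n) % n                             ≡⟨ [m+n]%n≡m%n i n ⟩
    i % n                                   ≡⟨ m<n⇒m%n≡m i<n ⟩
    i                                       ∎
    where open ≡-Reasoning

  row-column : ∀ {j s} → j < n → s < n → ((j + (n ∸ s)) % n + s) % n ≡ j
  row-column {j} {s} j<n s<n = begin
    ((j + (n ∸ s)) % n + s) % n             ≡⟨ %-distribˡ-+ _ s n ⟩
    ((j + (n ∸ s)) % n % n + s % n) % n     ≡⟨ cong (λ x → (x + s % n) % n) (m%n%n≡m%n _ n) ⟩
    ((j + (n ∸ s)) % n + s % n) % n         ≡⟨ %-distribˡ-+ (j + (n ∸ s)) s n ⟨
    (j + (n ∸ s) + s) % n                   ≡⟨ cong (_% n) (trans (+-assoc j _ s) (cong (λ x → j + x) (m∸n+n≡m (<⇒≤ s<n)))) ⟩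
    (j + n) % n                             ≡⟨ [m+n]%n≡m%n j n ⟩
    j % n                                   ≡⟨ m<n⇒m%n≡m j<n ⟩
    j                                       ∎
    where open ≡-Reasoning

  periodic-% : ∀ {f : ℕ → ℤ} → (∀ i → f (i + n) ≡ f i) → ∀ i → f (i % n) ≡ f i
  periodic-% {f} per i = sym (trans (cong f (m≡m%n+[m/n]*n i n)) (go (i / n)))
    where
    go : ∀ q → f (i % n + q * n) ≡ f (i % n)
    go zero    = cong f (+-identityʳ _)
    go (suc q) = trans (cong f (lemma (i % n) n (q * n))) (trans (per _) (go q))
      where
      lemma : ∀ a b c → a + (b + c) ≡ a + c + b
      lemma = solve-∀

  col-∑ : ∀ (ω : ℤ → ℕ) ls {j} → j < n → All (λ (l : Layer) → proj₁ l < n) ls → AllPairs (λ l l′ → proj₁ l ≢ proj₁ l′) ls →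
    All (λ (l : Layer) → ∀ i → proj₂ l (i + n) ≡ proj₂ l i) ls →
    ∑ (λ i → maybe′ ω 0 (cell ls i j)) n ≡ sum (map (λ (l : Layer) → ω (proj₂ l (j + (n ∸ proj₁ l)))) ls)
  col-∑ ω []             j<n []       []       []       = ∑-zero n
  col-∑ ω ((s , f) ∷ ls) {j} j<n (b ∷ bs) (d ∷ ds) (p ∷ ps) =
    trans (∑-ext n λ i → cell-∷ ω {f = f} i j b bs d)
    (trans (∑-distrib _ _ n)
    (cong₂ _+_
      (trans (∑-cong n swap) (trans (∑-single c n _ (m%n<n _ n)) (cong ω (periodic-% {f} p _))))
      (col-∑ ω ls j<n bs ds ps)))
    where
    -- The only row in which this layer meets column j. `swap` turns the indicator of j into one of
    -- this row, to which `∑-single` applies.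
    c = (j + (n ∸ s)) % n
    swap : ∀ i → i < n → indicator (ω (f i)) ((i + s) % n) j ≡ indicator (ω (f c)) c i
    swap i i<n with (i + s) % n ≟ j | c ≟ i
    ... | yes e | yes p    rewrite dec-true ((i + s) % n ≟ j) e | dec-true (c ≟ i) p = cong (ω ∘ f) (sym p)
    ... | no  p | no  q    rewrite dec-false ((i + s) % n ≟ j) p | dec-false (c ≟ i) q = refl
    ... | yes e | no  ¬e   = contradiction (column-row i<n j<n b e) ¬e
    ... | no ¬e | yes p    = contradiction (trans (cong (λ t → (t + s) % n) (sym p)) (row-column j<n b)) ¬e

-- Integers as residues modulo nk + 1

module _ (m : ℕ) where

  Mod : ℕ
  Mod = suc m

  residue : ℤ → Fin Mod
  residue (+ v)    = fromℕ< (m%n<n v Mod)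
  -- The outer reduction matters when `suc v` is a multiple of `Mod`: the difference is then `Mod`
  -- itself.
  residue -[1+ v ] = fromℕ< (m%n<n (Mod ∸ suc v % Mod) Mod)

  residue-≡ : ∀ z → ∃ λ q → + toℕ (residue z) ≡ z ℤ.+ + Mod ℤ.* q
  residue-≡ (+ v) = ℤ.- (+ (v / Mod)) , (begin
    + toℕ (residue (+ v))                                   ≡⟨ cong +_ (toℕ-fromℕ< (m%n<n v Mod)) ⟩
    + (v % Mod)                                               ≡⟨ identity (+ (v % Mod)) (+ (v / Mod)) (+ Mod) ⟩
    + (v % Mod) ℤ.+ + (v / Mod) ℤ.* + Mod ℤ.+ + Mod ℤ.* ℤ.- (+ (v / Mod)) ≡⟨ cong (λ x → x ℤ.+ + Mod ℤ.* ℤ.- (+ (v / Mod))) (sym (division v)) ⟩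
    + v ℤ.+ + Mod ℤ.* ℤ.- (+ (v / Mod))                         ∎)
    where
    open ≡-Reasoning
    identity : ∀ a b c → a ≡ a ℤ.+ b ℤ.* c ℤ.+ c ℤ.* ℤ.- b
    identity = ℤ.solve-∀
    division : ∀ v → + v ≡ + (v % Mod) ℤ.+ + (v / Mod) ℤ.* + Mod
    division v = trans (cong +_ (m≡m%n+[m/n]*n v Mod)) (cong (λ t → + (v % Mod) ℤ.+ t) (ℤ.pos-* (v / Mod) Mod))
  -- Writing suc v = a + e · Mod gives -suc v = b - (1 + e) · Mod with b = Mod - a, and reducing b
  -- takes away another b / Mod multiples.
  residue-≡ -[1+ v ] = + 1 ℤ.+ + (suc v / Mod) ℤ.- + (b / Mod) , (begin
    + toℕ (residue -[1+ v ])                                ≡⟨ cong +_ (toℕ-fromℕ< (m%n<n b Mod)) ⟩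
    + (b % Mod)                                               ≡⟨ identity (+ (b % Mod)) (+ (b / Mod)) (+ Mod) (+ (suc v / Mod)) (+ a) ⟩
    (ℤ.- (+ a ℤ.+ + (suc v / Mod) ℤ.* + Mod)) ℤ.+ (((+ (b % Mod) ℤ.+ + (b / Mod) ℤ.* + Mod) ℤ.+ + a) ℤ.- + Mod) ℤ.+ + Mod ℤ.* q
      ≡⟨ cong₂ (λ x y → (ℤ.- x) ℤ.+ ((y ℤ.+ + a) ℤ.- + Mod) ℤ.+ + Mod ℤ.* q) (sym (division (suc v))) (sym (division b)) ⟩
    -[1+ v ] ℤ.+ (+ (b + a) ℤ.- + Mod) ℤ.+ + Mod ℤ.* q          ≡⟨ cong (λ x → -[1+ v ] ℤ.+ (+ x ℤ.- + Mod) ℤ.+ + Mod ℤ.* q) (m∸n+n≡m (<⇒≤ (m%n<n (suc v) Mod))) ⟩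
    -[1+ v ] ℤ.+ (+ Mod ℤ.- + Mod) ℤ.+ + Mod ℤ.* q                ≡⟨ cancel -[1+ v ] (+ Mod) (+ Mod ℤ.* q) ⟩
    -[1+ v ] ℤ.+ + Mod ℤ.* q                                  ∎)
    where
    open ≡-Reasoning
    a = suc v % Mod
    b = Mod ∸ a
    q = + 1 ℤ.+ + (suc v / Mod) ℤ.- + (b / Mod)
    identity : ∀ r d c e a → r ≡ (ℤ.- (a ℤ.+ e ℤ.* c)) ℤ.+ (((r ℤ.+ d ℤ.* c) ℤ.+ a) ℤ.- c) ℤ.+ c ℤ.* (+ 1 ℤ.+ e ℤ.- d)
    identity = ℤ.solve-∀
    cancel : ∀ x y z → x ℤ.+ (y ℤ.- y) ℤ.+ z ≡ x ℤ.+ z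
    cancel = ℤ.solve-∀
    division : ∀ v → + v ≡ + (v % Mod) ℤ.+ + (v / Mod) ℤ.* + Mod
    division v = trans (cong +_ (m≡m%n+[m/n]*n v Mod)) (cong (λ t → + (v % Mod) ℤ.+ t) (ℤ.pos-* (v / Mod) Mod))

  residues-≡ : ∀ (g : Layer → ℤ) ls → ∃ λ q → + sum (map (λ (l : Layer) → toℕ (residue (g l))) ls) ≡ sumℤ g ls ℤ.+ + Mod ℤ.* q
  residues-≡ g []       = + 0 , sym (trans (ℤ.+-identityˡ _) (ℤ.*-zeroʳ (+ Mod)))
  residues-≡ g (l ∷ ls) with residue-≡ (g l) | residues-≡ g ls
  ... | q , e | q′ , e′ = q ℤ.+ q′ , trans (cong₂ ℤ._+_ e e′) (collect (g l) (sumℤ g ls) (+ Mod) q q′)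
    where
    collect : ∀ x y c q q′ → (x ℤ.+ c ℤ.* q) ℤ.+ (y ℤ.+ c ℤ.* q′) ≡ (x ℤ.+ y) ℤ.+ c ℤ.* (q ℤ.+ q′)
    collect = ℤ.solve-∀

  residues-% : ∀ (g : Layer → ℤ) ls → sumℤ g ls ≡ + 0 → sum (map (λ (l : Layer) → toℕ (residue (g l))) ls) % Mod ≡ 0
  residues-% g ls e with residues-≡ g ls
  ... | q , e′ = n∣m⇒m%n≡0 _ Mod (divides ∣ q ∣ (trans (cong ∣_∣ (trans e′ (trans (cong (ℤ._+ + Mod ℤ.* q) e) (ℤ.+-identityˡ (+ Mod ℤ.* q)))))
                   (trans (ℤ.abs-* (+ Mod) q) (*-comm Mod ∣ q ∣))))

  -- The contribution of an entry ± v to the multiplicity of g.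
  hits : ℕ → ℕ → ℕ
  hits g v = (if does (v % Mod ≟ g) then 1 else 0) + (if does ((Mod ∸ v % Mod) % Mod ≟ g) then 1 else 0)

  neg-neg : ∀ {a} → a < Mod → (Mod ∸ (Mod ∸ a) % Mod) % Mod ≡ a
  neg-neg {zero}  _   = trans (cong (λ t → (Mod ∸ t) % Mod) (n%n≡0 Mod)) (n%n≡0 Mod)
  neg-neg {suc a} a<Mod rewrite m<n⇒m%n≡m {n = Mod} {m = Mod ∸ suc a} (s≤s (m∸n≤m m a)) | m∸[m∸n]≡n (<⇒≤ a<Mod) = m<n⇒m%n≡m a<Mod

  hits-residue : ∀ g z → (if does (toℕ (residue z) ≟ g) then 1 else 0) + (if does (negℕ (residue z) ≟ g) then 1 else 0) ≡ hits g ∣ z ∣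
  hits-residue g (+ v)    rewrite toℕ-fromℕ< (m%n<n v Mod) = refl
  hits-residue g -[1+ v ] rewrite toℕ-fromℕ< (m%n<n (Mod ∸ suc v % Mod) Mod) | neg-neg (m%n<n (suc v) Mod) =
    +-comm (if does ((Mod ∸ suc v % Mod) % Mod ≟ g) then 1 else 0) _

  private
    one : ℕ → ℕ → ℕ
    one g v = if does (g ≟ v) then 1 else 0

    ≟-sym : ∀ a b → (if does (a ≟ b) then 1 else 0) ≡ one b a
    ≟-sym a b with a ≟ b | b ≟ a
    ... | yes p | yes q rewrite dec-true (a ≟ b) p | dec-true (b ≟ a) q = refl
    ... | no  p | no  q rewrite dec-false (a ≟ b) p | dec-false (b ≟ a) q = refl
    ... | yes p | no ¬q = contradiction (sym p) ¬q
    ... | no ¬p | yes q = contradiction (sym q) ¬p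

    -- On 1, ..., m negation is the reflection u ↦ m + 1 - u, so that everything reduces to
    -- indicators without remainders.
    hits-suc : ∀ g v → v < m → hits g (suc v) ≡ one g (suc v) + one g (suc (m ∸ suc v))
    hits-suc g v v<m rewrite m<n⇒m%n≡m {n = Mod} {m = suc v} (s≤s v<m) | m<n⇒m%n≡m {n = Mod} {m = m ∸ v} (s≤s (m∸n≤m m v)) =
      cong₂ _+_ (≟-sym (suc v) g) (trans (≟-sym (m ∸ v) g) (cong (one g) (+-∸-assoc 1 v<m)))

    ∑-one : ∀ {g} → suc g < Mod → ∑ (λ v → one (suc g) (suc v)) m ≡ 1
    ∑-one {g} (s≤s g<m) = ∑-single g m 1 g<m

  -- The reflection permutes 1, ..., m, so a residue is met once as a value and once as a negative.
  hits-single : ∀ {g} → g ≢ 0 → g < Mod → 1 * ∑ (λ v → hits g (suc v)) m ≡ 2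
  hits-single {zero}  g≢0 _   = contradiction refl g≢0
  hits-single {suc g} _   g<Mod = begin
    1 * ∑ (λ v → hits (suc g) (suc v)) m ≡⟨ *-identityˡ _ ⟩
    ∑ (λ v → hits (suc g) (suc v)) m     ≡⟨ ∑-cong m (hits-suc (suc g)) ⟩
    ∑ (λ v → one (suc g) (suc v) + one (suc g) (suc (m ∸ suc v))) m ≡⟨ ∑-distrib _ _ m ⟩
    ∑ (λ v → one (suc g) (suc v)) m + ∑ (λ v → one (suc g) (suc (m ∸ suc v))) m
      ≡⟨ cong₂ _+_ (∑-one g<Mod) (trans (∑-reverse (λ v → one (suc g) (suc v)) m) (∑-one g<Mod)) ⟩
    2 ∎
    where open ≡-Reasoning

  -- Since 2h = m, the reflections of 1, ..., h are h + 1, ..., m. One copy of 1, ..., h thus meets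
  -- every nonzero residue once, and there are two copies.
  hits-double : ∀ {g h} → h + h ≡ m → g ≢ 0 → g < Mod → 2 * ∑ (λ v → hits g (suc v)) h ≡ 2
  hits-double {zero}      _ g≢0 _   = contradiction refl g≢0
  hits-double {suc g} {h} e _   g<Mod = cong (2 *_) (begin
    ∑ (λ v → hits (suc g) (suc v)) h     ≡⟨ ∑-cong h (λ v v<h → hits-suc (suc g) v (<-≤-trans v<h h≤m)) ⟩
    ∑ (λ v → o v + o (m ∸ suc v)) h      ≡⟨ ∑-distrib o _ h ⟩
    ∑ o h + ∑ (λ v → o (m ∸ suc v)) h    ≡⟨ cong (λ t → ∑ o h + t) (trans (∑-cong h upper) (∑-reverse (λ v → o (h + v)) h)) ⟩
    ∑ o h + ∑ (λ v → o (h + v)) h        ≡⟨ ∑-split o h h ⟨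
    ∑ o (h + h)                          ≡⟨ cong (∑ o) e ⟩
    ∑ o m                                ≡⟨ ∑-one g<Mod ⟩
    1                                    ∎)
    where
    open ≡-Reasoning
    o : ℕ → ℕ
    o v = one (suc g) (suc v)
    h≤m : h ≤ m
    h≤m = subst (h ≤_) e (m≤m+n h h)
    upper : ∀ v → v < h → o (m ∸ suc v) ≡ o (h + (h ∸ suc v))
    upper v v<h = cong o (trans (cong (_∸ suc v) (sym e)) (+-∸-assoc h v<h))

-- From a design to an array

module Realise {n k μ h : ℕ} .{{_ : NonZero n}} (D : Design n k μ h) where
  open Design D

  private m = n * k

  array : PFArray n k
  array i j = mapM (residue m) (cell layers (toℕ i) (toℕ j))

  maybe-map : ∀ {A B : Set} (ω : B → ℕ) (g : A → B) x → maybe′ ω 0 (mapM g x) ≡ maybe′ (ω ∘ g) 0 x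
  maybe-map ω g (just _) = refl
  maybe-map ω g nothing  = refl

  rowEntries-sum : ∀ (ω : Fin (suc m) → ℕ) i →
    sum (map ω (rowEntries array i)) ≡ sum (map (λ (l : Layer) → ω (residue m (proj₂ l (toℕ i)))) layers)
  rowEntries-sum ω i =
    trans (sum-mapMaybe ω (array i) (allFin n))
    (trans (sum-map-cong (λ j → maybe-map ω (residue m) (cell layers (toℕ i) (toℕ j))) (allFin n))
    (trans (∑-allFin (λ j → maybe′ (ω ∘ residue m) 0 (cell layers (toℕ i) j)) n)
    (row-∑ (ω ∘ residue m) layers (toℕ i) bounded distinct)))

  colEntries-sum : ∀ (ω : Fin (suc m) → ℕ) j →
    sum (map ω (colEntries array j)) ≡ sum (map (λ (l : Layer) → ω (residue m (proj₂ l (toℕ j + (n ∸ proj₁ l))))) layers)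
  colEntries-sum ω j =
    trans (sum-mapMaybe ω (λ i → array i j) (allFin n))
    (trans (sum-map-cong (λ i → maybe-map ω (residue m) (cell layers (toℕ i) (toℕ j))) (allFin n))
    (trans (∑-allFin (λ i → maybe′ (ω ∘ residue m) 0 (cell layers i (toℕ j))) n)
    (col-∑ (ω ∘ residue m) layers (toℕ<n j) bounded distinct periodic)))

  ∑-layers : ∀ (ω : ℤ → ℕ) ls → ∑ (λ i → sum (map (λ (l : Layer) → ω (proj₂ l i)) ls)) n ≡ sum (map (λ (l : Layer) → ∑ (λ i → ω (proj₂ l i)) n) ls)
  ∑-layers ω []       = ∑-zero n
  ∑-layers ω (l ∷ ls) = trans (∑-distrib _ _ n) (cong (λ t → ∑ (λ i → ω (proj₂ l i)) n + t) (∑-layers ω ls))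

  multiplicity : ∀ g → pmMultiplicity array g ≡ μ * ∑ (λ v → hits m (toℕ g) (suc v)) h
  multiplicity g = begin
    pmMultiplicity array g
      ≡⟨ cong₂ _+_ (count≡sum (λ x → toℕ x ≟ toℕ g) xs) (count≡sum (λ x → negℕ x ≟ toℕ g) xs) ⟩
    sum (map _ xs) + sum (map _ xs)
      ≡⟨ sum-map-+ (λ x → if does (toℕ x ≟ toℕ g) then 1 else 0) (λ x → if does (negℕ x ≟ toℕ g) then 1 else 0) xs ⟩
    sum (map ω xs)
      ≡⟨ sum-concatMap ω (rowEntries array) (allFin n) ⟩
    sum (map (λ i → sum (map ω (rowEntries array i))) (allFin n))
      ≡⟨ sum-map-cong (rowEntries-sum ω) (allFin n) ⟩
    sum (map (λ i → sum (map (λ (l : Layer) → ω (residue m (proj₂ l (toℕ i)))) layers)) (allFin n))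
      ≡⟨ ∑-allFin (λ i → sum (map (λ (l : Layer) → ω (residue m (proj₂ l i))) layers)) n ⟩
    ∑ (λ i → sum (map (λ (l : Layer) → ω (residue m (proj₂ l i))) layers)) n
      ≡⟨ ∑-layers (ω ∘ residue m) layers ⟩
    sum (map (λ (l : Layer) → ∑ (λ i → ω (residue m (proj₂ l i))) n) layers)
      ≡⟨ sum-map-cong (λ (l : Layer) → ∑-ext n λ i → hits-residue m (toℕ g) (proj₂ l i)) layers ⟩
    weight (hits m (toℕ g)) n layers
      ≡⟨ weights (hits m (toℕ g)) ⟩
    μ * ∑ (λ v → hits m (toℕ g) (suc v)) h ∎
    where
    open ≡-Reasoning
    xs = allEntries array
    ω : Fin (suc m) → ℕ
    ω x = (if does (toℕ x ≟ toℕ g) then 1 else 0) + (if does (negℕ x ≟ toℕ g) then 1 else 0)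

  realise : (∀ {g} → g ≢ 0 → g < suc m → μ * ∑ (λ v → hits m g (suc v)) h ≡ 2) → Exists2H n k
  realise twice = array
    , (λ i → trans (length≡sum (rowEntries array i)) (trans (rowEntries-sum (λ _ → 1) i) (trans (sym (length≡sum layers)) size)))
    , (λ j → trans (length≡sum (colEntries array j)) (trans (colEntries-sum (λ _ → 1) j) (trans (sym (length≡sum layers)) size)))
    , (λ g g≢0 → trans (multiplicity g) (twice g≢0 (toℕ<n g)))
    , (λ i → trans (cong (_% suc m) (rowEntries-sum toℕ i)) (residues-% m _ layers (rows (toℕ i))))
    , (λ j → trans (cong (_% suc m) (colEntries-sum toℕ j)) (residues-% m _ layers (cols (toℕ j))))

exists-single : ∀ {n k} .{{_ : NonZero n}} → Design n k 1 (n * k) → Exists2H n k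
exists-single {n} {k} D = Realise.realise D (hits-single (n * k))

exists-double : ∀ {n k h} .{{_ : NonZero n}} → h + h ≡ n * k → Design n k 2 h → Exists2H n k
exists-double {n} {k} {h} e D = Realise.realise D (hits-double (n * k) {h = h} e)

-- Sums over lists of layers and periodic sequences

sumℤ-++ : ∀ g ls ls′ → sumℤ g (ls ++ ls′) ≡ sumℤ g ls ℤ.+ sumℤ g ls′
sumℤ-++ g []       ls′ = sym (ℤ.+-identityˡ _)
sumℤ-++ g (l ∷ ls) ls′ = trans (cong (λ t → g l ℤ.+ t) (sumℤ-++ g ls ls′)) (sym (ℤ.+-assoc (g l) _ _))

sumℤ-0 : ∀ g ls ls′ → sumℤ g ls ≡ + 0 → sumℤ g ls′ ≡ + 0 → sumℤ g (ls ++ ls′) ≡ + 0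
sumℤ-0 g ls ls′ e e′ = trans (sumℤ-++ g ls ls′) (cong₂ ℤ._+_ e e′)

weight-++ : ∀ w n ls ls′ → weight w n (ls ++ ls′) ≡ weight w n ls + weight w n ls′
weight-++ w n ls ls′ = trans (cong sum (map-++ _ ls ls′)) (sum-++ (map _ ls) (map _ ls′))

∸-complement : ∀ {s d T n} → s + d ≡ T → T ≤ n → n ∸ s ≡ d + (n ∸ T)
∸-complement {s} {d} {T} {n} refl T≤n =
  trans (cong (_∸ s) (trans (sym (m+[n∸m]≡n T≤n)) (+-assoc s d _))) (m+n∸m≡n s _)

-- Counting from the largest shift `B` instead of n makes the row indices i + (B - s), close to each
-- other, so that a column sum becomes an identity in a few named terms.
colSum-≡ : ∀ {B n} i ls → B ≤ n → All (λ l → proj₁ l ≤ B) ls → colSum n i ls ≡ colSum B (i + (n ∸ B)) ls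
colSum-≡ i []             B≤n []       = refl
colSum-≡ {B} {n} i ((s , f) ∷ ls) B≤n (p ∷ ps) = cong₂ ℤ._+_
  (cong f (trans (cong (λ t → i + t) (∸-complement (m+[n∸m]≡n p) B≤n)) (lemma i (B ∸ s) (n ∸ B))))
  (colSum-≡ i ls B≤n ps)
  where
  lemma : ∀ a b c → a + (b + c) ≡ a + c + b
  lemma = solve-∀

module _ {n : ℕ} .{{_ : NonZero n}} where

  periodise : (ℕ → ℤ) → ℕ → ℤ
  periodise F i = F (i % n)

  ∑-% : ∀ (g : ℕ → ℕ) → ∑ (λ i → g (i % n)) n ≡ ∑ g n
  ∑-% g = ∑-cong n λ i i<n → cong g (m<n⇒m%n≡m i<n)

  ∑-%-shift : ∀ (g : ℕ → ℕ) s → ∑ (λ i → g ((i + s) % n)) n ≡ ∑ g n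
  ∑-%-shift g s = trans (∑-rotate (λ i → g (i % n)) n s λ i → cong g ([m+n]%n≡m%n i n)) (∑-% g)

  ∑-neg : ∀ (w : ℕ → ℕ) (f : ℕ → ℤ) N → ∑ (λ i → w ∣ ℤ.- f i ∣) N ≡ ∑ (λ i → w ∣ f i ∣) N
  ∑-neg w f N = ∑-ext N λ i → cong w (ℤ.∣-i∣≡∣i∣ (f i))

-- Adding four layers at a time

-- In a double design every value up to h is used twice in absolute value,
-- in a single design once.
data Style : Set where
  double single : Style

mult step : Style → ℕ
mult double = 2
mult single = 1
step double = 1
step single = 2

-- The constant by which `high` exceeds `low`: the two agree in a double design, and run through
-- alternate values in a single one.
offset : Style → ℕ
offset double = 0
offset single = 1

∑-pairs : ∀ st g n → ∑ (λ i → g (offset st + step st * i) + g (step st * i)) n ≡ mult st * ∑ g (step st * n)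
∑-pairs double g n = trans (∑-distrib _ _ n) (trans (cong₂ _+_ (e n) (e n)) (lemma (∑ g (1 * n))))
  where
  e : ∀ n → ∑ (λ i → g (1 * i)) n ≡ ∑ g (1 * n)
  e n = trans (∑-ext n λ i → cong g (*-identityˡ i)) (cong (∑ g) (sym (*-identityˡ n)))
  lemma : ∀ a → a + a ≡ 2 * a
  lemma = solve-∀
∑-pairs single g n = trans (go g n) (sym (*-identityˡ _))
  where
  double-suc : ∀ n → 2 * suc n ≡ 2 + 2 * n
  double-suc = solve-∀
  swap : ∀ a b c → a + b + c ≡ b + (a + c)
  swap = solve-∀
  go : ∀ g n → ∑ (λ i → g (1 + 2 * i) + g (2 * i)) n ≡ ∑ g (2 * n)
  go g zero    = refl
  go g (suc n) = trans (cong (λ t → g 1 + g 0 + t)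
      (trans (∑-ext n λ i → cong₂ _+_ (cong (g ∘ suc) (double-suc i)) (cong g (double-suc i))) (go (g ∘ suc ∘ suc) n)))
    (trans (swap (g 1) (g 0) _) (cong (∑ g) (sym (double-suc n))))

-- Four layers x, -x′, -y, y′ at the shifts p, p + 1, p + σ, p + 1 + σ, where y and y′ arise
-- from x and x′ by a rotation by σ and the addition of a constant.
module Group (st : Style) (n σ : ℕ) .{{_ : NonZero n}} where

  low high : ℕ → ℕ → ℤ
  low  s = periodise {n} λ i → + (s + suc (step st * i))
  high s = periodise {n} λ i → + (s + suc (offset st + step st * i))

  c : ℕ
  c = step st * n

  group : ℕ → ℕ → List Layer
  group s p = (p , high s)
            ∷ (p + 1 , λ i → ℤ.- low s i)
            ∷ (p + σ , λ i → ℤ.- high (s + c) (i + σ))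
            ∷ (p + 1 + σ , λ i → low (s + c) (i + σ))
            ∷ []

  low-periodic : ∀ s i → low s (i + n) ≡ low s i
  low-periodic s i = cong (λ j → + (s + suc (step st * j))) ([m+n]%n≡m%n i n)

  high-periodic : ∀ s i → high s (i + n) ≡ high s i
  high-periodic s i = cong (λ j → + (s + suc (offset st + step st * j))) ([m+n]%n≡m%n i n)

  high-low : ∀ s i → high s i ≡ + offset st ℤ.+ low s i
  high-low s i = cong +_ (lemma s (offset st) (step st * (i % n)))
    where
    lemma : ∀ a b c → a + suc (b + c) ≡ b + (a + suc c)
    lemma = solve-∀

  raise : ∀ s j → low (s + c) j ≡ + c ℤ.+ low s j
  raise s j = cong +_ (lemma s c (suc (step st * (j % n))))
    where
    lemma : ∀ a b c → a + b + c ≡ b + (a + c)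
    lemma = solve-∀

  group-rows : ∀ s p i → rowSum i (group s p) ≡ + 0
  group-rows s p i rewrite high-low s i | high-low (s + c) (i + σ) = lemma (+ offset st) (low s i) (low (s + c) (i + σ))
    where
    lemma : ∀ e a b → (e ℤ.+ a) ℤ.+ ((ℤ.- a) ℤ.+ ((ℤ.- (e ℤ.+ b)) ℤ.+ (b ℤ.+ + 0))) ≡ + 0
    lemma = ℤ.solve-∀

  -- The rotation by σ undoes the difference of the shifts: in a given column both `high` layers are
  -- read at the index `a` and both `low` layers at `b`. What is left is the constant `c`, once with
  -- each sign.
  group-cols : ∀ s p i → p + 1 + σ ≤ n → colSum n i (group s p) ≡ + 0
  group-cols s p i le = begin
    colSum n i (group s p)
      ≡⟨ cong₂ ℤ._+_ (cong (high s) i₁) (cong₂ ℤ._+_ (cong (λ t → ℤ.- low s t) i₂)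
         (cong₂ ℤ._+_ (cong (λ t → ℤ.- high (s + c) t) i₃) (cong (λ t → low (s + c) t ℤ.+ + 0) i₄))) ⟩
    high s a ℤ.+ ((ℤ.- low s b) ℤ.+ ((ℤ.- high (s + c) a) ℤ.+ (low (s + c) b ℤ.+ + 0)))
      ≡⟨ cong₂ (λ x y → x ℤ.+ ((ℤ.- low s b) ℤ.+ ((ℤ.- y) ℤ.+ (low (s + c) b ℤ.+ + 0))))
         (high-low s a) (trans (high-low (s + c) a) (cong (λ t → + offset st ℤ.+ t) (raise s a))) ⟩
    _ ≡⟨ cong (λ x → (+ offset st ℤ.+ low s a) ℤ.+ ((ℤ.- low s b) ℤ.+ ((ℤ.- (+ offset st ℤ.+ (+ c ℤ.+ low s a))) ℤ.+ (x ℤ.+ + 0)))) (raise s b) ⟩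
    _ ≡⟨ lemma (+ offset st) (+ c) (low s a) (low s b) ⟩
    + 0 ∎
    where
    open ≡-Reasoning
    r = n ∸ (p + 1 + σ)
    a = i + r + 1 + σ
    b = i + r + σ
    lemma : ∀ e d a b → (e ℤ.+ a) ℤ.+ ((ℤ.- b) ℤ.+ ((ℤ.- (e ℤ.+ (d ℤ.+ a))) ℤ.+ ((d ℤ.+ b) ℤ.+ + 0))) ≡ + 0
    lemma = ℤ.solve-∀
    r₁ : ∀ i r σ → i + (1 + σ + r) ≡ i + r + 1 + σ
    r₁ = solve-∀
    r₂ : ∀ i r σ → i + (σ + r) ≡ i + r + σ
    r₂ = solve-∀
    r₃ : ∀ p σ → p + σ + 1 ≡ p + 1 + σ
    r₃ = solve-∀
    i₁ : i + (n ∸ p) ≡ a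
    i₁ = trans (cong (λ t → i + t) (∸-complement {d = 1 + σ} (sym (+-assoc p 1 σ)) le)) (r₁ i r σ)
    i₂ : i + (n ∸ (p + 1)) ≡ b
    i₂ = trans (cong (λ t → i + t) (∸-complement {d = σ} refl le)) (r₂ i r σ)
    i₃ : i + (n ∸ (p + σ)) + σ ≡ a
    i₃ = cong (_+ σ) (trans (cong (λ t → i + t) (∸-complement {d = 1} (r₃ p σ) le)) (trans (+-suc i r) (+-comm 1 (i + r))))
    i₄ : i + (n ∸ (p + 1 + σ)) + σ ≡ b
    i₄ = refl

  ∑-highlow : ∀ (w : ℕ → ℕ) s → ∑ (λ i → w ∣ high s i ∣) n + ∑ (λ i → w ∣ low s i ∣) n ≡ mult st * ∑ (λ j → w (s + suc j)) c
  ∑-highlow w s = trans (cong₂ _+_ (∑-% {n} (λ i → w (s + suc (offset st + step st * i)))) (∑-% {n} (λ i → w (s + suc (step st * i)))))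
    (trans (sym (∑-distrib _ _ n)) (∑-pairs st (λ j → w (s + suc j)) n))

  group-weight : ∀ w s p → weight w n (group s p) ≡ mult st * ∑ (λ j → w (s + suc j)) (c + c)
  group-weight w s p = begin
    weight w n (group s p)
      ≡⟨ cong₂ (λ x y → H s + (x + (y + (∑ (λ i → w ∣ low (s + c) (i + σ) ∣) n + 0))))
           (∑-neg {n} w (low s) n) (∑-neg {n} w (λ i → high (s + c) (i + σ)) n) ⟩
    H s + (L s + (∑ (λ i → w ∣ high (s + c) (i + σ) ∣) n + (∑ (λ i → w ∣ low (s + c) (i + σ) ∣) n + 0)))
      ≡⟨ cong₂ (λ x y → H s + (L s + (x + (y + 0)))) (rot (high (s + c)) (high-periodic (s + c))) (rot (low (s + c)) (low-periodic (s + c))) ⟩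
    H s + (L s + (H (s + c) + (L (s + c) + 0)))
      ≡⟨ regroup (H s) (L s) (H (s + c)) (L (s + c)) ⟩
    (H s + L s) + (H (s + c) + L (s + c))
      ≡⟨ cong₂ _+_ (∑-highlow w s) (∑-highlow w (s + c)) ⟩
    mult st * ∑ (λ j → w (s + suc j)) c + mult st * ∑ (λ j → w (s + c + suc j)) c
      ≡⟨ *-distribˡ-+ (mult st) (∑ (λ j → w (s + suc j)) c) _ ⟨
    mult st * (∑ (λ j → w (s + suc j)) c + ∑ (λ j → w (s + c + suc j)) c)
      ≡⟨ cong (λ t → mult st * (∑ (λ j → w (s + suc j)) c + t)) (∑-ext c λ j → cong w (trans (+-assoc s c (suc j)) (cong (λ t → s + t) (+-suc c j)))) ⟩
    mult st * (∑ (λ j → w (s + suc j)) c + ∑ (λ j → w (s + suc (c + j))) c)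
      ≡⟨ cong (mult st *_) (∑-split (λ j → w (s + suc j)) c c) ⟨
    mult st * ∑ (λ j → w (s + suc j)) (c + c) ∎
    where
    open ≡-Reasoning
    H L : ℕ → ℕ
    H s = ∑ (λ i → w ∣ high s i ∣) n
    L s = ∑ (λ i → w ∣ low s i ∣) n
    rot : ∀ f → (∀ i → f (i + n) ≡ f i) → ∑ (λ i → w ∣ f (i + σ) ∣) n ≡ ∑ (λ i → w ∣ f i ∣) n
    rot f per = ∑-rotate (λ i → w ∣ f i ∣) n σ λ i → cong (λ t → w ∣ t ∣) (per i)
    regroup : ∀ a b c d → a + (b + (c + (d + 0))) ≡ (a + b) + (c + d)
    regroup = solve-∀

  groups : ℕ → ℕ → ℕ → List Layer
  groups s p zero    = []
  groups s p (suc t) = group s p ++ groups (s + (c + c)) (p + 2) t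

  groups-size : ∀ s p t → length (groups s p t) ≡ t * 4
  groups-size s p zero    = refl
  groups-size s p (suc t) = cong (λ t → 4 + t) (groups-size _ _ t)

  groups-rows : ∀ s p t i → rowSum i (groups s p t) ≡ + 0
  groups-rows s p zero    i = refl
  groups-rows s p (suc t) i = sumℤ-0 (λ (l : Layer) → proj₂ l i) (group s p) (groups (s + (c + c)) (p + 2) t) (group-rows s p i) (groups-rows _ _ t i)

  groups-weight : ∀ w s p t → weight w n (groups s p t) ≡ mult st * ∑ (λ j → w (s + suc j)) (t * (c + c))
  groups-weight w s p zero    = sym (*-zeroʳ (mult st))
  groups-weight w s p (suc t) = begin
    weight w n (group s p ++ groups (s + (c + c)) (p + 2) t)
      ≡⟨ weight-++ w n (group s p) (groups (s + (c + c)) (p + 2) t) ⟩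
    weight w n (group s p) + weight w n (groups (s + (c + c)) (p + 2) t)
      ≡⟨ cong₂ _+_ (group-weight w s p) (groups-weight w (s + (c + c)) (p + 2) t) ⟩
    mult st * ∑ (λ j → w (s + suc j)) (c + c) + mult st * ∑ (λ j → w (s + (c + c) + suc j)) (t * (c + c))
      ≡⟨ *-distribˡ-+ (mult st) (∑ (λ j → w (s + suc j)) (c + c)) _ ⟨
    mult st * (∑ (λ j → w (s + suc j)) (c + c) + ∑ (λ j → w (s + (c + c) + suc j)) (t * (c + c)))
      ≡⟨ cong (λ x → mult st * (∑ (λ j → w (s + suc j)) (c + c) + x))
         (∑-ext (t * (c + c)) λ j → cong w (trans (+-assoc s (c + c) (suc j)) (cong (λ t → s + t) (+-suc (c + c) j)))) ⟩
    mult st * (∑ (λ j → w (s + suc j)) (c + c) + ∑ (λ j → w (s + suc (c + c + j))) (t * (c + c)))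
      ≡⟨ cong (mult st *_) (∑-split (λ j → w (s + suc j)) (c + c) (t * (c + c))) ⟨
    mult st * ∑ (λ j → w (s + suc j)) (c + c + t * (c + c)) ∎
    where open ≡-Reasoning

  groups-periodic : ∀ s p t → All (λ (l : Layer) → ∀ i → proj₂ l (i + n) ≡ proj₂ l i) (groups s p t)
  groups-periodic s p zero    = []
  groups-periodic s p (suc t) =
      high-periodic s
    ∷ (λ i → cong ℤ.-_ (low-periodic s i))
    ∷ (λ i → cong ℤ.-_ (trans (cong (high (s + c)) (comm i n σ)) (high-periodic (s + c) (i + σ))))
    ∷ (λ i → trans (cong (low (s + c)) (comm i n σ)) (low-periodic (s + c) (i + σ)))
    ∷ groups-periodic (s + (c + c)) (p + 2) t
    where
    comm : ∀ a b c → a + b + c ≡ a + c + b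
    comm = solve-∀

  -- Every group takes two neighbouring shifts from each of two blocks of length 2t that lie σ
  -- apart.
  Zone : ℕ → ℕ → ℕ → Set
  Zone p t s = (p ≤ s × s < p + t * 2) ⊎ (p + σ ≤ s × s < p + t * 2 + σ)

  private
    widen : ∀ p t → p + 2 + t * 2 ≡ p + suc t * 2
    widen p t = +-assoc p 2 (t * 2)

    grow : ∀ {p t s} → Zone (p + 2) t s → Zone p (suc t) s
    grow {p} {t} {s} (inj₁ (a , b)) = inj₁ (≤-trans (m≤m+n p 2) a , subst (s <_) (widen p t) b)
    grow {p} {t} {s} (inj₂ (a , b)) = inj₂ (≤-trans (+-monoˡ-≤ σ (m≤m+n p 2)) a , subst (λ x → s < x + σ) (widen p t) b)

  groups-zone : ∀ s p t → All (λ (l : Layer) → Zone p t (proj₁ l)) (groups s p t)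
  groups-zone s p zero    = []
  groups-zone s p (suc t) =
      inj₁ (≤-refl , m<m+n p z<s)
    ∷ inj₁ (m≤m+n p 1 , +-monoʳ-< p (s≤s (s≤s z≤n)))
    ∷ inj₂ (≤-refl , +-monoˡ-< σ (m<m+n p z<s))
    ∷ inj₂ (+-monoˡ-≤ σ (m≤m+n p 1) , +-monoˡ-< σ (+-monoʳ-< p (s≤s (s≤s z≤n))))
    ∷ All.map (grow {p} {t}) (groups-zone (s + (c + c)) (p + 2) t)

  groups-bounded : ∀ s p t → p + t * 2 + σ ≤ n → All (λ (l : Layer) → proj₁ l < n) (groups s p t)
  groups-bounded s p t le = All.map (λ { (inj₁ (_ , b)) → ≤-trans b (≤-trans (m≤m+n _ σ) le)
                                       ; (inj₂ (_ , b)) → ≤-trans b le }) (groups-zone s p t)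

  groups-distinct : ∀ s p t → t * 2 ≤ σ → AllPairs (λ (l l′ : Layer) → proj₁ l ≢ proj₁ l′) (groups s p t)
  groups-distinct s p zero    _  = []
  groups-distinct s p (suc t) le =
      (<⇒≢ p<p+1 ∷ <⇒≢ (<-≤-trans p<p+1 (+-monoʳ-≤ p (≤-trans (s≤s z≤n) 2≤σ))) ∷ <⇒≢ (<-≤-trans p<p+1 (m≤m+n _ σ))
        ∷ All.map (λ { (inj₁ (a , _)) → <⇒≢ (<-≤-trans (m<m+n p z<s) a)
                     ; (inj₂ (a , _)) → <⇒≢ (<-≤-trans (m<m+n p z<s) (≤-trans (m≤m+n _ σ) a)) }) zone)
    ∷ (<⇒≢ (<-≤-trans (+-monoʳ-< p (s≤s (s≤s z≤n))) (+-monoʳ-≤ p 2≤σ)) ∷ <⇒≢ (m<m+n (p + 1) (≤-trans (s≤s z≤n) 2≤σ))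
        ∷ All.map (λ { (inj₁ (a , _)) → <⇒≢ (<-≤-trans (+-monoʳ-< p (s≤s (s≤s z≤n))) a)
                     ; (inj₂ (a , _)) → <⇒≢ (<-≤-trans (+-monoʳ-< p (s≤s (s≤s z≤n))) (≤-trans (m≤m+n _ σ) a)) }) zone)
    ∷ (<⇒≢ (+-monoˡ-< σ p<p+1)
        ∷ All.map (λ { (inj₁ (_ , b)) → ≢-sym (<⇒≢ (<-≤-trans b below))
                     ; (inj₂ (a , _)) → <⇒≢ (<-≤-trans (+-monoˡ-< σ (m<m+n p z<s)) a) }) zone)
    ∷ All.map (λ { (inj₁ (_ , b)) → ≢-sym (<⇒≢ (<-≤-trans b (≤-trans below (+-monoˡ-≤ σ (m≤m+n p 1)))))
                 ; (inj₂ (a , _)) → <⇒≢ (<-≤-trans (+-monoˡ-< σ (+-monoʳ-< p (s≤s (s≤s z≤n)))) a) }) zone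
    ∷ groups-distinct (s + (c + c)) (p + 2) t (≤-trans (m≤n+m (t * 2) 2) le)
    where
    p<p+1 : p < p + 1
    p<p+1 = m<m+n p z<s
    2≤σ : 2 ≤ σ
    2≤σ = ≤-trans (m≤m+n 2 (t * 2)) le
    zone = groups-zone (s + (c + c)) (p + 2) t
    below : p + 2 + t * 2 ≤ p + σ
    below = subst (_≤ p + σ) (sym (widen p t)) (+-monoʳ-≤ p le)

  groups-cols : ∀ s p t i → p + t * 2 + σ ≤ n → colSum n i (groups s p t) ≡ + 0
  groups-cols s p zero    i le = refl
  groups-cols s p (suc t) i le = sumℤ-0 (λ (l : Layer) → proj₂ l (i + (n ∸ proj₁ l))) (group s p) (groups (s + (c + c)) (p + 2) t)
    (group-cols s p i (≤-trans (+-monoˡ-≤ σ (+-monoʳ-≤ p (s≤s z≤n))) le))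
    (groups-cols _ _ t i (subst (λ x → x + σ ≤ n) (sym (widen p t)) le))

  -- The new values start right after `h`, so the absolute values again form an initial interval.
  extend : ∀ {k h} (D : Design n k (mult st) h) b t →
    All (λ (l : Layer) → ¬ Zone b t (proj₁ l)) (Design.layers D) → t * 2 ≤ σ → b + t * 2 + σ ≤ n →
    Design n (k + t * 4) (mult st) (h + t * (c + c))
  extend {k} {h} D b t avoid le₁ le₂ = record
    { layers   = layers ++ gs
    ; size     = trans (length-++ layers) (cong₂ _+_ size (groups-size h b t))
    ; bounded  = All.++⁺ bounded (groups-bounded h b t le₂)
    ; distinct = AllPairs.++⁺ distinct (groups-distinct h b t le₁)
                   (All.map (λ {l} ¬z → All.map (λ {l′} z (e : proj₁ l ≡ proj₁ l′) → ¬z (subst (Zone b t) (sym e) z)) (groups-zone h b t)) avoid)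
    ; periodic = All.++⁺ periodic (groups-periodic h b t)
    ; rows     = λ i → sumℤ-0 _ layers gs (rows i) (groups-rows h b t i)
    ; cols     = λ i → sumℤ-0 _ layers gs (cols i) (groups-cols h b t i le₂)
    ; weights  = λ w → trans (weight-++ w n layers gs)
        (trans (cong₂ _+_ (weights w) (groups-weight w h b t))
        (trans (sym (*-distribˡ-+ (mult st) (∑ (w ∘ suc) h) _))
        (cong (mult st *_) (trans (cong (λ t → ∑ (w ∘ suc) h + t) (∑-ext (t * (c + c)) λ j → cong w (+-suc h j)))
          (sym (∑-split (w ∘ suc) h (t * (c + c))))))))
    }
    where
    open Design D
    gs = groups h b t

-- Joined sequences, zigzags and their distances

∑-split₃ : ∀ (f : ℕ → ℕ) a b c → ∑ f (a + b + c) ≡ ∑ f a + ∑ (λ i → f (a + i)) b + ∑ (λ i → f (a + b + i)) c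
∑-split₃ f a b c = trans (∑-split f (a + b) c) (cong (_+ ∑ (λ i → f (a + b + i)) c) (∑-split f a b))

join : ∀ {A : Set} → ℕ → (ℕ → A) → (ℕ → A) → ℕ → A
join zero    f g i       = g i
join (suc m) f g zero    = f 0
join (suc m) f g (suc i) = join m (f ∘ suc) g i

∑-join : ∀ {A : Set} (F : A → ℕ) m l (f g : ℕ → A) → ∑ (λ i → F (join m f g i)) (m + l) ≡ ∑ (λ i → F (f i)) m + ∑ (λ i → F (g i)) l
∑-join F zero    l f g = refl
∑-join F (suc m) l f g = trans (cong (λ t → F (f 0) + t) (∑-join F m l (f ∘ suc) g)) (sym (+-assoc (F (f 0)) _ _))

-- Isolates the step across the seam, from `f m` to `g 0`; the constructions choose their zigzags so
-- that it supplies a missing distance.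
∑-join-adjacent : ∀ {A : Set} (G : A → A → ℕ) m l (f g : ℕ → A) →
  ∑ (λ i → G (join (suc m) f g i) (join (suc m) f g (suc i))) (m + suc l) ≡
  ∑ (λ i → G (f i) (f (suc i))) m + (G (f m) (g 0) + ∑ (λ i → G (g i) (g (suc i))) l)
∑-join-adjacent G zero    l f g = refl
∑-join-adjacent G (suc m) l f g =
  trans (cong (λ t → G (f 0) (f 1) + t) (∑-join-adjacent G m l (f ∘ suc) g)) (sym (+-assoc (G (f 0) (f 1)) _ _))

join-right : ∀ {A : Set} m l (f g : ℕ → A) → join m f g (m + l) ≡ g l
join-right zero    l f g = refl
join-right (suc m) l f g = join-right m l (f ∘ suc) g

join-left : ∀ {A : Set} m (f g : ℕ → A) i → i < m → join m f g i ≡ f i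
join-left (suc m) f g zero    _         = refl
join-left (suc m) f g (suc i) (s≤s i<m) = join-left m (f ∘ suc) g i i<m

-- The zigzag x, y, x + s, y - s, x + 2s, y - 2s, …
zigzag : ℤ → ℤ → ℤ → ℕ → ℤ
zigzag s x y zero    = x
zigzag s x y (suc i) = zigzag (ℤ.- s) y (x ℤ.+ s) i

zigzag-gap : ∀ s x y i → ∣ zigzag s x y i ℤ.- zigzag s x y (suc i) ∣ ≡ ∣ (y ℤ.- x) ℤ.- s ℤ.* + i ∣
zigzag-gap s x y zero    = trans (ℤ.∣i-j∣≡∣j-i∣ x y) (cong ∣_∣ (lemma (y ℤ.- x) s))
  where
  lemma : ∀ e s → e ≡ e ℤ.- s ℤ.* + 0
  lemma = ℤ.solve-∀
zigzag-gap s x y (suc i) = trans (zigzag-gap (ℤ.- s) y (x ℤ.+ s) i)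
  (trans (cong ∣_∣ (lemma s x y (+ i))) (ℤ.∣-i∣≡∣i∣ ((y ℤ.- x) ℤ.- s ℤ.* + suc i)))
  where
  lemma : ∀ s x y i → (x ℤ.+ s ℤ.- y) ℤ.- (ℤ.- s) ℤ.* i ≡ ℤ.- ((y ℤ.- x) ℤ.- s ℤ.* (+ 1 ℤ.+ i))
  lemma = ℤ.solve-∀

zigzag-even : ∀ s x y j → zigzag s x y (j + j) ≡ x ℤ.+ s ℤ.* + j
zigzag-odd  : ∀ s x y j → zigzag s x y (suc (j + j)) ≡ y ℤ.- s ℤ.* + j
zigzag-even s x y zero    = lemma x s
  where
  lemma : ∀ x s → x ≡ x ℤ.+ s ℤ.* + 0
  lemma = ℤ.solve-∀
zigzag-even s x y (suc j) = trans (cong (zigzag s x y ∘ suc) (+-suc j j)) (trans (zigzag-odd (ℤ.- s) y (x ℤ.+ s) j) (lemma x s (+ j)))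
  where
  lemma : ∀ x s j → (x ℤ.+ s) ℤ.- (ℤ.- s) ℤ.* j ≡ x ℤ.+ s ℤ.* (+ 1 ℤ.+ j)
  lemma = ℤ.solve-∀
zigzag-odd s x y j = trans (zigzag-even (ℤ.- s) y (x ℤ.+ s) j) (lemma y s (+ j))
  where
  lemma : ∀ y s j → y ℤ.+ (ℤ.- s) ℤ.* j ≡ y ℤ.- s ℤ.* j
  lemma = ℤ.solve-∀

-- Meant for a zigzag that stops before its two ends meet: it leaves a hole between two
-- progressions, to be filled by another zigzag.
∑-zigzag : ∀ (F : ℤ → ℕ) s x y j →
  ∑ (λ i → F (zigzag s x y i)) (suc (j + j)) ≡ ∑ (λ i → F (x ℤ.+ s ℤ.* + i)) (suc j) + ∑ (λ i → F (y ℤ.- s ℤ.* + i)) j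
∑-zigzag F s x y zero    = trans (cong (λ z → F z + 0) (lemma x s)) (sym (+-identityʳ _))
  where
  lemma : ∀ x s → x ≡ x ℤ.+ s ℤ.* + 0
  lemma = ℤ.solve-∀
∑-zigzag F s x y (suc j) = begin
  F x + (F y + ∑ (λ i → F (zigzag (ℤ.- ℤ.- s) (x ℤ.+ s) (y ℤ.+ ℤ.- s) i)) (j + suc j))
    ≡⟨ cong₂ (λ a b → F x + (F y + ∑ (λ i → F (zigzag a (x ℤ.+ s) (y ℤ.+ ℤ.- s) i)) b)) (ℤ.neg-involutive s) (+-suc j j) ⟩
  F x + (F y + ∑ (λ i → F (zigzag s (x ℤ.+ s) (y ℤ.+ ℤ.- s) i)) (suc (j + j)))
    ≡⟨ cong (λ t → F x + (F y + t)) (∑-zigzag F s (x ℤ.+ s) (y ℤ.+ ℤ.- s) j) ⟩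
  F x + (F y + (∑ (λ i → F (x ℤ.+ s ℤ.+ s ℤ.* + i)) (suc j) + ∑ (λ i → F (y ℤ.+ ℤ.- s ℤ.- s ℤ.* + i)) j))
    ≡⟨ regroup (F x) (F y) _ _ ⟩
  (F x + ∑ (λ i → F (x ℤ.+ s ℤ.+ s ℤ.* + i)) (suc j)) + (F y + ∑ (λ i → F (y ℤ.+ ℤ.- s ℤ.- s ℤ.* + i)) j)
    ≡⟨ cong₂ _+_ (cong₂ _+_ (cong F (start x s)) (∑-ext (suc j) λ i → cong F (lemma x s (+ i))))
                 (cong₂ _+_ (cong F (start′ y s)) (∑-ext j λ i → cong F (lemma′ y s (+ i)))) ⟩
  ∑ (λ i → F (x ℤ.+ s ℤ.* + i)) (suc (suc j)) + ∑ (λ i → F (y ℤ.- s ℤ.* + i)) (suc j) ∎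
  where
  open ≡-Reasoning
  regroup : ∀ a b c d → a + (b + (c + d)) ≡ (a + c) + (b + d)
  regroup = solve-∀
  start : ∀ x s → x ≡ x ℤ.+ s ℤ.* + 0
  start = ℤ.solve-∀
  start′ : ∀ y s → y ≡ y ℤ.- s ℤ.* + 0
  start′ = ℤ.solve-∀
  lemma : ∀ x s i → x ℤ.+ s ℤ.+ s ℤ.* i ≡ x ℤ.+ s ℤ.* (+ 1 ℤ.+ i)
  lemma = ℤ.solve-∀
  lemma′ : ∀ y s i → y ℤ.+ ℤ.- s ℤ.- s ℤ.* i ≡ y ℤ.- s ℤ.* (+ 1 ℤ.+ i)
  lemma′ = ℤ.solve-∀

-- Here the ends meet. Without its first term the zigzag runs through a shorter interval starting
-- from the other end, hence the mutual recursion.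
∑-zigzag-up   : ∀ (F : ℤ → ℕ) x d → ∑ (λ i → F (zigzag (+ 1) x (x ℤ.+ + d) i)) (suc d) ≡ ∑ (λ i → F (x ℤ.+ + i)) (suc d)
∑-zigzag-down : ∀ (F : ℤ → ℕ) x d → ∑ (λ i → F (zigzag (ℤ.- + 1) (x ℤ.+ + d) x i)) (suc d) ≡ ∑ (λ i → F (x ℤ.+ + i)) (suc d)
∑-zigzag-up F x zero    = cong (_+ 0) (cong F (sym (ℤ.+-identityʳ x)))
∑-zigzag-up F x (suc d) = cong₂ _+_ (cong F (sym (ℤ.+-identityʳ x)))
  (trans (cong (λ y → ∑ (λ i → F (zigzag (ℤ.- + 1) y (x ℤ.+ + 1) i)) (suc d)) (assoc x (+ d)))
  (trans (∑-zigzag-down F (x ℤ.+ + 1) d) (∑-ext (suc d) λ i → cong F (sym (assoc x (+ i))))))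
  where
  assoc : ∀ x d → x ℤ.+ (+ 1 ℤ.+ d) ≡ x ℤ.+ + 1 ℤ.+ d
  assoc = ℤ.solve-∀
∑-zigzag-down F x zero    = refl
∑-zigzag-down F x (suc d) = begin
  F (x ℤ.+ + suc d) + ∑ (λ i → F (zigzag (+ 1) x (x ℤ.+ + suc d ℤ.+ ℤ.- + 1) i)) (suc d)
    ≡⟨ cong (λ y → F (x ℤ.+ + suc d) + ∑ (λ i → F (zigzag (+ 1) x y i)) (suc d)) (lemma x (+ d)) ⟩
  F (x ℤ.+ + suc d) + ∑ (λ i → F (zigzag (+ 1) x (x ℤ.+ + d) i)) (suc d)
    ≡⟨ cong (λ t → F (x ℤ.+ + suc d) + t) (∑-zigzag-up F x d) ⟩
  F (x ℤ.+ + suc d) + ∑ (λ i → F (x ℤ.+ + i)) (suc d)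
    ≡⟨ trans (+-comm (F (x ℤ.+ + suc d)) _) (sym (∑-snoc (λ i → F (x ℤ.+ + i)) (suc d))) ⟩
  ∑ (λ i → F (x ℤ.+ + i)) (suc (suc d)) ∎
  where
  open ≡-Reasoning
  lemma : ∀ x d → x ℤ.+ (+ 1 ℤ.+ d) ℤ.+ ℤ.- + 1 ≡ x ℤ.+ d
  lemma = ℤ.solve-∀

distance : ℤ → ℤ → ℕ
distance x y = ∣ x ℤ.- y ∣

gap-value : ∀ b L i → i < L → ∣ + (b + L) ℤ.- + i ∣ ≡ b + suc (L ∸ suc i)
gap-value b L i i<L = trans (cong (λ l → ∣ + (b + l) ℤ.- + i ∣) (sym (trans (+-suc i _) (m+[n∸m]≡n i<L))))
  (cong ∣_∣ (lemma (+ b) (+ i) (+ suc (L ∸ suc i))))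
  where
  lemma : ∀ x y z → (x ℤ.+ (y ℤ.+ z)) ℤ.- y ≡ x ℤ.+ z
  lemma = ℤ.solve-∀

∑-gaps : ∀ (w : ℕ → ℕ) b L → ∑ (λ i → w ∣ + (b + L) ℤ.- + i ∣) L ≡ ∑ (λ i → w (b + suc i)) L
∑-gaps w b L = trans (∑-cong L λ i i<L → cong w (gap-value b L i i<L)) (∑-reverse (λ i → w (b + suc i)) L)

-- Each step moves one end inwards by one, so the gaps decrease from b + L to b + 1.
∑-distance-up : ∀ (w : ℕ → ℕ) x b L →
  ∑ (λ i → w (distance (zigzag (+ 1) x (x ℤ.+ + (b + L)) i) (zigzag (+ 1) x (x ℤ.+ + (b + L)) (suc i)))) L ≡ ∑ (λ i → w (b + suc i)) L
∑-distance-up w x b L = trans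
  (∑-ext L λ i → cong w (trans (zigzag-gap (+ 1) x _ i) (cong ∣_∣ (lemma x (+ (b + L)) (+ i))))) (∑-gaps w b L)
  where
  lemma : ∀ x e i → (x ℤ.+ e ℤ.- x) ℤ.- + 1 ℤ.* i ≡ e ℤ.- i
  lemma = ℤ.solve-∀

∑-distance-down : ∀ (w : ℕ → ℕ) x b L →
  ∑ (λ i → w (distance (zigzag (ℤ.- + 1) (x ℤ.+ + (b + L)) x i) (zigzag (ℤ.- + 1) (x ℤ.+ + (b + L)) x (suc i)))) L ≡ ∑ (λ i → w (b + suc i)) L
∑-distance-down w x b L = trans
  (∑-ext L λ i → cong w (trans (zigzag-gap (ℤ.- + 1) (x ℤ.+ + (b + L)) x i)
    (trans (cong ∣_∣ (lemma x (+ (b + L)) (+ i))) (ℤ.∣-i∣≡∣i∣ (+ (b + L) ℤ.- + i))))) (∑-gaps w b L)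
  where
  lemma : ∀ x e i → (x ℤ.- (x ℤ.+ e)) ℤ.- (ℤ.- + 1) ℤ.* i ≡ ℤ.- (e ℤ.- i)
  lemma = ℤ.solve-∀

∑-cyclic : ∀ {A : Set} (G : A → A → ℕ) (f : ℕ → A) N →
  ∑ (λ i → G (f (i % suc N)) (f ((i + 1) % suc N))) (suc N) ≡ ∑ (λ i → G (f i) (f (suc i))) N + G (f N) (f 0)
∑-cyclic G f N = trans (∑-snoc _ N) (cong₂ _+_
  (∑-cong N λ i i<N → cong₂ (λ a b → G (f a) (f b)) (m<n⇒m%n≡m (m<n⇒m<1+n i<N))
     (trans (cong (_% suc N) (+-comm i 1)) (m<n⇒m%n≡m (s≤s i<N))))
  (cong₂ (λ a b → G (f a) (f b)) (m<n⇒m%n≡m (n<1+n N)) (trans (cong (_% suc N) (+-comm N 1)) (n%n≡0 (suc N)))))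

-- Three layers

alternate : ℤ → ℕ → ℤ → ℤ
alternate K zero    x = x
alternate K (suc i) x = K ℤ.- alternate K i x

alternate-even : ∀ K j x → alternate K (j + j) x ≡ x
alternate-even K zero    x = refl
alternate-even K (suc j) x = trans (cong (λ i → K ℤ.- alternate K i x) (+-suc j j))
  (trans (cong (λ y → K ℤ.- (K ℤ.- y)) (alternate-even K j x)) (lemma K x))
  where
  lemma : ∀ K x → K ℤ.- (K ℤ.- x) ≡ x
  lemma = ℤ.solve-∀

alternate-invariant : ∀ (F : ℤ → ℕ) K → (∀ x → F (K ℤ.- x) ≡ F x) → ∀ i x → F (alternate K i x) ≡ F x
alternate-invariant F K inv zero    x = refl
alternate-invariant F K inv (suc i) x = trans (inv (alternate K i x)) (alternate-invariant F K inv i x)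

-- Of two neighbours exactly one is reflected, so K cancels and their sum turns into ± a difference.
-- This is how the middle layer of `Three` comes to carry distances.
alternate-distance : ∀ K i x y → ∣ alternate K i x ℤ.+ alternate K (suc i) y ℤ.- K ∣ ≡ distance x y
alternate-distance K zero    x y = cong ∣_∣ (lemma K x y)
  where
  lemma : ∀ K x y → x ℤ.+ (K ℤ.- y) ℤ.- K ≡ x ℤ.- y
  lemma = ℤ.solve-∀
alternate-distance K (suc i) x y = trans (cong ∣_∣ (lemma K (alternate K i x) (alternate K (suc i) y)))
  (trans (ℤ.∣-i∣≡∣i∣ (alternate K i x ℤ.+ alternate K (suc i) y ℤ.- K)) (alternate-distance K i x y))
  where
  lemma : ∀ K a b → (K ℤ.- a) ℤ.+ (K ℤ.- b) ℤ.- K ≡ ℤ.- (a ℤ.+ b ℤ.- K)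
  lemma = ℤ.solve-∀

-- Three consecutive layers v i, K - v i - v (i + 1), v (i + 1) - K; rows and columns
-- sum to zero for every choice of v.
module Three (N : ℕ) (2≤N : 2 ≤ N) (K : ℤ) (v : ℕ → ℤ) where

  private
    n = suc N
    V : ℕ → ℤ
    V i = v (i % n)

    V-periodic : ∀ i → V (i + n) ≡ V i
    V-periodic i = cong v ([m+n]%n≡m%n i n)

    V-periodic′ : ∀ i → V (i + n + 1) ≡ V (i + 1)
    V-periodic′ i = trans (cong V (lemma i n)) (V-periodic (i + 1))
      where
      lemma : ∀ i n → i + n + 1 ≡ i + 1 + n
      lemma = solve-∀

  layers : List Layer
  layers = (0 , V) ∷ (1 , λ i → ℤ.- (V i ℤ.+ V (i + 1) ℤ.- K)) ∷ (2 , λ i → V (i + 1) ℤ.- K) ∷ []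

  design : ∀ {μ h} →
    (∀ w → ∑ (λ i → (w ∣ v i ∣) + (w ∣ v i ℤ.- K ∣)) n +
           (∑ (λ i → w ∣ v i ℤ.+ v (suc i) ℤ.- K ∣) N + (w ∣ v N ℤ.+ v 0 ℤ.- K ∣)) ≡ μ * ∑ (w ∘ suc) h) →
    Design n 3 μ h
  design total = record
    { layers   = layers
    ; size     = refl
    ; bounded  = s≤s z≤n ∷ s≤s (≤-trans (s≤s z≤n) 2≤N) ∷ s≤s 2≤N ∷ []
    ; distinct = ((λ ()) ∷ (λ ()) ∷ []) ∷ ((λ ()) ∷ []) ∷ [] ∷ []
    ; periodic = V-periodic ∷ (λ i → cong₂ (λ a b → ℤ.- (a ℤ.+ b ℤ.- K)) (V-periodic i) (V-periodic′ i))
               ∷ (λ i → cong (ℤ._- K) (V-periodic′ i)) ∷ []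
    ; rows     = λ i → row-zero (V i) (V (i + 1)) K
    ; cols     = λ i → trans (colSum-≡ {2} {n} i layers (m≤n⇒m≤1+n 2≤N) (z≤n ∷ s≤s z≤n ∷ s≤s (s≤s z≤n) ∷ [])) (col-zero (i + (n ∸ 2)))
    ; weights  = λ w → trans (cong₂ (λ a b → a + (b + (∑ (λ i → w ∣ V (i + 1) ℤ.- K ∣) n + 0)))
                   (∑-% {n} (λ i → w ∣ v i ∣)) (∑-neg {n} w (λ i → V i ℤ.+ V (i + 1) ℤ.- K) n))
        (trans (cong₂ (λ a b → ∑ (λ i → w ∣ v i ∣) n + (a + (b + 0)))
                   (∑-cyclic (λ x y → w ∣ x ℤ.+ y ℤ.- K ∣) v N)
                   (∑-%-shift {n} (λ i → w ∣ v i ℤ.- K ∣) 1))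
        (trans (regroup (∑ (λ i → w ∣ v i ∣) n) (closed w) _)
        (trans (cong (_+ closed w) (sym (∑-distrib (λ i → w ∣ v i ∣) (λ i → w ∣ v i ℤ.- K ∣) n))) (total w))))
    }
    where
    row-zero : ∀ a b K → a ℤ.+ (ℤ.- (a ℤ.+ b ℤ.- K) ℤ.+ (b ℤ.- K ℤ.+ + 0)) ≡ + 0
    row-zero = ℤ.solve-∀
    col-identity : ∀ a b K → a ℤ.+ (ℤ.- (b ℤ.+ a ℤ.- K) ℤ.+ (b ℤ.- K ℤ.+ + 0)) ≡ + 0
    col-identity = ℤ.solve-∀
    col-zero : ∀ i → colSum 2 i layers ≡ + 0
    col-zero i = trans (cong₂ (λ a b → V (i + 2) ℤ.+ (ℤ.- (V (i + 1) ℤ.+ V a ℤ.- K) ℤ.+ (V b ℤ.- K ℤ.+ + 0)))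
        (+-assoc i 1 1) (cong (_+ 1) (+-identityʳ i)))
      (col-identity (V (i + 2)) (V (i + 1)) K)
    regroup : ∀ a b c → a + (b + (c + 0)) ≡ a + c + b
    regroup = solve-∀
    closed : (ℕ → ℕ) → ℕ
    closed w = ∑ (λ i → w ∣ v i ℤ.+ v (suc i) ℤ.- K ∣) N + (w ∣ v N ℤ.+ v 0 ℤ.- K ∣)

double-weight : (ℕ → ℕ) → ℤ → ℤ → ℕ
double-weight w K z = (w ∣ z ∣) + (w ∣ z ℤ.- K ∣)

-- The reflection exchanges the two entries that a label contributes to the outer layers of `Three`.
-- These layers therefore do not notice which labels are reflected.
double-weight-invariant : ∀ w K z → double-weight w K (K ℤ.- z) ≡ double-weight w K z
double-weight-invariant w K z = trans (cong₂ (λ a b → w a + w b) (ℤ.∣i-j∣≡∣j-i∣ K z)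
    (trans (cong ∣_∣ (lemma K z)) (ℤ.∣-i∣≡∣i∣ z))) (+-comm (w ∣ z ℤ.- K ∣) (w ∣ z ∣))
  where
  lemma : ∀ K z → K ℤ.- z ℤ.- K ≡ ℤ.- z
  lemma = ℤ.solve-∀

distance-sym : ∀ x y → distance x y ≡ distance y x
distance-sym = ℤ.∣i-j∣≡∣j-i∣

-- The labels m + 1, …, 3m in a cyclic order for which each distance 1, …, m occurs twice:
-- a zigzag through the lower half, followed by its reversed translate through the upper half.
module EvenThree (m′ : ℕ) (1≤m′ : 1 ≤ m′) where

  private
    m n : ℕ
    m = suc m′
    n = m + m
    x : ℤ
    x = + suc m
    a b p v : ℕ → ℤ
    a = zigzag (+ 1) x (x ℤ.+ + m′)
    b j = a (m′ ∸ j) ℤ.+ + m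
    p = join m a b
    v i = alternate (+ 0) i (p i)

    N : ℕ
    N = m′ + suc m′

    translate-distance : ∀ x y t → distance (x ℤ.+ t) (y ℤ.+ t) ≡ distance x y
    translate-distance x y t = cong ∣_∣ (lemma x y t)
      where
      lemma : ∀ x y t → x ℤ.+ t ℤ.- (y ℤ.+ t) ≡ x ℤ.- y
      lemma = ℤ.solve-∀

    -- As n is even, the last label is reflected and the first is not, so the closing entry is a
    -- distance too: from x + m back to x.
    closing : ∣ v N ℤ.+ v 0 ℤ.- + 0 ∣ ≡ m
    closing = begin
      ∣ alternate (+ 0) N (p N) ℤ.+ x ℤ.- + 0 ∣
        ≡⟨ cong (λ z → ∣ alternate (+ 0) N z ℤ.+ x ℤ.- + 0 ∣) (trans (cong p (+-suc m′ m′)) (trans (join-right m m′ a b) (cong (λ i → a i ℤ.+ + m) (n∸n≡0 m′)))) ⟩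
      ∣ alternate (+ 0) N (x ℤ.+ + m) ℤ.+ x ℤ.- + 0 ∣
        ≡⟨ cong (λ i → ∣ alternate (+ 0) i (x ℤ.+ + m) ℤ.+ x ℤ.- + 0 ∣) (+-suc m′ m′) ⟩
      ∣ (+ 0 ℤ.- alternate (+ 0) (m′ + m′) (x ℤ.+ + m)) ℤ.+ x ℤ.- + 0 ∣
        ≡⟨ cong (λ z → ∣ (+ 0 ℤ.- z) ℤ.+ x ℤ.- + 0 ∣) (alternate-even (+ 0) m′ (x ℤ.+ + m)) ⟩
      ∣ (+ 0 ℤ.- (x ℤ.+ + m)) ℤ.+ x ℤ.- + 0 ∣
        ≡⟨ cong ∣_∣ (lemma x (+ m)) ⟩
      m ∎
      where
      open ≡-Reasoning
      lemma : ∀ x m → (+ 0 ℤ.- (x ℤ.+ m)) ℤ.+ x ℤ.- + 0 ≡ ℤ.- m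
      lemma = ℤ.solve-∀

    distances : ∀ (w : ℕ → ℕ) → ∑ (λ i → w ∣ v i ℤ.+ v (suc i) ℤ.- + 0 ∣) N ≡ ∑ (w ∘ suc) m′ + (w m + ∑ (w ∘ suc) m′)
    distances w = begin
      ∑ (λ i → w ∣ v i ℤ.+ v (suc i) ℤ.- + 0 ∣) N
        ≡⟨ ∑-ext N (λ i → cong w (alternate-distance (+ 0) i (p i) (p (suc i)))) ⟩
      ∑ (λ i → w (distance (p i) (p (suc i)))) N
        ≡⟨ ∑-join-adjacent (λ y z → w (distance y z)) m′ m′ a b ⟩
      ∑ g m′ + (w (distance (a m′) (b 0)) + ∑ (λ i → w (distance (b i) (b (suc i)))) m′)
        ≡⟨ cong₂ (λ s t → ∑ g m′ + (s + t)) (cong w middle)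
             (trans (∑-cong m′ backwards) (∑-reverse g m′)) ⟩
      ∑ g m′ + (w m + ∑ g m′)
        ≡⟨ cong (λ s → s + (w m + s)) (∑-distance-up w x 0 m′) ⟩
      ∑ (w ∘ suc) m′ + (w m + ∑ (w ∘ suc) m′) ∎
      where
      open ≡-Reasoning
      g : ℕ → ℕ
      g i = w (distance (a i) (a (suc i)))
      middle : distance (a m′) (b 0) ≡ m
      middle = cong ∣_∣ (lemma (a m′) (+ m))
        where
        lemma : ∀ y m → y ℤ.- (y ℤ.+ m) ≡ ℤ.- m
        lemma = ℤ.solve-∀
      backwards : ∀ i → i < m′ → w (distance (b i) (b (suc i))) ≡ g (m′ ∸ suc i)
      backwards i i<m′ = cong w (trans (translate-distance (a (m′ ∸ i)) (a (m′ ∸ suc i)) (+ m))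
        (trans (distance-sym (a (m′ ∸ i)) (a (m′ ∸ suc i))) (cong (λ j → distance (a (m′ ∸ suc i)) (a j)) (+-∸-assoc 1 i<m′))))

    labels : ∀ w → ∑ (λ i → double-weight w (+ 0) (v i)) n ≡
      2 * (∑ (λ i → w (m + suc i)) m + ∑ (λ i → w (m + m + suc i)) m)
    labels w = begin
      ∑ (λ i → F (v i)) n
        ≡⟨ ∑-ext n (λ i → alternate-invariant F (+ 0) (double-weight-invariant w (+ 0)) i (p i)) ⟩
      ∑ (λ i → F (p i)) n
        ≡⟨ ∑-join F m m a b ⟩
      ∑ (λ i → F (a i)) m + ∑ (λ i → F (b i)) m
        ≡⟨ cong₂ _+_ (∑-zigzag-up F x m′) (trans (∑-reverse (λ i → F (a i ℤ.+ + m)) m) (∑-zigzag-up (λ z → F (z ℤ.+ + m)) x m′)) ⟩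
      ∑ (λ i → F (+ (suc m + i))) m + ∑ (λ i → F (+ (suc m + i + m))) m
        ≡⟨ cong₂ _+_ (twice (λ i → m + suc i) (λ i → suc m + i) (λ i → sym (+-suc m i)))
             (twice (λ i → m + m + suc i) (λ i → suc m + i + m) (λ i → index m i)) ⟩
      2 * ∑ (λ i → w (m + suc i)) m + 2 * ∑ (λ i → w (m + m + suc i)) m
        ≡⟨ *-distribˡ-+ 2 (∑ (λ i → w (m + suc i)) m) _ ⟨
      2 * (∑ (λ i → w (m + suc i)) m + ∑ (λ i → w (m + m + suc i)) m) ∎
      where
      open ≡-Reasoning
      F = double-weight w (+ 0)
      index : ∀ m i → suc m + i + m ≡ m + m + suc i
      index = solve-∀
      plus : ∀ s → s + s ≡ 2 * s
      plus = solve-∀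
      twice : ∀ (f g : ℕ → ℕ) → (∀ i → g i ≡ f i) → ∑ (λ i → F (+ g i)) m ≡ 2 * ∑ (λ i → w (f i)) m
      twice f g e = trans (∑-ext m λ i → cong₂ (λ s t → w s + w t) (e i) (trans (+-identityʳ (g i)) (e i)))
        (trans (∑-distrib (w ∘ f) (w ∘ f) m) (plus (∑ (w ∘ f) m)))

  design : Design n 3 2 (m + m + m)
  design = Three.design N (+-mono-≤ 1≤m′ (s≤s z≤n)) (+ 0) v λ w → begin
    ∑ (λ i → double-weight w (+ 0) (v i)) n + (∑ (λ i → w ∣ v i ℤ.+ v (suc i) ℤ.- + 0 ∣) N + (w ∣ v N ℤ.+ v 0 ℤ.- + 0 ∣))
      ≡⟨ cong₂ _+_ (labels w) (cong₂ _+_ (distances w) (cong w closing)) ⟩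
    2 * (A w + B w) + (C w + (w m + C w) + w m)
      ≡⟨ regroup (A w) (B w) (C w) (w m) ⟩
    2 * (C w + w m + A w + B w)
      ≡⟨ cong (λ s → 2 * (s + A w + B w)) (∑-snoc (w ∘ suc) m′) ⟨
    2 * (∑ (w ∘ suc) m + A w + B w)
      ≡⟨ cong (2 *_) (cong₂ (λ s t → ∑ (w ∘ suc) m + s + t) (∑-ext m λ i → cong w (+-suc m i)) (∑-ext m λ i → cong w (+-suc (m + m) i))) ⟩
    2 * (∑ (w ∘ suc) m + ∑ (λ i → w (suc (m + i))) m + ∑ (λ i → w (suc (m + m + i))) m)
      ≡⟨ cong (2 *_) (∑-split₃ (w ∘ suc) m m m) ⟨
    2 * ∑ (w ∘ suc) (m + m + m) ∎
    where
    open ≡-Reasoning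
    A B C : (ℕ → ℕ) → ℕ
    A w = ∑ (λ i → w (m + suc i)) m
    B w = ∑ (λ i → w (m + m + suc i)) m
    C w = ∑ (w ∘ suc) m′
    regroup : ∀ a b c d → 2 * (a + b) + (c + (d + c) + d) ≡ 2 * (c + d + a + b)
    regroup = solve-∀

-- Two zigzags through the labels n + 1, …, 2n, of lengths 2a and 2a + 1, the first one
-- filling the gap left by the second; the distances are 1, …, n - 1, and n occurs when
-- the sequence is continued by reflected labels.
module OddThree (a′ : ℕ) where

  private
    a d n N : ℕ
    a = suc a′
    d = suc (a′ + a′)
    N = d + suc (a + a)
    n = suc N
    K x₁ x₂ : ℤ
    -- With K = 4n + 1 the reflection takes the labels n + 1, ..., 2n to 2n + 1, ..., 3n.
    K = + (n + n + n + suc n)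
    x₁ = + (n + suc (suc a))
    x₂ = + (n + 1)
    f g p v : ℕ → ℤ
    f = zigzag (ℤ.- + 1) (x₁ ℤ.+ + d) x₁
    g = zigzag (+ 1) x₂ (x₂ ℤ.+ + (a + a + (a + a)))
    p = join (suc d) f g
    v i = alternate K i (p i)

    d≡ : suc d ≡ a + a
    d≡ = cong suc (sym (+-suc a′ a′))

    -- As n = 4a + 1 is odd, neither the first nor the last label is reflected, and the closing
    -- entry is not a distance. The end labels n + 3a + 1 and n + a + 1 have the sum 3n + 1 = K - n.
    closing : ∣ v N ℤ.+ v 0 ℤ.- K ∣ ≡ n
    closing = trans (cong (λ z → ∣ z ℤ.+ (x₁ ℤ.+ + d) ℤ.- K ∣) last)
      (cong ∣_∣ (lemma (+ a′)))
      where
      N-even : N ≡ (a + a) + (a + a)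
      N-even = trans (+-suc d (a + a)) (cong (_+ (a + a)) d≡)
      last : v N ≡ x₂ ℤ.+ + a
      last = begin
        alternate K N (p N)                     ≡⟨ cong (λ i → alternate K i (p N)) N-even ⟩
        alternate K ((a + a) + (a + a)) (p N)   ≡⟨ alternate-even K (a + a) (p N) ⟩
        p N                                     ≡⟨ trans (cong p (+-suc d (a + a))) (join-right (suc d) (a + a) f g) ⟩
        g (a + a)                               ≡⟨ zigzag-even (+ 1) x₂ (x₂ ℤ.+ + (a + a + (a + a))) a ⟩
        x₂ ℤ.+ + 1 ℤ.* + a                      ≡⟨ cong (λ t → x₂ ℤ.+ t) (ℤ.*-identityˡ (+ a)) ⟩
        x₂ ℤ.+ + a                              ∎
        where open ≡-Reasoning
      lemma : ∀ a → let A = + 1 ℤ.+ a ; D = + 1 ℤ.+ (a ℤ.+ a) ; M = + 1 ℤ.+ (D ℤ.+ (+ 1 ℤ.+ (A ℤ.+ A))) in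
        (M ℤ.+ + 1) ℤ.+ A ℤ.+ ((M ℤ.+ (+ 1 ℤ.+ (+ 1 ℤ.+ A))) ℤ.+ D) ℤ.- (M ℤ.+ M ℤ.+ M ℤ.+ (+ 1 ℤ.+ M)) ≡ ℤ.- M
      lemma = ℤ.solve-∀

    -- The inner zigzag gives 1, ..., 2a - 1, the seam 2a, and the outer zigzag 2a + 1, ..., 4a.
    distances : ∀ (w : ℕ → ℕ) → ∑ (λ i → w ∣ v i ℤ.+ v (suc i) ℤ.- K ∣) N ≡ ∑ (w ∘ suc) (suc d + (a + a))
    distances w = begin
      ∑ (λ i → w ∣ v i ℤ.+ v (suc i) ℤ.- K ∣) N
        ≡⟨ ∑-ext N (λ i → cong w (alternate-distance K i (p i) (p (suc i)))) ⟩
      ∑ (λ i → w (distance (p i) (p (suc i)))) N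
        ≡⟨ ∑-join-adjacent (λ y z → w (distance y z)) d (a + a) f g ⟩
      ∑ (λ i → w (distance (f i) (f (suc i)))) d + (w (distance (f d) (g 0)) + ∑ (λ i → w (distance (g i) (g (suc i)))) (a + a))
        ≡⟨ cong₂ _+_ (∑-distance-down w x₁ 0 d) (cong₂ _+_ (cong w middle) (∑-distance-up w x₂ (a + a) (a + a))) ⟩
      ∑ (w ∘ suc) d + (w (suc d) + ∑ (λ i → w (a + a + suc i)) (a + a))
        ≡⟨ +-assoc (∑ (w ∘ suc) d) _ _ ⟨
      ∑ (w ∘ suc) d + w (suc d) + ∑ (λ i → w (a + a + suc i)) (a + a)
        ≡⟨ cong₂ _+_ (sym (∑-snoc (w ∘ suc) d)) (∑-ext (a + a) λ i → cong w (trans (+-suc (a + a) i) (cong (λ t → suc (t + i)) (sym d≡)))) ⟩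
      ∑ (w ∘ suc) (suc d) + ∑ (λ i → w (suc (suc d + i))) (a + a)
        ≡⟨ ∑-split (w ∘ suc) (suc d) (a + a) ⟨
      ∑ (w ∘ suc) (suc d + (a + a)) ∎
      where
      open ≡-Reasoning
      middle : distance (f d) (g 0) ≡ suc d
      middle = trans (cong (λ z → distance z x₂) (zigzag-odd (ℤ.- + 1) (x₁ ℤ.+ + d) x₁ a′)) (cong ∣_∣ (lemma (+ n) (+ a′)))
        where
        lemma : ∀ n a → n ℤ.+ (+ 1 ℤ.+ (+ 1 ℤ.+ (+ 1 ℤ.+ a))) ℤ.- (ℤ.- + 1) ℤ.* a ℤ.- (n ℤ.+ + 1) ≡ + 1 ℤ.+ (+ 1 ℤ.+ (a ℤ.+ a))
        lemma = ℤ.solve-∀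

    labels : ∀ w → ∑ (λ i → double-weight w K (v i)) n ≡ ∑ (λ i → w (n + suc i)) n + ∑ (λ i → w (n + n + suc i)) n
    labels w = begin
      ∑ (λ i → F (v i)) n
        ≡⟨ ∑-ext n (λ i → alternate-invariant F K (double-weight-invariant w K) i (p i)) ⟩
      ∑ (λ i → F (p i)) (suc d + suc (a + a))
        ≡⟨ ∑-join F (suc d) (suc (a + a)) f g ⟩
      ∑ (λ i → F (f i)) (suc d) + ∑ (λ i → F (g i)) (suc (a + a))
        ≡⟨ cong₂ _+_ (∑-zigzag-down F x₁ d) (∑-zigzag F (+ 1) x₂ (x₂ ℤ.+ + (a + a + (a + a))) a) ⟩
      ∑ (λ i → F (x₁ ℤ.+ + i)) (suc d) + (∑ (λ i → F (x₂ ℤ.+ + 1 ℤ.* + i)) (suc a) + ∑ (λ i → F (x₂ ℤ.+ + (a + a + (a + a)) ℤ.- + 1 ℤ.* + i)) a)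
        ≡⟨ cong₂ _+_ (∑-ext (suc d) λ i → cong (F ∘ +_) (+-assoc n (suc (suc a)) i))
             (cong₂ _+_ (∑-ext (suc a) λ i → cong F (low (+ n) (+ i)))
               (trans (∑-cong a λ i i<a → cong F (high i i<a)) (∑-reverse (λ i → φ (suc a + suc d + i)) a))) ⟩
      ∑ (λ i → φ (suc a + i)) (suc d) + (∑ φ (suc a) + ∑ (λ i → φ (suc a + suc d + i)) a)
        ≡⟨ regroup (∑ (λ i → φ (suc a + i)) (suc d)) (∑ φ (suc a)) (∑ (λ i → φ (suc a + suc d + i)) a) ⟩
      ∑ φ (suc a) + ∑ (λ i → φ (suc a + i)) (suc d) + ∑ (λ i → φ (suc a + suc d + i)) a
        ≡⟨ ∑-split₃ φ (suc a) (suc d) a ⟨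
      ∑ φ (suc a + suc d + a)
        ≡⟨ cong (∑ φ) (number a d) ⟩
      ∑ φ n
        ≡⟨ ∑-distrib (λ i → w (n + suc i)) (λ i → w ∣ + (n + suc i) ℤ.- K ∣) n ⟩
      ∑ (λ i → w (n + suc i)) n + ∑ (λ i → w ∣ + (n + suc i) ℤ.- K ∣) n
        ≡⟨ cong (λ t → ∑ (λ i → w (n + suc i)) n + t)
             (trans (∑-cong n λ i i<n → cong w (reflected i i<n)) (∑-reverse (λ i → w (n + n + suc i)) n)) ⟩
      ∑ (λ i → w (n + suc i)) n + ∑ (λ i → w (n + n + suc i)) n ∎
      where
      open ≡-Reasoning
      F = double-weight w K
      φ : ℕ → ℕ
      φ i = F (+ (n + suc i))
      regroup : ∀ a b c → a + (b + c) ≡ b + a + c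
      regroup = solve-∀
      number : ∀ a d → suc a + suc d + a ≡ suc (d + suc (a + a))
      number = solve-∀
      low : ∀ n i → n ℤ.+ + 1 ℤ.+ + 1 ℤ.* i ≡ n ℤ.+ (+ 1 ℤ.+ i)
      low = ℤ.solve-∀
      high : ∀ i → i < a → x₂ ℤ.+ + (a + a + (a + a)) ℤ.- + 1 ℤ.* + i ≡ + (n + suc (suc a + suc d + (a ∸ suc i)))
      high i i<a = trans (cong (λ t → x₂ ℤ.+ + (a + a + (a + t)) ℤ.- + 1 ℤ.* + i) (sym (m+[n∸m]≡n i<a)))
        (trans (lemma (+ n) (+ a) (+ i) (+ (a ∸ suc i))) (cong (λ t → + (n + suc (suc a + t + (a ∸ suc i)))) (sym d≡)))
        where
        lemma : ∀ n a i j → n ℤ.+ + 1 ℤ.+ (a ℤ.+ a ℤ.+ (a ℤ.+ (+ 1 ℤ.+ (i ℤ.+ j)))) ℤ.- + 1 ℤ.* i ≡ n ℤ.+ (+ 1 ℤ.+ ((+ 1 ℤ.+ a) ℤ.+ (a ℤ.+ a) ℤ.+ j))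
        lemma = ℤ.solve-∀
      reflected : ∀ i → i < n → ∣ + (n + suc i) ℤ.- K ∣ ≡ n + n + suc (n ∸ suc i)
      reflected i i<n = trans (cong (λ t → ∣ + (n + suc i) ℤ.- + (n + n + n + suc t) ∣) (sym (m+[n∸m]≡n i<n)))
        (trans (cong ∣_∣ (lemma (+ n) (+ i) (+ (n ∸ suc i)))) (ℤ.∣-i∣≡∣i∣ (+ (n + n + suc (n ∸ suc i)))))
        where
        lemma : ∀ n i j → n ℤ.+ (+ 1 ℤ.+ i) ℤ.- (n ℤ.+ n ℤ.+ n ℤ.+ (+ 1 ℤ.+ (+ 1 ℤ.+ i ℤ.+ j))) ≡ ℤ.- (n ℤ.+ n ℤ.+ (+ 1 ℤ.+ j))
        lemma = ℤ.solve-∀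

  design : Design n 3 1 (n + n + n)
  design = Three.design N (+-mono-≤ {1} {d} {1} (s≤s z≤n) (s≤s z≤n)) K v λ w → begin
    ∑ (λ i → double-weight w K (v i)) n + (∑ (λ i → w ∣ v i ℤ.+ v (suc i) ℤ.- K ∣) N + (w ∣ v N ℤ.+ v 0 ℤ.- K ∣))
      ≡⟨ cong₂ _+_ (labels w) (cong₂ _+_ (trans (distances w) (cong (∑ (w ∘ suc)) (sym (+-suc d (a + a))))) (cong w closing)) ⟩
    A w + B w + (∑ (w ∘ suc) N + w n)
      ≡⟨ cong (λ t → A w + B w + t) (∑-snoc (w ∘ suc) N) ⟨
    A w + B w + ∑ (w ∘ suc) n
      ≡⟨ regroup (A w) (B w) (∑ (w ∘ suc) n) ⟩
    ∑ (w ∘ suc) n + A w + B w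
      ≡⟨ cong₂ (λ s t → ∑ (w ∘ suc) n + s + t) (∑-ext n λ i → cong w (+-suc n i)) (∑-ext n λ i → cong w (+-suc (n + n) i)) ⟩
    ∑ (w ∘ suc) n + ∑ (λ i → w (suc (n + i))) n + ∑ (λ i → w (suc (n + n + i))) n
      ≡⟨ ∑-split₃ (w ∘ suc) n n n ⟨
    ∑ (w ∘ suc) (n + n + n)
      ≡⟨ *-identityˡ _ ⟨
    1 * ∑ (w ∘ suc) (n + n + n) ∎
    where
    open ≡-Reasoning
    A B : (ℕ → ℕ) → ℕ
    A w = ∑ (λ i → w (n + suc i)) n
    B w = ∑ (λ i → w (n + n + suc i)) n
    regroup : ∀ a b c → a + b + c ≡ c + a + b
    regroup = solve-∀

-- Five layers, n odd

-- A layer of differences v (i + 1) - v i, compensated in the rows by one pair of layers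
-- of shape v and in the columns by another.
module Five (N : ℕ) (4≤N : 4 ≤ N) (v : ℕ → ℤ) where

  private
    n : ℕ
    n = suc N
    c : ℤ
    -- The 2n integers -n, ..., n - 1, translated by c + 1 and by 2c + 1, become n + 1, ..., 3n and
    -- 3n + 1, ..., 5n.
    c = + (n + n)
    V : ℕ → ℤ
    V i = v (i % n)

    V-periodic : ∀ s i → V (i + n + s) ≡ V (i + s)
    V-periodic s i = trans (cong V (lemma i n s)) (cong v ([m+n]%n≡m%n (i + s) n))
      where
      lemma : ∀ i n s → i + n + s ≡ i + s + n
      lemma = solve-∀

  layers : List Layer
  layers = (0 , λ i → V (i + 1) ℤ.- V (i + 0))
         ∷ (1 , λ i → V (i + 0) ℤ.+ (c ℤ.+ + 1))
         ∷ (2 , λ i → ℤ.- (V (i + 1) ℤ.+ (c ℤ.+ c ℤ.+ + 1)))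
         ∷ (4 , λ i → V (i + 4) ℤ.- c)
         ∷ (3 , λ i → ℤ.- (V (i + 4) ℤ.- (c ℤ.+ c)))
         ∷ []

  copies : (ℕ → ℕ) → ℤ → ℕ
  copies w z = ((w ∣ z ℤ.+ (c ℤ.+ + 1) ∣) + (w ∣ z ℤ.+ (c ℤ.+ c ℤ.+ + 1) ∣)) + ((w ∣ z ℤ.- c ∣) + (w ∣ z ℤ.- (c ℤ.+ c) ∣))

  design : ∀ {μ h} →
    (∀ (w : ℕ → ℕ) → ∑ (λ i → w (distance (v i) (v (suc i)))) N + w (distance (v N) (v 0)) + ∑ (λ i → copies w (v i)) n ≡ μ * ∑ (w ∘ suc) h) →
    Design n 5 μ h
  design total = record
    { layers   = layers
    ; size     = refl
    ; bounded  = s≤s z≤n ∷ s≤s (≤-trans (s≤s z≤n) 4≤N) ∷ s≤s (≤-trans (s≤s (s≤s z≤n)) 4≤N) ∷ s≤s 4≤N ∷ s≤s (≤-trans (s≤s (s≤s (s≤s z≤n))) 4≤N) ∷ []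
    ; distinct = ((λ ()) ∷ (λ ()) ∷ (λ ()) ∷ (λ ()) ∷ []) ∷ ((λ ()) ∷ (λ ()) ∷ (λ ()) ∷ []) ∷ ((λ ()) ∷ (λ ()) ∷ []) ∷ ((λ ()) ∷ []) ∷ [] ∷ []
    ; periodic = (λ i → cong₂ ℤ._-_ (V-periodic 1 i) (V-periodic 0 i))
               ∷ (λ i → cong (ℤ._+ (c ℤ.+ + 1)) (V-periodic 0 i))
               ∷ (λ i → cong (λ a → ℤ.- (a ℤ.+ (c ℤ.+ c ℤ.+ + 1))) (V-periodic 1 i))
               ∷ (λ i → cong (ℤ._- c) (V-periodic 4 i))
               ∷ (λ i → cong (λ a → ℤ.- (a ℤ.- (c ℤ.+ c))) (V-periodic 4 i)) ∷ []
    ; rows     = λ i → row-zero (V (i + 0)) (V (i + 1)) (V (i + 4)) c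
    ; cols     = λ i → trans (colSum-≡ {4} {n} i layers (m≤n⇒m≤1+n 4≤N) (z≤n ∷ s≤s z≤n ∷ s≤s (s≤s z≤n) ∷ ≤-refl ∷ s≤s (s≤s (s≤s z≤n)) ∷ [])) (col-zero (i + (n ∸ 4)))
    ; weights  = λ w → trans (cong₂ _+_ (trans (∑-ext n λ i → cong w (trans (distance-sym (V (i + 1)) (V (i + 0))) (cong (λ j → distance (V j) (V (i + 1))) (+-identityʳ i))))
                                               (∑-cyclic (λ x y → w (distance x y)) v N))
          (cong₂ _+_ (∑-%-shift {n} (λ i → w ∣ v i ℤ.+ (c ℤ.+ + 1) ∣) 0)
          (cong₂ _+_ (trans (∑-neg {n} w (λ i → V (i + 1) ℤ.+ (c ℤ.+ c ℤ.+ + 1)) n) (∑-%-shift {n} (λ i → w ∣ v i ℤ.+ (c ℤ.+ c ℤ.+ + 1) ∣) 1))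
          (cong₂ _+_ (∑-%-shift {n} (λ i → w ∣ v i ℤ.- c ∣) 4)
          (cong (_+ 0) (trans (∑-neg {n} w (λ i → V (i + 4) ℤ.- (c ℤ.+ c)) n) (∑-%-shift {n} (λ i → w ∣ v i ℤ.- (c ℤ.+ c) ∣) 4)))))))
        (trans (regroup (∑ (λ i → w (distance (v i) (v (suc i)))) N + w (distance (v N) (v 0))) (P w) (Q w) (R w) (S w))
        (trans (cong (λ t → ∑ (λ i → w (distance (v i) (v (suc i)))) N + w (distance (v N) (v 0)) + t)
          (trans (cong₂ _+_ (sym (∑-distrib (λ i → w ∣ v i ℤ.+ (c ℤ.+ + 1) ∣) (λ i → w ∣ v i ℤ.+ (c ℤ.+ c ℤ.+ + 1) ∣) n))
                            (sym (∑-distrib (λ i → w ∣ v i ℤ.- c ∣) (λ i → w ∣ v i ℤ.- (c ℤ.+ c) ∣) n)))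
                 (sym (∑-distrib (λ i → (w ∣ v i ℤ.+ (c ℤ.+ + 1) ∣) + (w ∣ v i ℤ.+ (c ℤ.+ c ℤ.+ + 1) ∣)) (λ i → (w ∣ v i ℤ.- c ∣) + (w ∣ v i ℤ.- (c ℤ.+ c) ∣)) n))))
          (total w)))
    }
    where
    P Q R S : (ℕ → ℕ) → ℕ
    P w = ∑ (λ i → w ∣ v i ℤ.+ (c ℤ.+ + 1) ∣) n
    Q w = ∑ (λ i → w ∣ v i ℤ.+ (c ℤ.+ c ℤ.+ + 1) ∣) n
    R w = ∑ (λ i → w ∣ v i ℤ.- c ∣) n
    S w = ∑ (λ i → w ∣ v i ℤ.- (c ℤ.+ c) ∣) n
    row-zero : ∀ x y z c → (y ℤ.- x) ℤ.+ (x ℤ.+ (c ℤ.+ + 1) ℤ.+ (ℤ.- (y ℤ.+ (c ℤ.+ c ℤ.+ + 1)) ℤ.+ (z ℤ.- c ℤ.+ (ℤ.- (z ℤ.- (c ℤ.+ c)) ℤ.+ + 0)))) ≡ + 0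
    row-zero = ℤ.solve-∀
    col-identity : ∀ x y z c → (z ℤ.- y) ℤ.+ (x ℤ.+ (c ℤ.+ + 1) ℤ.+ (ℤ.- (x ℤ.+ (c ℤ.+ c ℤ.+ + 1)) ℤ.+ (y ℤ.- c ℤ.+ (ℤ.- (z ℤ.- (c ℤ.+ c)) ℤ.+ + 0)))) ≡ + 0
    col-identity = ℤ.solve-∀
    col-zero : ∀ i → colSum 4 i layers ≡ + 0
    col-zero i = trans (cong₂ ℤ._+_ (cong₂ (λ a b → V a ℤ.- V b) (+-assoc i 4 1) (+-assoc i 4 0))
        (cong₂ ℤ._+_ (cong (λ a → V a ℤ.+ (c ℤ.+ + 1)) (+-assoc i 3 0))
        (cong₂ ℤ._+_ (cong (λ a → ℤ.- (V a ℤ.+ (c ℤ.+ c ℤ.+ + 1))) (+-assoc i 2 1))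
        (cong₂ ℤ._+_ (cong (λ a → V a ℤ.- c) (+-assoc i 0 4)) (cong (λ a → ℤ.- (V a ℤ.- (c ℤ.+ c)) ℤ.+ + 0) (+-assoc i 1 4))))))
      (col-identity (V (i + 3)) (V (i + 4)) (V (i + 5)) c)
    regroup : ∀ d a b e f → d + (a + (b + (e + (f + 0)))) ≡ d + ((a + b) + (e + f))
    regroup = solve-∀

-- A cycle through one element of each of the classes {a, -1 - a}, 0 ≤ a < n, whose
-- distances are 1, …, n. The four copies of it in Five then fill n + 1, …, 5n.
module OddFive (q : ℕ) (1≤q : 1 ≤ q) where

  private
    d N n : ℕ
    d = suc (q + q)
    N = q + q + suc d
    n = suc N
    x : ℤ
    -- The second zigzag uses the negative members of its classes, since no two of the numbers 0,
    -- ..., n - 1 have distance n. From q to -(3q + 3) the distance is exactly n = 4q + 3.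
    x = ℤ.- (+ (q + q + q + 3))
    f g v : ℕ → ℤ
    f = zigzag (+ 1) (+ 0) (+ 0 ℤ.+ + (suc d + (q + q)))
    g = zigzag (+ 1) x (x ℤ.+ + d)
    v = join d f g

    4≤N : 4 ≤ N
    4≤N = ≤-trans (s≤s (s≤s (+-mono-≤ 1≤q 1≤q))) (m≤n+m (suc d) (q + q))

    open Five N 4≤N v using (copies)

    c : ℤ
    c = + (n + n)

    -- The extra + 1 in two of the four translates makes z ↦ -1 - z exchange them, up to sign, with
    -- the other two. The choice within a class thus affects the distances only.
    copies-invariant : ∀ w z → copies w (ℤ.- + 1 ℤ.- z) ≡ copies w z
    copies-invariant w z = trans
      (cong₂ _+_ (cong₂ _+_ (flip (l₁ z c)) (flip (l₂ z c))) (cong₂ _+_ (flip (l₃ z c)) (flip (l₄ z c))))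
      (+-comm ((w ∣ z ℤ.- c ∣) + (w ∣ z ℤ.- (c ℤ.+ c) ∣)) _)
      where
      flip : ∀ {a b} → a ≡ ℤ.- b → w ∣ a ∣ ≡ w ∣ b ∣
      flip {b = b} refl = cong w (ℤ.∣-i∣≡∣i∣ b)
      l₁ : ∀ z c → ℤ.- + 1 ℤ.- z ℤ.+ (c ℤ.+ + 1) ≡ ℤ.- (z ℤ.- c)
      l₁ = ℤ.solve-∀
      l₂ : ∀ z c → ℤ.- + 1 ℤ.- z ℤ.+ (c ℤ.+ c ℤ.+ + 1) ≡ ℤ.- (z ℤ.- (c ℤ.+ c))
      l₂ = ℤ.solve-∀
      l₃ : ∀ z c → ℤ.- + 1 ℤ.- z ℤ.- c ≡ ℤ.- (z ℤ.+ (c ℤ.+ + 1))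
      l₃ = ℤ.solve-∀
      l₄ : ∀ z c → ℤ.- + 1 ℤ.- z ℤ.- (c ℤ.+ c) ≡ ℤ.- (z ℤ.+ (c ℤ.+ c ℤ.+ + 1))
      l₄ = ℤ.solve-∀

    -- The first zigzag gives 2q + 3, ..., 4q + 2, the seam n = 4q + 3, the second zigzag 1, ..., 2q
    -- + 1, and the closing step the missing 2q + 2.
    distances : ∀ (w : ℕ → ℕ) → ∑ (λ i → w (distance (v i) (v (suc i)))) N + w (distance (v N) (v 0)) ≡ ∑ (w ∘ suc) n
    distances w = begin
      ∑ (λ i → w (distance (v i) (v (suc i)))) N + w (distance (v N) (v 0))
        ≡⟨ cong₂ _+_ (∑-join-adjacent (λ y z → w (distance y z)) (q + q) d f g) (cong w closing) ⟩
      A + (w (distance (f (q + q)) (g 0)) + B) + w (suc d)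
        ≡⟨ cong₂ (λ s t → s + t + w (suc d)) (∑-distance-up w (+ 0) (suc d) (q + q)) (cong₂ _+_ (cong w middle) (∑-distance-up w x 0 d)) ⟩
      ∑ (λ i → w (suc d + suc i)) (q + q) + (w n + ∑ (w ∘ suc) d) + w (suc d)
        ≡⟨ regroup (∑ (λ i → w (suc d + suc i)) (q + q)) (w n) (∑ (w ∘ suc) d) (w (suc d)) ⟩
      ∑ (w ∘ suc) d + w (suc d) + ∑ (λ i → w (suc d + suc i)) (q + q) + w n
        ≡⟨ cong₂ (λ s t → s + t + w n) (sym (∑-snoc (w ∘ suc) d)) (∑-ext (q + q) λ i → cong w (+-suc (suc d) i)) ⟩
      ∑ (w ∘ suc) (suc d) + ∑ (λ i → w (suc (suc d + i))) (q + q) + w n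
        ≡⟨ cong (_+ w n) (∑-split (w ∘ suc) (suc d) (q + q)) ⟨
      ∑ (w ∘ suc) (suc d + (q + q)) + w n
        ≡⟨ cong (λ t → ∑ (w ∘ suc) t + w n) (+-comm (suc d) (q + q)) ⟩
      ∑ (w ∘ suc) N + w n
        ≡⟨ ∑-snoc (w ∘ suc) N ⟨
      ∑ (w ∘ suc) n ∎
      where
      open ≡-Reasoning
      A = ∑ (λ i → w (distance (f i) (f (suc i)))) (q + q)
      B = ∑ (λ i → w (distance (g i) (g (suc i)))) d
      regroup : ∀ a b c d → a + (b + c) + d ≡ c + d + a + b
      regroup = solve-∀
      closing : distance (v N) (v 0) ≡ suc d
      closing = trans (cong (λ z → distance z (+ 0)) (trans (cong v (+-suc (q + q) d)) (trans (join-right d (suc (q + q)) f g) (zigzag-odd (+ 1) x (x ℤ.+ + d) q))))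
        (cong ∣_∣ (lemma (+ q)))
        where
        lemma : ∀ q → ℤ.- (q ℤ.+ q ℤ.+ q ℤ.+ + 3) ℤ.+ (+ 1 ℤ.+ (q ℤ.+ q)) ℤ.- + 1 ℤ.* q ℤ.- + 0 ≡ ℤ.- (+ 2 ℤ.+ (q ℤ.+ q))
        lemma = ℤ.solve-∀
      middle : distance (f (q + q)) (g 0) ≡ n
      middle = trans (cong (λ z → distance z x) (zigzag-even (+ 1) (+ 0) (+ 0 ℤ.+ + (suc d + (q + q))) q))
        (cong ∣_∣ (lemma (+ q)))
        where
        lemma : ∀ q → + 0 ℤ.+ + 1 ℤ.* q ℤ.- ℤ.- (q ℤ.+ q ℤ.+ q ℤ.+ + 3) ≡ + 1 ℤ.+ (q ℤ.+ q ℤ.+ (+ 2 ℤ.+ (q ℤ.+ q)))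
        lemma = ℤ.solve-∀

    labels : ∀ (w : ℕ → ℕ) → ∑ (λ i → copies w (v i)) n ≡
      (∑ (λ i → w (n + n + suc i)) n + ∑ (λ i → w (n + n + n + n + suc i)) n) + (∑ (λ i → w (n + suc i)) n + ∑ (λ i → w (n + n + n + suc i)) n)
    labels w = begin
      ∑ (λ i → F (v i)) n
        ≡⟨ ∑-join F d (suc d) f g ⟩
      ∑ (λ i → F (f i)) d + ∑ (λ i → F (g i)) (suc d)
        ≡⟨ cong₂ _+_ (∑-zigzag F (+ 1) (+ 0) (+ 0 ℤ.+ + (suc d + (q + q))) q) (∑-zigzag-up F x d) ⟩
      ∑ (λ i → F (+ 0 ℤ.+ + 1 ℤ.* + i)) (suc q) + ∑ (λ i → F (+ 0 ℤ.+ + (suc d + (q + q)) ℤ.- + 1 ℤ.* + i)) q + ∑ (λ i → F (x ℤ.+ + i)) (suc d)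
        ≡⟨ cong₂ _+_ (cong₂ _+_ (∑-ext (suc q) λ i → cong F (low (+ i)))
                                (trans (∑-cong q λ i i<q → cong F (high i i<q)) (∑-reverse (λ i → φ (suc q + suc d + i)) q)))
                     (trans (∑-cong (suc d) λ i i<d → trans (sym (copies-invariant w (x ℤ.+ + i))) (cong F (mid i i<d))) (∑-reverse (λ i → φ (suc q + i)) (suc d))) ⟩
      ∑ φ (suc q) + ∑ (λ i → φ (suc q + suc d + i)) q + ∑ (λ i → φ (suc q + i)) (suc d)
        ≡⟨ regroup (∑ φ (suc q)) (∑ (λ i → φ (suc q + suc d + i)) q) (∑ (λ i → φ (suc q + i)) (suc d)) ⟩
      ∑ φ (suc q) + ∑ (λ i → φ (suc q + i)) (suc d) + ∑ (λ i → φ (suc q + suc d + i)) q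
        ≡⟨ ∑-split₃ φ (suc q) (suc d) q ⟨
      ∑ φ (suc q + suc d + q)
        ≡⟨ cong (∑ φ) (number q d) ⟩
      ∑ φ n
        ≡⟨ trans (∑-distrib φ₁₂ φ₃₄ n) (cong₂ _+_ (∑-distrib φ₁ φ₂ n) (∑-distrib φ₃ φ₄ n)) ⟩
      (∑ φ₁ n + ∑ φ₂ n) + (∑ φ₃ n + ∑ φ₄ n)
        ≡⟨ cong₂ _+_ (cong₂ _+_ (∑-ext n λ i → cong w (e₁ i n)) (∑-ext n λ i → cong w (e₂ i n)))
                     (cong₂ _+_ (trans (∑-cong n λ i i<n → cong w (e₃ i i<n)) (∑-reverse (λ i → w (n + suc i)) n))
                                (trans (∑-cong n λ i i<n → cong w (e₄ i i<n)) (∑-reverse (λ i → w (n + n + n + suc i)) n))) ⟩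
      (∑ (λ i → w (n + n + suc i)) n + ∑ (λ i → w (n + n + n + n + suc i)) n) + (∑ (λ i → w (n + suc i)) n + ∑ (λ i → w (n + n + n + suc i)) n) ∎
      where
      open ≡-Reasoning
      F = copies w
      φ φ₁ φ₂ φ₃ φ₄ φ₁₂ φ₃₄ : ℕ → ℕ
      φ i = F (+ i)
      φ₁ i = w ∣ + i ℤ.+ (c ℤ.+ + 1) ∣
      φ₂ i = w ∣ + i ℤ.+ (c ℤ.+ c ℤ.+ + 1) ∣
      φ₃ i = w ∣ + i ℤ.- c ∣
      φ₄ i = w ∣ + i ℤ.- (c ℤ.+ c) ∣
      φ₁₂ i = φ₁ i + φ₂ i
      φ₃₄ i = φ₃ i + φ₄ i
      regroup : ∀ a b c → a + b + c ≡ a + c + b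
      regroup = solve-∀
      number : ∀ q d → suc q + suc d + q ≡ suc (q + q + suc d)
      number = solve-∀
      low : ∀ i → + 0 ℤ.+ + 1 ℤ.* i ≡ i
      low = ℤ.solve-∀
      high : ∀ i → i < q → + 0 ℤ.+ + (suc d + (q + q)) ℤ.- + 1 ℤ.* + i ≡ + (suc q + suc d + (q ∸ suc i))
      high i i<q = trans (cong (λ t → + 0 ℤ.+ + (suc d + (q + t)) ℤ.- + 1 ℤ.* + i) (sym (m+[n∸m]≡n i<q))) (lemma (+ q) (+ d) (+ i) (+ (q ∸ suc i)))
        where
        lemma : ∀ q d i j → + 0 ℤ.+ (+ 1 ℤ.+ d ℤ.+ (q ℤ.+ (+ 1 ℤ.+ (i ℤ.+ j)))) ℤ.- + 1 ℤ.* i ≡ + 1 ℤ.+ q ℤ.+ (+ 1 ℤ.+ d) ℤ.+ j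
        lemma = ℤ.solve-∀
      mid : ∀ i → i < suc d → ℤ.- + 1 ℤ.- (x ℤ.+ + i) ≡ + (suc q + (suc d ∸ suc i))
      mid i i<d = trans (lemma₁ (+ q) (+ i)) (trans (cong (λ t → + q ℤ.+ + t ℤ.- + i) (sym (m+[n∸m]≡n i<d))) (lemma₂ (+ q) (+ i) (+ (suc d ∸ suc i))))
        where
        lemma₁ : ∀ q i → ℤ.- + 1 ℤ.- (ℤ.- (q ℤ.+ q ℤ.+ q ℤ.+ + 3) ℤ.+ i) ≡ q ℤ.+ (+ 2 ℤ.+ (q ℤ.+ q)) ℤ.- i
        lemma₁ = ℤ.solve-∀
        lemma₂ : ∀ q i j → q ℤ.+ (+ 1 ℤ.+ (i ℤ.+ j)) ℤ.- i ≡ + 1 ℤ.+ q ℤ.+ j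
        lemma₂ = ℤ.solve-∀
      e₁ : ∀ i n → i + (n + n + 1) ≡ n + n + suc i
      e₁ = solve-∀
      e₂ : ∀ i n → i + (n + n + (n + n) + 1) ≡ n + n + n + n + suc i
      e₂ = solve-∀
      e₃ : ∀ i → i < n → ∣ + i ℤ.- c ∣ ≡ n + suc (n ∸ suc i)
      e₃ i i<n = trans (cong (λ t → ∣ + i ℤ.- + (n + t) ∣) (sym (m+[n∸m]≡n i<n)))
        (trans (cong ∣_∣ (lemma (+ n) (+ i) (+ (n ∸ suc i)))) (ℤ.∣-i∣≡∣i∣ (+ (n + suc (n ∸ suc i)))))
        where
        lemma : ∀ n i j → i ℤ.- (n ℤ.+ (+ 1 ℤ.+ (i ℤ.+ j))) ≡ ℤ.- (n ℤ.+ (+ 1 ℤ.+ j))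
        lemma = ℤ.solve-∀
      e₄ : ∀ i → i < n → ∣ + i ℤ.- (c ℤ.+ c) ∣ ≡ n + n + n + suc (n ∸ suc i)
      e₄ i i<n = trans (cong (λ t → ∣ + i ℤ.- + (n + n + (n + t)) ∣) (sym (m+[n∸m]≡n i<n)))
        (trans (cong ∣_∣ (lemma (+ n) (+ i) (+ (n ∸ suc i)))) (ℤ.∣-i∣≡∣i∣ (+ (n + n + n + suc (n ∸ suc i)))))
        where
        lemma : ∀ n i j → i ℤ.- (n ℤ.+ n ℤ.+ (n ℤ.+ (+ 1 ℤ.+ (i ℤ.+ j)))) ≡ ℤ.- (n ℤ.+ n ℤ.+ n ℤ.+ (+ 1 ℤ.+ j))
        lemma = ℤ.solve-∀

  design : Design n 5 1 (n + n + n + n + n)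
  design = Five.design N 4≤N v λ w → begin
    ∑ (λ i → w (distance (v i) (v (suc i)))) N + w (distance (v N) (v 0)) + ∑ (λ i → copies w (v i)) n
      ≡⟨ cong₂ _+_ (distances w) (labels w) ⟩
    ∑ (w ∘ suc) n + ((B w + D w) + (A w + C w))
      ≡⟨ regroup (∑ (w ∘ suc) n) (A w) (B w) (C w) (D w) ⟩
    ∑ (w ∘ suc) n + A w + B w + C w + D w
      ≡⟨ cong₂ _+_ (cong₂ _+_ (cong₂ _+_ (cong (λ t → ∑ (w ∘ suc) n + t) (next w n)) (next w (n + n))) (next w (n + n + n))) (next w (n + n + n + n)) ⟩
    ∑ (w ∘ suc) n + A′ w n + A′ w (n + n) + A′ w (n + n + n) + A′ w (n + n + n + n)
      ≡⟨ cong (λ t → t + A′ w (n + n + n) + A′ w (n + n + n + n)) (∑-split₃ (w ∘ suc) n n n) ⟨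
    ∑ (w ∘ suc) (n + n + n) + A′ w (n + n + n) + A′ w (n + n + n + n)
      ≡⟨ ∑-split₃ (w ∘ suc) (n + n + n) n n ⟨
    ∑ (w ∘ suc) (n + n + n + n + n)
      ≡⟨ *-identityˡ _ ⟨
    1 * ∑ (w ∘ suc) (n + n + n + n + n) ∎
    where
    open ≡-Reasoning
    A B C D : (ℕ → ℕ) → ℕ
    A w = ∑ (λ i → w (n + suc i)) n
    B w = ∑ (λ i → w (n + n + suc i)) n
    C w = ∑ (λ i → w (n + n + n + suc i)) n
    D w = ∑ (λ i → w (n + n + n + n + suc i)) n
    A′ : (ℕ → ℕ) → ℕ → ℕ
    A′ w s = ∑ (λ i → w (suc (s + i))) n
    next : ∀ w s → ∑ (λ i → w (s + suc i)) n ≡ A′ w s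
    next w s = ∑-ext n λ i → cong w (+-suc s i)
    regroup : ∀ s a b c d → s + ((b + d) + (a + c)) ≡ s + a + b + c + d
    regroup = solve-∀

-- Six layers with a spare shift

-- Three pairs ± of layers; a shift is left out because the sum of the six shifts has to be even.
module SixGap (n : ℕ) (7≤n : 7 ≤ n) .{{_ : NonZero n}} where

  private
    X : ℕ → ℕ → ℤ
    X s i = + (s + suc (i % n))

    X-periodic : ∀ s t i → X s (i + n + t) ≡ X s (i + t)
    X-periodic s t i = trans (cong (X s) (lemma i n t)) (cong (λ j → + (s + suc j)) ([m+n]%n≡m%n (i + t) n))
      where
      lemma : ∀ i n s → i + n + s ≡ i + s + n
      lemma = solve-∀

  layers : List Layer
  layers = (0 , λ i → X 0 (i + 0))
         ∷ (1 , λ i → ℤ.- X 0 (i + 0))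
         ∷ (2 , λ i → ℤ.- X n (i + 2))
         ∷ (5 , λ i → X n (i + 2))
         ∷ (4 , λ i → X (n + n) (i + 3))
         ∷ (6 , λ i → ℤ.- X (n + n) (i + 3))
         ∷ []

  design : Design n 6 2 (n + n + n)
  design = record
    { layers   = layers
    ; size     = refl
    ; bounded  = below (s≤s z≤n) ∷ below (s≤s (s≤s z≤n)) ∷ below (s≤s (s≤s (s≤s z≤n))) ∷ below (s≤s (s≤s (s≤s (s≤s (s≤s (s≤s z≤n))))))
               ∷ below (s≤s (s≤s (s≤s (s≤s (s≤s z≤n))))) ∷ 7≤n ∷ []
    ; distinct = ((λ ()) ∷ (λ ()) ∷ (λ ()) ∷ (λ ()) ∷ (λ ()) ∷ []) ∷ ((λ ()) ∷ (λ ()) ∷ (λ ()) ∷ (λ ()) ∷ []) ∷ ((λ ()) ∷ (λ ()) ∷ (λ ()) ∷ [])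
               ∷ ((λ ()) ∷ (λ ()) ∷ []) ∷ ((λ ()) ∷ []) ∷ [] ∷ []
    ; periodic = X-periodic 0 0 ∷ (cong ℤ.-_ ∘ X-periodic 0 0) ∷ (cong ℤ.-_ ∘ X-periodic n 2) ∷ X-periodic n 2
               ∷ X-periodic (n + n) 3 ∷ (cong ℤ.-_ ∘ X-periodic (n + n) 3) ∷ []
    ; rows     = λ i → row-zero (X 0 (i + 0)) (X n (i + 2)) (X (n + n) (i + 3))
    ; cols     = λ i → trans (colSum-≡ {6} {n} i layers (≤-trans (n≤1+n 6) 7≤n)
                   (z≤n ∷ s≤s z≤n ∷ s≤s (s≤s z≤n) ∷ s≤s (s≤s (s≤s (s≤s (s≤s z≤n)))) ∷ s≤s (s≤s (s≤s (s≤s z≤n))) ∷ ≤-refl ∷ [])) (col-zero (i + (n ∸ 6)))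
    ; weights  = total
    }
    where
    below : ∀ {k} → k ≤ 7 → k ≤ n
    below k≤7 = ≤-trans k≤7 7≤n
    row-zero : ∀ x y z → x ℤ.+ (ℤ.- x ℤ.+ (ℤ.- y ℤ.+ (y ℤ.+ (z ℤ.+ (ℤ.- z ℤ.+ + 0))))) ≡ + 0
    row-zero = ℤ.solve-∀
    -- The three pairs contribute a - b, c - a and b - c. For this triangle to close, the gaps 1, 3,
    -- 2 between the paired shifts must satisfy 3 = 1 + 2, whence the parity condition on the
    -- shifts.
    col-identity : ∀ a b c n → a ℤ.+ (ℤ.- b ℤ.+ (ℤ.- (n ℤ.+ a) ℤ.+ (n ℤ.+ c ℤ.+ (n ℤ.+ n ℤ.+ b ℤ.+ (ℤ.- (n ℤ.+ n ℤ.+ c) ℤ.+ + 0))))) ≡ + 0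
    col-identity = ℤ.solve-∀
    col-zero : ∀ i → colSum 6 i layers ≡ + 0
    col-zero i = trans (cong₂ ℤ._+_ (cong (X 0) (+-assoc i 6 0)) (cong₂ ℤ._+_ (cong (ℤ.-_ ∘ X 0) (+-assoc i 5 0))
        (cong₂ ℤ._+_ (cong (ℤ.-_ ∘ X n) (+-assoc i 4 2)) (cong₂ ℤ._+_ (cong (X n) (+-assoc i 1 2))
        (cong₂ ℤ._+_ (cong (X (n + n)) (+-assoc i 2 3)) (cong (λ j → ℤ.- X (n + n) j ℤ.+ + 0) (+-assoc i 0 3)))))))
      (col-identity (X 0 (i + 6)) (X 0 (i + 5)) (X 0 (i + 3)) (+ n))
    total : ∀ w → weight w n layers ≡ 2 * ∑ (w ∘ suc) (n + n + n)
    total w = begin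
      weight w n layers
        ≡⟨ cong₂ _+_ (plus 0 0) (cong₂ _+_ (minus 0 0) (cong₂ _+_ (minus n 2) (cong₂ _+_ (plus n 2) (cong₂ _+_ (plus (n + n) 3) (cong (_+ 0) (minus (n + n) 3)))))) ⟩
      A 0 + (A 0 + (A n + (A n + (A (n + n) + (A (n + n) + 0)))))
        ≡⟨ regroup (A 0) (A n) (A (n + n)) ⟩
      2 * (A 0 + A n + A (n + n))
        ≡⟨ cong (2 *_) (∑-split₃ (w ∘ suc) n n n) ⟨
      2 * ∑ (w ∘ suc) (n + n + n) ∎
      where
      open ≡-Reasoning
      A : ℕ → ℕ
      A s = ∑ (λ i → w (suc (s + i))) n
      plus : ∀ s t → ∑ (λ i → w ∣ X s (i + t) ∣) n ≡ A s
      plus s t = trans (∑-%-shift {n} (λ i → w (s + suc i)) t) (∑-ext n λ i → cong w (+-suc s i))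
      minus : ∀ s t → ∑ (λ i → w ∣ ℤ.- X s (i + t) ∣) n ≡ A s
      minus s t = trans (∑-neg {n} w (λ i → X s (i + t)) n) (plus s t)
      regroup : ∀ a b c → a + (a + (b + (b + (c + (c + 0))))) ≡ 2 * (a + b + c)
      regroup = solve-∀

-- Five layers, n even

∑-interval : (ℕ → ℕ) → ℕ → ℕ → ℕ
∑-interval w s l = ∑ (λ i → w (suc (s + i))) l

∑-interval-split : ∀ w s a b → ∑-interval w s (a + b) ≡ ∑-interval w s a + ∑-interval w (s + a) b
∑-interval-split w s a b = trans (∑-split _ a b)
  (cong (λ t → ∑-interval w s a + t) (∑-ext b λ i → cong (w ∘ suc) (sym (+-assoc s a i))))

∑-interval-suc : ∀ w s l → ∑-interval w s (suc l) ≡ w (suc s) + ∑-interval w (suc s) l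
∑-interval-suc w s l = cong₂ _+_ (cong (w ∘ suc) (+-identityʳ s)) (∑-ext l λ i → cong (w ∘ suc) (+-suc s i))

∑-suc-interval : ∀ (w : ℕ → ℕ) s l → ∑ (λ i → w (s + suc i)) l ≡ ∑-interval w s l
∑-suc-interval w s l = ∑-ext l λ i → cong w (+-suc s i)

join-map₂ : ∀ {A B C : Set} (h : A → B → C) m a b c d r →
  h (join m a b r) (join m c d r) ≡ join m (λ i → h (a i) (c i)) (λ i → h (b i) (d i)) r
join-map₂ h zero    a b c d r       = refl
join-map₂ h (suc m) a b c d zero    = refl
join-map₂ h (suc m) a b c d (suc r) = join-map₂ h m (a ∘ suc) b (c ∘ suc) d r

join-cong : ∀ {A : Set} m {a b c d : ℕ → A} → (∀ i → a i ≡ c i) → (∀ i → b i ≡ d i) → ∀ r → join m a b r ≡ join m c d r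
join-cong zero    e e′ r       = e′ r
join-cong (suc m) e e′ zero    = e 0
join-cong (suc m) e e′ (suc r) = join-cong m (e ∘ suc) e′ r

-- With n = 2m the cells (i, j), (i, j + m), (i + m, j), (i + m, j + m) form a 2 × 2 square.
-- The squares on x have zero rows and column sums ∓ d, the squares on y have zero columns and
-- row sums ∓ d; both are compensated by the diagonal layer with entries ± d.
module Squares (m : ℕ) (3≤m : 3 ≤ m) .{{_ : NonZero (m + m)}} (d x y : ℕ → ℤ) where

  private
    n : ℕ
    n = m + m

    halves : (ℕ → ℤ) → (ℕ → ℤ) → ℕ → ℤ
    halves a b i = join m a b (i % n)

    halves-periodic : ∀ a b s i → halves a b (i + n + s) ≡ halves a b (i + s)
    halves-periodic a b s i = trans (cong (halves a b) (lemma i n s)) (cong (join m a b) ([m+n]%n≡m%n (i + s) n))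
      where
      lemma : ∀ i n s → i + n + s ≡ i + s + n
      lemma = solve-∀

    halves-swap : ∀ a b i → halves a b (i + m) ≡ halves b a i
    halves-swap a b i with i % n <? m
    ... | yes r<m = trans (cong (join m a b) (trans shift (m<n⇒m%n≡m (+-monoˡ-< m r<m))))
      (trans (cong (join m a b) (+-comm (i % n) m)) (trans (join-right m (i % n) a b) (sym (join-left m b a (i % n) r<m))))
      where
      shift : (i + m) % n ≡ (i % n + m) % n
      shift = trans (%-distribˡ-+ i m n) (trans (cong (λ t → (t + m % n) % n) (sym (m%n%n≡m%n i n))) (sym (%-distribˡ-+ (i % n) m n)))
    ... | no r≮m = trans (cong (join m a b) (trans shift (trans (cong (_% n) index) (trans ([m+n]%n≡m%n r n) (m<n⇒m%n≡m (<-≤-trans r<m (m≤m+n m m)))))))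
      (trans (join-left m a b r r<m) (trans (sym (join-right m r b a)) (cong (join m b a) (m+[n∸m]≡n m≤i%n))))
      where
      r = i % n ∸ m
      m≤i%n : m ≤ i % n
      m≤i%n = ≮⇒≥ r≮m
      r<m : r < m
      r<m = +-cancelˡ-< m r m (subst (_< n) (sym (m+[n∸m]≡n m≤i%n)) (m%n<n i n))
      shift : (i + m) % n ≡ (i % n + m) % n
      shift = trans (%-distribˡ-+ i m n) (trans (cong (λ t → (t + m % n) % n) (sym (m%n%n≡m%n i n))) (sym (%-distribˡ-+ (i % n) m n)))
      index : i % n + m ≡ r + n
      index = trans (cong (_+ m) (sym (m+[n∸m]≡n m≤i%n))) (lemma m r)
        where
        lemma : ∀ m r → m + r + m ≡ r + (m + m)
        lemma = solve-∀

    D : ℕ → ℤ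
    D = halves d (λ i → ℤ.- d i)

    square : (ℕ → ℤ) → ℕ → ℤ
    square x = halves x (λ i → x i ℤ.+ d i)

    D-opposite : ∀ i → D (i + m) ≡ ℤ.- D i
    D-opposite i = trans (halves-swap d (λ i → ℤ.- d i) i)
      (trans (join-cong m (λ _ → refl) (λ j → sym (ℤ.neg-involutive (d j))) (i % n))
      (sym (join-map₂ (λ u _ → ℤ.- u) m d (λ i → ℤ.- d i) d d (i % n))))

    -- Adding m leads from x to x + d in one half and back in the other; the sign of `D` changes
    -- accordingly, so one formula serves both.
    square-step : ∀ x i → square x (i + m) ≡ square x i ℤ.+ D i
    square-step x i = trans (halves-swap x (λ i → x i ℤ.+ d i) i)
      (trans (join-cong m (λ _ → refl) (λ j → lemma (x j) (d j)) (i % n))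
      (sym (join-map₂ ℤ._+_ m x (λ i → x i ℤ.+ d i) d (λ i → ℤ.- d i) (i % n))))
      where
      lemma : ∀ x d → x ≡ x ℤ.+ d ℤ.+ (ℤ.- d)
      lemma = ℤ.solve-∀

    X Y : ℕ → ℤ
    X = square x
    Y = square y

  layers : List Layer
  layers = (0 , λ i → D (i + 0))
         ∷ (1 , λ i → X (i + 1))
         ∷ (suc m , λ i → ℤ.- X (i + 1))
         ∷ (2 , λ i → Y (i + 0))
         ∷ (suc (suc m) , λ i → ℤ.- Y (i + m))
         ∷ []

  -- The array has each of these absolute values twice: d as ± d on the diagonal, and every entry of
  -- a square once with each sign. It remains to arrange 1, ..., h once.
  half-weight : (ℕ → ℕ) → ℕ
  half-weight w = ∑ (λ i → w ∣ d i ∣) m + ((∑ (λ i → w ∣ x i ∣) m + ∑ (λ i → w ∣ x i ℤ.+ d i ∣) m) + (∑ (λ i → w ∣ y i ∣) m + ∑ (λ i → w ∣ y i ℤ.+ d i ∣) m))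

  design : ∀ {h} → (∀ w → half-weight w ≡ ∑ (w ∘ suc) h) → Design n 5 2 h
  design total = record
    { layers   = layers
    ; size     = refl
    ; bounded  = ≤-trans (s≤s z≤n) 3≤n ∷ ≤-trans (s≤s (s≤s z≤n)) 3≤n ∷ ≤-trans (s≤s (n≤1+n (suc m))) 3+m≤n ∷ 3≤n ∷ 3+m≤n ∷ []
    ; distinct = ((λ ()) ∷ (λ ()) ∷ (λ ()) ∷ (λ ()) ∷ []) ∷ (<⇒≢ (s≤s 0<m) ∷ (λ ()) ∷ (λ ()) ∷ [])
               ∷ (≢-sym (<⇒≢ (s≤s 1<m)) ∷ <⇒≢ ≤-refl ∷ []) ∷ (<⇒≢ (s≤s (s≤s 0<m)) ∷ []) ∷ [] ∷ []
    ; periodic = halves-periodic _ _ 0 ∷ halves-periodic _ _ 1 ∷ (cong ℤ.-_ ∘ halves-periodic _ _ 1) ∷ halves-periodic _ _ 0 ∷ (cong ℤ.-_ ∘ halves-periodic _ _ m) ∷ []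
    ; rows     = λ i → trans (cong₂ (λ j z → D (i + 0) ℤ.+ (X (i + 1) ℤ.+ (ℤ.- X (i + 1) ℤ.+ (Y j ℤ.+ (ℤ.- z ℤ.+ + 0)))))
                     (+-identityʳ i) (trans (square-step y i) (cong (λ j → Y i ℤ.+ D j) (sym (+-identityʳ i)))))
                   (row-zero (D (i + 0)) (X (i + 1)) (Y i))
    ; cols     = λ i → trans (colSum-≡ {suc (suc m)} {n} i layers (≤-trans (n≤1+n _) 3+m≤n)
                   (z≤n ∷ s≤s z≤n ∷ s≤s (n≤1+n m) ∷ s≤s (s≤s z≤n) ∷ ≤-refl ∷ [])) (col-zero (i + (n ∸ suc (suc m))))
    ; weights  = λ w → trans (cong₂ _+_ (trans (shifted w d (λ i → ℤ.- d i) 0) (cong (λ t → ∑ (λ i → w ∣ d i ∣) m + t) (∑-neg {n} w d m)))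
                   (cong₂ _+_ (shifted w x _ 1) (cong₂ _+_ (trans (∑-neg {n} w (λ i → X (i + 1)) n) (shifted w x _ 1))
                   (cong₂ _+_ (shifted w y _ 0) (cong (_+ 0) (trans (∑-neg {n} w (λ i → Y (i + m)) n) (shifted w y _ m)))))))
                 (trans (regroup (∑ (λ i → w ∣ d i ∣) m) (∑ (λ i → w ∣ x i ∣) m + ∑ (λ i → w ∣ x i ℤ.+ d i ∣) m) (∑ (λ i → w ∣ y i ∣) m + ∑ (λ i → w ∣ y i ℤ.+ d i ∣) m))
                 (cong (2 *_) (total w)))
    }
    where
    0<m : 0 < m
    0<m = ≤-trans (s≤s z≤n) 3≤m
    1<m : 1 < m
    1<m = ≤-trans (s≤s (s≤s z≤n)) 3≤m
    3≤n : 3 ≤ n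
    3≤n = ≤-trans 3≤m (m≤m+n m m)
    3+m≤n : 3 + m ≤ n
    3+m≤n = +-monoˡ-≤ m 3≤m
    row-zero : ∀ d x y → d ℤ.+ (x ℤ.+ (ℤ.- x ℤ.+ (y ℤ.+ (ℤ.- (y ℤ.+ d) ℤ.+ + 0)))) ≡ + 0
    row-zero = ℤ.solve-∀
    col-identity : ∀ d x y → ℤ.- d ℤ.+ (x ℤ.+ d ℤ.+ (ℤ.- x ℤ.+ (y ℤ.+ (ℤ.- y ℤ.+ + 0)))) ≡ + 0
    col-identity = ℤ.solve-∀
    col-zero : ∀ i → colSum (suc (suc m)) i layers ≡ + 0
    col-zero i = trans (cong₂ ℤ._+_ (trans (cong D (i₀ i m)) (D-opposite (i + 2)))
        (cong₂ ℤ._+_ (trans (cong X (i₁ i m)) (square-step x (i + 2)))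
        (cong₂ ℤ._+_ (cong (ℤ.-_ ∘ X) (trans (cong (λ t → i + t + 1) (m+n∸n≡m 1 m)) (+-assoc i 1 1)))
        (cong₂ ℤ._+_ (cong Y (+-identityʳ (i + m)))
        (cong (λ t → ℤ.- Y t ℤ.+ + 0) (trans (cong (λ t → i + t + m) (n∸n≡0 m)) (cong (_+ m) (+-identityʳ i))))))))
      (col-identity (D (i + 2)) (X (i + 2)) (Y (i + m)))
      where
      i₀ : ∀ i m → i + suc (suc m) + 0 ≡ i + 2 + m
      i₀ = solve-∀
      i₁ : ∀ i m → i + suc m + 1 ≡ i + 2 + m
      i₁ = solve-∀
    shifted : ∀ (w : ℕ → ℕ) a b s → ∑ (λ i → w ∣ halves a b (i + s) ∣) n ≡ ∑ (λ i → w ∣ a i ∣) m + ∑ (λ i → w ∣ b i ∣) m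
    shifted w a b s = trans (∑-%-shift {n} (λ i → w ∣ join m a b i ∣) s) (∑-join (λ z → w ∣ z ∣) m m a b)
    regroup : ∀ d x y → (d + d) + (x + (x + (y + (y + 0)))) ≡ 2 * (d + (x + y))
    regroup = solve-∀

-- The differences d = 1, …, m, each of them twice as a difference of two numbers of m + 1, …, 5m:
-- the odd differences are those of pairs around two common centres, and likewise for the even
-- ones; here the largest even difference occurs once as the difference of the centres.
module EvenFive (h′ g : ℕ) (d-weight : ∀ (w : ℕ → ℕ) →
    ∑ (λ i → w (suc (i + i))) g + ∑ (λ i → w (suc (suc (i + i)))) (suc h′) ≡ ∑ (w ∘ suc) (g + suc h′)) where

  private
    h m e : ℕ
    h = suc h′
    m = g + h
    e = m + (g + g + g + g)

    -- Lists odd differences, even differences and, last, the exceptional largest even difference.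
    three : (ℕ → ℤ) → (ℕ → ℤ) → ℤ → ℕ → ℤ
    three a b c = join g a (join h′ b (λ _ → c))

    ∑-three : ∀ (w : ℕ → ℕ) a b c → ∑ (λ i → w ∣ three a b c i ∣) m ≡ ∑ (λ i → w ∣ a i ∣) g + (∑ (λ i → w ∣ b i ∣) h′ + w ∣ c ∣)
    ∑-three w a b c = trans (cong (∑ (λ i → w ∣ three a b c i ∣)) (cong (λ t → g + t) (sym (+-comm h′ 1))))
      (trans (∑-join (λ z → w ∣ z ∣) g (h′ + 1) a _)
      (cong (λ t → ∑ (λ i → w ∣ a i ∣) g + t) (trans (∑-join (λ z → w ∣ z ∣) h′ 1 b (λ _ → c)) (cong (λ t → ∑ (λ i → w ∣ b i ∣) h′ + t) (+-identityʳ _)))))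

    d : ℕ → ℤ
    d = three (λ i → + suc (i + i)) (λ i → + suc (suc (i + i))) (+ (h + h))

    -- The difference 2i + 1 joins s + g - i to s + g + 1 + i, so the odd pairs fill s + 1, ..., s +
    -- 2g. The difference 2i + 2 joins t + h′ - i to t + h′ + 2 + i, which leaves the centre t + h′
    -- + 1 vacant.
    start : ℕ → ℕ → ℤ → ℕ → ℤ
    start s t c = three (λ i → + (s + g) ℤ.- + i) (λ i → + (t + h′) ℤ.- + i) c

    ∑-descending : ∀ (w : ℕ → ℕ) b L → ∑ (λ i → w ∣ + (b + L) ℤ.- + i ∣) L ≡ ∑-interval w b L
    ∑-descending w b L = trans (∑-gaps w b L) (∑-suc-interval w b L)

    ∑-start : ∀ (w : ℕ → ℕ) s t c → ∑ (λ i → w ∣ start s t (+ c) i ∣) m ≡ ∑-interval w s g + (∑-interval w t h′ + w c)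
    ∑-start w s t c = trans (∑-three w _ _ _) (cong₂ (λ a b → a + (b + w c)) (∑-descending w s g) (∑-descending w t h′))

    ∑-end : ∀ (w : ℕ → ℕ) s t c → ∑ (λ i → w ∣ start s t (+ c) i ℤ.+ d i ∣) m ≡ ∑-interval w (s + g) g + (∑-interval w (suc (t + h′)) h′ + w (c + (h + h)))
    ∑-end w s t c = trans (∑-ext m λ i → cong (λ z → w ∣ z ∣) (trans (join-map₂ ℤ._+_ g _ _ _ _ i)
        (join-cong g (λ j → l₁ (+ (s + g)) (+ j)) (λ r → trans (join-map₂ ℤ._+_ h′ _ _ _ _ r) (join-cong h′ (λ j → l₂ (+ (t + h′)) (+ j)) (λ _ → refl) r)) i)))
      (trans (∑-three w (λ i → + (s + g + suc i)) (λ i → + (t + h′ + suc (suc i))) (+ (c + (h + h))))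
      (cong₂ (λ a b → a + (b + w (c + (h + h)))) (∑-suc-interval w (s + g) g)
        (∑-ext h′ λ i → cong w (trans (+-suc (t + h′) (suc i)) (cong suc (+-suc (t + h′) i))))))
      where
      l₁ : ∀ a j → a ℤ.- j ℤ.+ (+ 1 ℤ.+ (j ℤ.+ j)) ≡ a ℤ.+ (+ 1 ℤ.+ j)
      l₁ = ℤ.solve-∀
      l₂ : ∀ a j → a ℤ.- j ℤ.+ (+ 2 ℤ.+ (j ℤ.+ j)) ≡ a ℤ.+ (+ 2 ℤ.+ j)
      l₂ = ℤ.solve-∀

    x y : ℕ → ℤ
    -- In the blocks e + 1, ..., e + 2h and e + 2h + 1, ..., e + 4h the small even pairs leave out
    -- the first elements and the centres e + h + 1 and e + 3h + 1. The first elements differ by 2h,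
    -- and so do the centres: the last pair of `x` and of `y`.
    x = start m (suc e) (+ suc e)
    y = start (m + g + g) (suc (e + (h + h))) (+ suc (e + h))

  module _ (3≤m : 3 ≤ m) .{{_ : NonZero (m + m)}} where

    module S = Squares m 3≤m d x y

    design : Design (m + m) 5 2 (m + (g + g + g + g) + (h + h + h + h))
    design = S.design total
      where
      total : ∀ w → S.half-weight w ≡ ∑ (w ∘ suc) (m + (g + g + g + g) + (h + h + h + h))
      total w = begin
        S.half-weight w
          ≡⟨ cong₂ _+_ d-total (cong₂ _+_ (cong₂ _+_ (∑-start w m (suc e) (suc e)) (∑-end w m (suc e) (suc e)))
               (cong₂ _+_ (∑-start w (m + g + g) (suc (e + (h + h))) (suc (e + h))) (∑-end w (m + g + g) (suc (e + (h + h))) (suc (e + h))))) ⟩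
        _ ≡⟨ regroup (∑ (w ∘ suc) m) (G′ m) (G′ (m + g)) (G′ (m + g + g)) (G′ (m + g + g + g)) (H′ (suc e)) (w (suc e)) (H′ (suc (suc e + h′))) (w (suc e + (h + h))) (H′ (suc (e + (h + h)))) (w (suc (e + h))) (H′ (suc (suc (e + (h + h)) + h′))) (w (suc (e + h) + (h + h))) ⟩
        ∑ (w ∘ suc) m + (G′ m + G′ (m + g) + G′ (m + g + g) + G′ (m + g + g + g)) +
          ((w (suc e) + H′ (suc e)) + (w (suc (e + h)) + H′ (suc (suc e + h′))) + (w (suc e + (h + h)) + H′ (suc (e + (h + h)))) + (w (suc (e + h) + (h + h)) + H′ (suc (suc (e + (h + h)) + h′))))
          ≡⟨ cong₂ (λ a b → ∑ (w ∘ suc) m + a + b) odd-part even-part ⟩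
        ∑ (w ∘ suc) m + ∑-interval w m (g + g + g + g) + ∑-interval w e (h + h + h + h)
          ≡⟨ ∑-split₃ (w ∘ suc) m (g + g + g + g) (h + h + h + h) ⟨
        ∑ (w ∘ suc) (m + (g + g + g + g) + (h + h + h + h)) ∎
        where
        open ≡-Reasoning
        G′ H′ K′ : ℕ → ℕ
        G′ s = ∑-interval w s g
        H′ s = ∑-interval w s h′
        K′ s = ∑-interval w s h
        d-total : ∑ (λ i → w ∣ d i ∣) m ≡ ∑ (w ∘ suc) m
        d-total = trans (∑-three w _ _ _) (trans (cong (λ t → ∑ (λ i → w (suc (i + i))) g + t)
          (trans (cong (λ t → ∑ (λ i → w (suc (suc (i + i)))) h′ + w t) (cong suc (+-suc h′ h′))) (sym (∑-snoc (λ i → w (suc (suc (i + i)))) h′)))) (d-weight w))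
        regroup : ∀ s a b c d p q r t u v y z →
          s + (((a + (p + q)) + (b + (r + t))) + ((c + (u + v)) + (d + (y + z)))) ≡
          s + (a + b + c + d) + ((q + p) + (v + r) + (t + u) + (z + y))
        regroup = solve-∀
        fourfold : ∀ l s → ∑-interval w s l + ∑-interval w (s + l) l + ∑-interval w (s + l + l) l + ∑-interval w (s + l + l + l) l ≡ ∑-interval w s (l + l + l + l)
        fourfold l s = sym (trans (∑-interval-split w s (l + l + l) l) (cong₂ _+_
          (trans (∑-interval-split w s (l + l) l) (cong₂ _+_ (∑-interval-split w s l l) (cong (λ t → ∑-interval w t l) (sym (+-assoc s l l)))))
          (cong (λ t → ∑-interval w t l) (lemma s l))))
          where
          lemma : ∀ s l → s + (l + l + l) ≡ s + l + l + l
          lemma = solve-∀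
        odd-part : G′ m + G′ (m + g) + G′ (m + g + g) + G′ (m + g + g + g) ≡ ∑-interval w m (g + g + g + g)
        odd-part = fourfold g m
        cons : ∀ s {a b} → a ≡ suc s → b ≡ suc s → w a + H′ b ≡ K′ s
        cons s refl refl = sym (∑-interval-suc w s h′)
        even-part : (w (suc e) + H′ (suc e)) + (w (suc (e + h)) + H′ (suc (suc e + h′))) + (w (suc e + (h + h)) + H′ (suc (e + (h + h)))) + (w (suc (e + h) + (h + h)) + H′ (suc (suc (e + (h + h)) + h′)))
          ≡ ∑-interval w e (h + h + h + h)
        even-part = trans (cong₂ _+_ (cong₂ _+_ (cong₂ _+_ (cons e refl refl) (cons (e + h) refl (cong suc (sym (+-suc e h′)))))
            (cons (e + h + h) (cong suc (sym (+-assoc e h h))) (cong suc (sym (+-assoc e h h)))))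
            (cons (e + h + h + h) (cong suc (sym (+-assoc (e + h) h h) )) (cong suc (l e h′))))
          (fourfold h e)
          where
          l : ∀ e h → suc (e + (suc h + suc h)) + h ≡ e + suc h + suc h + suc h
          l = solve-∀

-- Six layers without a spare shift

-- Here n = 2m with m odd, and rows and columns are grouped into the 2 × 2 squares of the cells
-- (i, j), (i, j + m), (i + m, j), (i + m, j + m) with i and j even. There are three squares
--    9 -1     -3   4    -11  2
--   -8  5      7 -10      6 -0
-- for each i, where ± u stands for the entry ± (u m + 1 + (i mod m)).
module SixFull (k : ℕ) where

  private
    m n : ℕ
    m = suc (suc k + suc k)
    n = m + m

    even : ℕ → Bool
    even zero    = true
    even (suc i) = not (even i)

    even-+ : ∀ i j → even (i + (j + j)) ≡ even i
    even-+ i zero    = cong even (+-identityʳ i)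
    even-+ i (suc j) = trans (cong even (lemma i j)) (trans (not-involutive (even (i + (j + j)))) (even-+ i j))
      where
      lemma : ∀ i j → i + (suc j + suc j) ≡ suc (suc (i + (j + j)))
      lemma = solve-∀

    -- This is where m has to be odd: rows i and i + m share the residue modulo m but belong to
    -- different rows of a square.
    even-m : ∀ i → even (i + m) ≡ not (even i)
    even-m i = trans (cong even (+-suc i (suc k + suc k))) (cong not (even-+ i (suc k)))

    %-m : ∀ i → (i + m) % m ≡ i % m
    %-m i = [m+n]%n≡m%n i m

    entry : Bool → ℕ → ℕ → ℕ → ℤ
    entry b α β j = + ((if b then α else β) * m + suc j)

    F : ℕ → ℕ → ℕ → ℤ
    F α β i = entry (even i) α β (i % m)

    F-periodic : ∀ α β i → F α β (i + n) ≡ F α β i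
    F-periodic α β i = cong₂ (λ b j → entry b α β j) (even-+ i m)
      (trans (cong (_% m) (sym (+-assoc i m m))) (trans (%-m (i + m)) (%-m i)))

    F-m : ∀ α β i → F α β (i + m) ≡ entry (not (even i)) α β (i % m)
    F-m α β i = cong₂ (λ b j → entry b α β j) (even-m i) (%-m i)

    F-1 : ∀ α β i → F α β (i + 1) ≡ entry (not (even i)) α β ((i + 1) % m)
    F-1 α β i = cong (λ j → entry (even j) α β ((i + 1) % m)) (+-comm i 1)

    F-2 : ∀ α β i → F α β (i + 2) ≡ entry (even i) α β ((i + 2) % m)
    F-2 α β i = cong (λ b → entry b α β ((i + 2) % m)) (even-+ i 1)

    weight-F : ∀ (w : ℕ → ℕ) α β → ∑ (λ i → w ∣ F α β i ∣) n ≡ ∑-interval w (α * m) m + ∑-interval w (β * m) m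
    weight-F w α β = begin
      ∑ (λ i → w ∣ F α β i ∣) (m + m)
        ≡⟨ ∑-split (λ i → w ∣ F α β i ∣) m m ⟩
      ∑ (λ i → w ∣ F α β i ∣) m + ∑ (λ i → w ∣ F α β (m + i) ∣) m
        ≡⟨ ∑-distrib (λ i → w ∣ F α β i ∣) (λ i → w ∣ F α β (m + i) ∣) m ⟨
      ∑ (λ i → (w ∣ F α β i ∣) + (w ∣ F α β (m + i) ∣)) m
        ≡⟨ ∑-cong m (λ i i<m → trans (cong₂ (λ x y → (w ∣ x ∣) + (w ∣ y ∣))
             (cong (entry (even i) α β) (m<n⇒m%n≡m i<m))
             (trans (cong (F α β) (+-comm m i)) (trans (F-m α β i) (cong (entry (not (even i)) α β) (m<n⇒m%n≡m i<m)))))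
             (both (even i) i)) ⟩
      ∑ (λ i → w (α * m + suc i) + w (β * m + suc i)) m
        ≡⟨ ∑-distrib (λ i → w (α * m + suc i)) (λ i → w (β * m + suc i)) m ⟩
      ∑ (λ i → w (α * m + suc i)) m + ∑ (λ i → w (β * m + suc i)) m
        ≡⟨ cong₂ _+_ (∑-suc-interval w (α * m) m) (∑-suc-interval w (β * m) m) ⟩
      ∑-interval w (α * m) m + ∑-interval w (β * m) m ∎
      where
      open ≡-Reasoning
      both : ∀ b i → (w ∣ entry b α β i ∣) + (w ∣ entry (not b) α β i ∣) ≡ w (α * m + suc i) + w (β * m + suc i)
      both true  i = refl
      both false i = +-comm (w (β * m + suc i)) (w (α * m + suc i))

    -- The values α m + 1 + j are affine in α, so that the identities below reduce to those between the α.
    affine : ∀ α j → + (α * m + suc j) ≡ + α ℤ.* + m ℤ.+ (+ 1 ℤ.+ + j)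
    affine α j = cong (ℤ._+ (+ suc j)) (ℤ.pos-* α m)

    balance : ∀ b₁ b₂ b₃ b₄ b₅ b₆ x y z → + b₁ ℤ.- + b₂ ℤ.- + b₃ ℤ.+ + b₄ ℤ.- + b₅ ℤ.+ + b₆ ≡ + 0 →
      + (b₁ * m + suc x) ℤ.+ (ℤ.- + (b₂ * m + suc x) ℤ.+ (ℤ.- + (b₃ * m + suc y) ℤ.+ (+ (b₄ * m + suc y) ℤ.+ (ℤ.- + (b₅ * m + suc z) ℤ.+ (+ (b₆ * m + suc z) ℤ.+ + 0))))) ≡ + 0
    balance b₁ b₂ b₃ b₄ b₅ b₆ x y z e = trans
      (cong₂ ℤ._+_ (affine b₁ x) (cong₂ ℤ._+_ (cong ℤ.-_ (affine b₂ x)) (cong₂ ℤ._+_ (cong ℤ.-_ (affine b₃ y)) (cong₂ ℤ._+_ (affine b₄ y)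
        (cong₂ ℤ._+_ (cong ℤ.-_ (affine b₅ z)) (cong (ℤ._+ + 0) (affine b₆ z)))))))
      (trans (lemma (+ b₁) (+ b₂) (+ b₃) (+ b₄) (+ b₅) (+ b₆) (+ x) (+ y) (+ z) (+ m)) (trans (cong (ℤ._* + m) e) (ℤ.*-zeroˡ (+ m))))
      where
      lemma : ∀ a b c d e f x y z m →
        a ℤ.* m ℤ.+ (+ 1 ℤ.+ x) ℤ.+ (ℤ.- (b ℤ.* m ℤ.+ (+ 1 ℤ.+ x)) ℤ.+ (ℤ.- (c ℤ.* m ℤ.+ (+ 1 ℤ.+ y)) ℤ.+ (d ℤ.* m ℤ.+ (+ 1 ℤ.+ y) ℤ.+ (ℤ.- (e ℤ.* m ℤ.+ (+ 1 ℤ.+ z)) ℤ.+ (f ℤ.* m ℤ.+ (+ 1 ℤ.+ z) ℤ.+ + 0))))) ≡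
        (a ℤ.- b ℤ.- c ℤ.+ d ℤ.- e ℤ.+ f) ℤ.* m
      lemma = ℤ.solve-∀

  layers : List Layer
  layers = (0 , F 9 5)
         ∷ (m , λ i → ℤ.- F 1 8 i)
         ∷ (suc m , λ i → ℤ.- F 3 10 i)
         ∷ (1 , F 4 7)
         ∷ (2 , λ i → ℤ.- F 11 0 i)
         ∷ (suc (suc m) , F 2 6)
         ∷ []

  design : Design n 6 1 (12 * m)
  design = record
    { layers   = layers
    ; size     = refl
    ; bounded  = s≤s z≤n ∷ m<m+n m (s≤s z≤n) ∷ ≤-trans (n≤1+n _) 3+m≤n ∷ ≤-trans (s≤s (s≤s z≤n)) 3≤n ∷ 3≤n ∷ 3+m≤n ∷ []
    ; distinct = ((λ ()) ∷ (λ ()) ∷ (λ ()) ∷ (λ ()) ∷ (λ ()) ∷ [])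
               ∷ (<⇒≢ (n<1+n m) ∷ ≢-sym (<⇒≢ 1<m) ∷ ≢-sym (<⇒≢ 2<m) ∷ <⇒≢ (m<n⇒m<1+n (n<1+n m)) ∷ [])
               ∷ (≢-sym (<⇒≢ (m<n⇒m<1+n 1<m)) ∷ ≢-sym (<⇒≢ (m<n⇒m<1+n 2<m)) ∷ <⇒≢ (n<1+n (suc m)) ∷ [])
               ∷ ((λ ()) ∷ <⇒≢ (m<n⇒m<1+n (m<n⇒m<1+n 1<m)) ∷ []) ∷ (<⇒≢ (m<n⇒m<1+n (m<n⇒m<1+n 2<m)) ∷ []) ∷ [] ∷ []
    ; periodic = F-periodic 9 5 ∷ (cong ℤ.-_ ∘ F-periodic 1 8) ∷ (cong ℤ.-_ ∘ F-periodic 3 10) ∷ F-periodic 4 7 ∷ (cong ℤ.-_ ∘ F-periodic 11 0) ∷ F-periodic 2 6 ∷ []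
    ; rows     = λ i → row-zero (even i) (i % m)
    ; cols     = λ i → trans (colSum-≡ {suc (suc m)} {n} i layers (≤-trans (n≤1+n _) 3+m≤n)
                   (z≤n ∷ m≤n⇒m≤1+n (n≤1+n m) ∷ n≤1+n (suc m) ∷ s≤s z≤n ∷ s≤s (s≤s z≤n) ∷ ≤-refl ∷ [])) (col-zero (i + (n ∸ suc (suc m))))
    ; weights  = total
    }
    where
    2<m : 2 < m
    2<m = s≤s (s≤s (≤-trans (s≤s z≤n) (m≤n+m (suc k) k)))
    1<m : 1 < m
    1<m = ≤-trans (s≤s (s≤s z≤n)) 2<m
    3≤n : 3 ≤ n
    3≤n = ≤-trans 2<m (m≤m+n m m)
    3+m≤n : 3 + m ≤ n
    3+m≤n = +-monoˡ-≤ m 2<m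
    row-zero : ∀ b j → entry b 9 5 j ℤ.+ (ℤ.- entry b 1 8 j ℤ.+ (ℤ.- entry b 3 10 j ℤ.+ (entry b 4 7 j ℤ.+ (ℤ.- entry b 11 0 j ℤ.+ (entry b 2 6 j ℤ.+ + 0))))) ≡ + 0
    row-zero true  j = balance 9 1 3 4 11 2 j j j refl
    row-zero false j = balance 5 8 10 7 0 6 j j j refl
    -- A column meets all three squares in their first columns, with sums 1 + 4 - 5, or in their
    -- second columns, with sums 4 - 6 + 2.
    col-identity : ∀ b x y z → entry (not b) 9 5 x ℤ.+ (ℤ.- entry b 1 8 x ℤ.+ (ℤ.- entry (not b) 3 10 y ℤ.+ (entry b 4 7 y ℤ.+ (ℤ.- entry (not b) 11 0 z ℤ.+ (entry b 2 6 z ℤ.+ + 0))))) ≡ + 0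
    col-identity true  x y z = balance 5 1 10 4 0 2 x y z refl
    col-identity false x y z = balance 9 8 3 7 11 6 x y z refl
    col-zero : ∀ i → colSum (suc (suc m)) i layers ≡ + 0
    col-zero i = trans (cong₂ ℤ._+_ (trans (cong (F 9 5) (i₀ i m)) (trans (F-m 9 5 (i + 2)) (cong (λ b → entry (not b) 9 5 ((i + 2) % m)) (even-+ i 1))))
        (cong₂ ℤ._+_ (cong ℤ.-_ (trans (cong (λ t → F 1 8 (i + t)) (m+n∸n≡m 2 m)) (F-2 1 8 i)))
        (cong₂ ℤ._+_ (cong ℤ.-_ (trans (cong (λ t → F 3 10 (i + t)) (m+n∸n≡m 1 m)) (F-1 3 10 i)))
        (cong₂ ℤ._+_ (trans (cong (F 4 7) (i₁ i m)) (trans (F-m 4 7 (i + 1)) (cong (λ b → entry b 4 7 ((i + 1) % m)) (trans (cong (not ∘ even) (+-comm i 1)) (not-involutive (even i))))))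
        (cong₂ ℤ._+_ (cong ℤ.-_ (F-m 11 0 i))
        (cong (ℤ._+ + 0) (cong (F 2 6) (trans (cong (λ t → i + t) (n∸n≡0 m)) (+-identityʳ i)))))))))
      (col-identity (even i) ((i + 2) % m) ((i + 1) % m) (i % m))
      where
      i₀ : ∀ i m → i + suc (suc m) ≡ i + 2 + m
      i₀ = solve-∀
      i₁ : ∀ i m → i + suc m ≡ i + 1 + m
      i₁ = solve-∀
    total : ∀ w → weight w n layers ≡ 1 * ∑ (w ∘ suc) (12 * m)
    total w = begin
      weight w n layers
        ≡⟨ cong₂ _+_ (weight-F w 9 5) (cong₂ _+_ (minus 1 8) (cong₂ _+_ (minus 3 10) (cong₂ _+_ (weight-F w 4 7) (cong₂ _+_ (minus 11 0) (cong (_+ 0) (weight-F w 2 6)))))) ⟩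
      (U 9 + U 5) + ((U 1 + U 8) + ((U 3 + U 10) + ((U 4 + U 7) + ((U 11 + U 0) + ((U 2 + U 6) + 0)))))
        ≡⟨ regroup (U 0) (U 1) (U 2) (U 3) (U 4) (U 5) (U 6) (U 7) (U 8) (U 9) (U 10) (U 11) ⟩
      1 * units 12
        ≡⟨ cong (1 *_) (units-∑ 12) ⟨
      1 * ∑ (w ∘ suc) (12 * m) ∎
      where
      open ≡-Reasoning
      U units : ℕ → ℕ
      U u = ∑-interval w (u * m) m
      units zero    = 0
      units (suc u) = units u + U u
      units-∑ : ∀ u → ∑ (w ∘ suc) (u * m) ≡ units u
      units-∑ zero    = refl
      units-∑ (suc u) = trans (cong (∑ (w ∘ suc)) (+-comm m (u * m))) (trans (∑-split (w ∘ suc) (u * m) m) (cong (_+ U u) (units-∑ u)))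
      minus : ∀ α β → ∑ (λ i → w ∣ ℤ.- F α β i ∣) n ≡ U α + U β
      minus α β = trans (∑-neg {n} w (F α β) n) (weight-F w α β)
      regroup : ∀ a b c d e f g h i j k l → (j + f) + ((b + i) + ((d + k) + ((e + h) + ((l + a) + ((c + g) + 0))))) ≡ 1 * (0 + a + b + c + d + e + f + g + h + i + j + k + l)
      regroup = solve-∀

-- Existence by residues modulo 4

data Mod4 : ℕ → Set where
  rem0 : ∀ t → Mod4 (t * 4)
  rem1 : ∀ t → Mod4 (1 + t * 4)
  rem2 : ∀ t → Mod4 (2 + t * 4)
  rem3 : ∀ t → Mod4 (3 + t * 4)

mod4 : ∀ n → Mod4 n
mod4 0 = rem0 0
mod4 1 = rem1 0
mod4 2 = rem2 0
mod4 3 = rem3 0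
mod4 (suc (suc (suc (suc n)))) with mod4 n
... | rem0 t = rem0 (suc t)
... | rem1 t = rem1 (suc t)
... | rem2 t = rem2 (suc t)
... | rem3 t = rem3 (suc t)

%4-≡1 : ∀ {a} b → a ≡ 1 + b * 4 → a % 4 ≡ 1
%4-≡1 b refl = [m+kn]%n≡m%n 1 b 4

-- With σ = 2t the two blocks of new shifts are adjacent and fill b, ..., b + 4t - 1.
extend-contiguous : ∀ st {n k h} .{{_ : NonZero n}} (D : Design n k (mult st) h) b t →
  All (λ (l : Layer) → proj₁ l < b) (Design.layers D) → b + t * 4 ≤ n →
  Design n (k + t * 4) (mult st) (h + t * (step st * n + step st * n))
extend-contiguous st {n} D b t below le = Group.extend st n (t * 2) D b t
  (All.map (λ s<b → λ { (inj₁ (b≤s , _)) → <⇒≱ s<b b≤s ; (inj₂ (b≤s , _)) → <⇒≱ s<b (≤-trans (m≤m+n b (t * 2)) b≤s) }) below)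
  ≤-refl (subst (_≤ n) (lemma b t) le)
  where
  lemma : ∀ b t → b + t * 4 ≡ b + t * 2 + t * 2
  lemma = solve-∀

-- The given layers lie within 0, 1, 2 and m, m + 1, m + 2, so σ = m puts the new shifts right after
-- each of these.
extend-halves : ∀ st m {k h} .{{_ : NonZero (m + m)}} (D : Design (m + m) k (mult st) h) t →
  All (λ (l : Layer) → (proj₁ l < 3) ⊎ (m ≤ proj₁ l × proj₁ l < 3 + m)) (Design.layers D) → 3 + t * 2 ≤ m →
  Design (m + m) (k + t * 4) (mult st) (h + t * (step st * (m + m) + step st * (m + m)))
extend-halves st m D t near le = Group.extend st (m + m) m D 3 t
  (All.map (λ { (inj₁ s<3) → λ { (inj₁ (3≤s , _)) → <⇒≱ s<3 3≤s ; (inj₂ (3≤s , _)) → <⇒≱ s<3 (≤-trans (m≤m+n 3 m) 3≤s) }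
              ; (inj₂ (m≤s , s<3+m)) → λ { (inj₁ (_ , s<)) → <⇒≱ s< (≤-trans le m≤s) ; (inj₂ (3+m≤s , _)) → <⇒≱ s<3+m 3+m≤s } }) near)
  (≤-trans (m≤n+m (t * 2) 3) le) (+-monoˡ-≤ m le)

empty : ∀ n → Design n 0 2 0
empty n = record { layers = [] ; size = refl ; bounded = [] ; distinct = [] ; periodic = []
                 ; rows = λ _ → refl ; cols = λ _ → refl ; weights = λ _ → refl }

-- For odd k and even n the bound k ≤ n is strict; this is what gives both halves enough room for
-- the new layers.
halve-≤ : ∀ a m → suc (a + a) ≤ m + m → suc a ≤ m
halve-≤ a m le with suc a ≤? m
... | yes p = p
... | no ¬p = contradiction le (<⇒≱ (s≤s (+-mono-≤ (≤-pred (≰⇒> ¬p)) (≤-pred (≰⇒> ¬p)))))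

exists-0 : ∀ n t .{{_ : NonZero n}} → t * 4 ≤ n → Exists2H n (t * 4)
exists-0 n t le = exists-double (lemma n t) (extend-contiguous double (empty n) 0 t [] le)
  where
  lemma : ∀ n t → t * (1 * n + 1 * n) + t * (1 * n + 1 * n) ≡ n * (t * 4)
  lemma = solve-∀

exists-3-even : ∀ m t → 3 + t * 4 ≤ m + m → Exists2H (m + m) (3 + t * 4)
exists-3-even (suc (suc m)) t le = exists-double (lemma (suc (suc m)) t)
  (extend-contiguous double (EvenThree.design (suc m) (s≤s z≤n)) 3 t (s≤s z≤n ∷ s≤s (s≤s z≤n) ∷ ≤-refl ∷ []) le)
  where
  lemma : ∀ m t → (m + m + m + t * (1 * (m + m) + 1 * (m + m))) + (m + m + m + t * (1 * (m + m) + 1 * (m + m))) ≡ (m + m) * (3 + t * 4)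
  lemma = solve-∀
exists-3-even (suc zero) t (s≤s (s≤s ()))

exists-3-odd : ∀ s t → 3 + t * 4 ≤ 1 + s * 4 → Exists2H (1 + s * 4) (3 + t * 4)
exists-3-odd (suc a) t le = subst (λ n → 3 + t * 4 ≤ n → Exists2H n (3 + t * 4)) (shape a) go le
  where
  shape : ∀ a → suc (suc (a + a) + suc (suc a + suc a)) ≡ 1 + suc a * 4
  shape = solve-∀
  lemma : ∀ n t → n + n + n + t * (2 * n + 2 * n) ≡ n * (3 + t * 4)
  lemma = solve-∀
  n = suc (suc (a + a) + suc (suc a + suc a))
  go : 3 + t * 4 ≤ n → Exists2H n (3 + t * 4)
  go le = exists-single (subst (Design n (3 + t * 4) 1) (lemma n t)
    (extend-contiguous single (OddThree.design a) 3 t (s≤s z≤n ∷ s≤s (s≤s z≤n) ∷ ≤-refl ∷ []) le))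
exists-3-odd zero t (s≤s ())

exists-5-odd : ∀ q t → 5 + t * 4 ≤ 3 + q * 4 → Exists2H (3 + q * 4) (5 + t * 4)
exists-5-odd (suc q) t le = subst (λ n → 5 + t * 4 ≤ n → Exists2H n (5 + t * 4)) (shape q) go le
  where
  shape : ∀ q → suc (suc q + suc q + suc (suc (suc q + suc q))) ≡ 3 + suc q * 4
  shape = solve-∀
  lemma : ∀ n t → n + n + n + n + n + t * (2 * n + 2 * n) ≡ n * (5 + t * 4)
  lemma = solve-∀
  n = suc (suc q + suc q + suc (suc (suc q + suc q)))
  go : 5 + t * 4 ≤ n → Exists2H n (5 + t * 4)
  go le = exists-single (subst (Design n (5 + t * 4) 1) (lemma n t)
    (extend-contiguous single (OddFive.design (suc q) (s≤s z≤n)) 5 t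
      (s≤s z≤n ∷ s≤s (s≤s z≤n) ∷ s≤s (s≤s (s≤s z≤n)) ∷ ≤-refl ∷ s≤s (s≤s (s≤s (s≤s z≤n))) ∷ []) le))
exists-5-odd zero t (s≤s (s≤s (s≤s ())))

-- The hypothesis on `w` asks that g odd and h + 1 even numbers make up an initial interval. It is
-- applied with g = h + 1 for n ≡ 0 and with g = h + 2 for n ≡ 2 (mod 4).
exists-5-even : ∀ h g t → (∀ (w : ℕ → ℕ) → ∑ (λ i → w (suc (i + i))) g + ∑ (λ i → w (suc (suc (i + i)))) (suc h) ≡ ∑ (w ∘ suc) (g + suc h)) →
  .{{_ : NonZero ((g + suc h) + (g + suc h))}} → 5 + t * 4 ≤ (g + suc h) + (g + suc h) → Exists2H ((g + suc h) + (g + suc h)) (5 + t * 4)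
exists-5-even h g t e le = exists-double (lemma g (suc h) t) (extend-halves double m (EvenFive.design h g e (≤-trans (m≤m+n 3 (t * 2)) 3+2t≤m)) t
    (inj₁ (s≤s z≤n) ∷ inj₁ (s≤s (s≤s z≤n)) ∷ inj₂ (n≤1+n m , ≤-trans (n<1+n (suc m)) (n≤1+n _)) ∷ inj₁ ≤-refl ∷ inj₂ (≤-trans (n≤1+n m) (n≤1+n (suc m)) , ≤-refl) ∷ []) 3+2t≤m)
  where
  m = g + suc h
  3+2t≤m : 3 + t * 2 ≤ m
  3+2t≤m = halve-≤ (2 + t * 2) m (subst (_≤ m + m) (shape t) le)
    where
    shape : ∀ t → 5 + t * 4 ≡ suc (2 + t * 2 + (2 + t * 2))
    shape = solve-∀
  lemma : ∀ g h t → let m = g + h ; H = m + (g + g + g + g) + (h + h + h + h) + t * (1 * (m + m) + 1 * (m + m)) in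
    H + H ≡ (m + m) * (5 + t * 4)
  lemma = solve-∀

exists-6-gap : ∀ n t .{{_ : NonZero n}} → 7 + t * 4 ≤ n → Exists2H n (6 + t * 4)
exists-6-gap n t le = exists-double (lemma n t) (extend-contiguous double (SixGap.design n (≤-trans (m≤m+n 7 (t * 4)) le)) 7 t
    (s≤s z≤n ∷ s≤s (s≤s z≤n) ∷ s≤s (s≤s (s≤s z≤n)) ∷ s≤s (s≤s (s≤s (s≤s (s≤s (s≤s z≤n))))) ∷ s≤s (s≤s (s≤s (s≤s (s≤s z≤n)))) ∷ ≤-refl ∷ []) le)
  where
  lemma : ∀ n t → (n + n + n + t * (1 * n + 1 * n)) + (n + n + n + t * (1 * n + 1 * n)) ≡ n * (6 + t * 4)
  lemma = solve-∀

exists-6-full : ∀ t → Exists2H (6 + t * 4) (6 + t * 4)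
exists-6-full t = subst (λ n → Exists2H n (6 + t * 4)) (shape t) (exists-single (subst (Design (m + m) (6 + t * 4) 1) (lemma t)
    (extend-halves single m (SixFull.design t) t
      (inj₁ (s≤s z≤n) ∷ inj₂ (≤-refl , s≤s (m≤n+m m 2)) ∷ inj₂ (n≤1+n m , ≤-trans (n<1+n (suc m)) (n≤1+n _)) ∷ inj₁ (s≤s (s≤s z≤n)) ∷ inj₁ ≤-refl
        ∷ inj₂ (≤-trans (n≤1+n m) (n≤1+n (suc m)) , ≤-refl) ∷ []) (≤-reflexive (size t)))))
  where
  m = suc (suc t + suc t)
  size : ∀ t → 3 + t * 2 ≡ suc (suc t + suc t)
  size = solve-∀
  shape : ∀ t → suc (suc t + suc t) + suc (suc t + suc t) ≡ 6 + t * 4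
  shape = solve-∀
  lemma : ∀ t → let m = suc (suc t + suc t) in 12 * m + t * (2 * (m + m) + 2 * (m + m)) ≡ (m + m) * (6 + t * 4)
  lemma = solve-∀

∑-odd-even : ∀ (w : ℕ → ℕ) h → ∑ (λ i → w (suc (i + i))) h + ∑ (λ i → w (suc (suc (i + i)))) h ≡ ∑ (w ∘ suc) (h + h)
∑-odd-even w zero    = refl
∑-odd-even w (suc h) = begin
  (w 1 + ∑ (λ i → w (suc (suc i + suc i))) h) + (w 2 + ∑ (λ i → w (suc (suc (suc i + suc i)))) h)
    ≡⟨ cong₂ (λ a b → (w 1 + a) + (w 2 + b)) (∑-ext h λ i → cong (w ∘ suc ∘ suc) (+-suc i i)) (∑-ext h λ i → cong (w ∘ suc ∘ suc ∘ suc) (+-suc i i)) ⟩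
  (w 1 + ∑ (λ i → w (suc (suc (suc (i + i))))) h) + (w 2 + ∑ (λ i → w (suc (suc (suc (suc (i + i)))))) h)
    ≡⟨ regroup (w 1) (w 2) _ _ ⟩
  w 1 + (w 2 + (∑ (λ i → w (suc (suc (suc (i + i))))) h + ∑ (λ i → w (suc (suc (suc (suc (i + i)))))) h))
    ≡⟨ cong (λ t → w 1 + (w 2 + t)) (∑-odd-even (w ∘ suc ∘ suc) h) ⟩
  ∑ (w ∘ suc) (suc (suc (h + h)))
    ≡⟨ cong (∑ (w ∘ suc)) (cong suc (sym (+-suc h h))) ⟩
  ∑ (w ∘ suc) (suc h + suc h) ∎
  where
  open ≡-Reasoning
  regroup : ∀ a b c d → (a + c) + (b + d) ≡ a + (b + (c + d))
  regroup = solve-∀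

∑-odd-even-suc : ∀ (w : ℕ → ℕ) h → ∑ (λ i → w (suc (i + i))) (suc h) + ∑ (λ i → w (suc (suc (i + i)))) h ≡ ∑ (w ∘ suc) (suc (h + h))
∑-odd-even-suc w h = begin
  ∑ O (suc h) + E                   ≡⟨ cong (_+ E) (∑-snoc O h) ⟩
  ∑ O h + O h + E                   ≡⟨ comm (∑ O h) (O h) E ⟩
  ∑ O h + E + O h                   ≡⟨ cong (_+ O h) (∑-odd-even w h) ⟩
  ∑ (w ∘ suc) (h + h) + O h         ≡⟨ ∑-snoc (w ∘ suc) (h + h) ⟨
  ∑ (w ∘ suc) (suc (h + h))         ∎
  where
  open ≡-Reasoning
  O : ℕ → ℕ
  O i = w (suc (i + i))
  E = ∑ (λ i → w (suc (suc (i + i)))) h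
  comm : ∀ a b c → a + b + c ≡ a + c + b
  comm = solve-∀

sufficient : ∀ {n k} → Mod4 n → Mod4 k → .{{_ : NonZero n}} → k ≤ n → 3 ≤ k → ¬ ((n * k) % 4 ≡ 1) → Exists2H n k
sufficient {n} _ (rem0 t) k≤n _ _ = exists-0 n t k≤n
sufficient _ (rem1 zero) _ (s≤s ()) _
sufficient _ (rem2 zero) _ (s≤s (s≤s ())) _
sufficient {n} _ (rem2 (suc t)) k≤n _ _ with m≤n⇒m<n∨m≡n k≤n
... | inj₁ k<n  = exists-6-gap n t k<n
... | inj₂ refl = exists-6-full t
sufficient (rem0 s) (rem3 t) k≤n _ _ = subst (λ n → 3 + t * 4 ≤ n → Exists2H n (3 + t * 4)) (lemma s) (exists-3-even (s + s) t) k≤n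
  where
  lemma : ∀ s → (s + s) + (s + s) ≡ s * 4
  lemma = solve-∀
sufficient (rem1 s) (rem3 t) k≤n _ _ = exists-3-odd s t k≤n
sufficient (rem2 s) (rem3 t) k≤n _ _ = subst (λ n → 3 + t * 4 ≤ n → Exists2H n (3 + t * 4)) (lemma s) (exists-3-even (1 + s + s) t) k≤n
  where
  lemma : ∀ s → (1 + s + s) + (1 + s + s) ≡ 2 + s * 4
  lemma = solve-∀
sufficient (rem3 s) (rem3 t) _ _ nk≢1 = contradiction (%4-≡1 (2 + s * 3 + t * 3 + s * t * 4) (lemma s t)) nk≢1
  where
  lemma : ∀ s t → (3 + s * 4) * (3 + t * 4) ≡ 1 + (2 + s * 3 + t * 3 + s * t * 4) * 4
  lemma = solve-∀
sufficient (rem0 zero) (rem1 (suc t)) () _ _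
sufficient (rem0 (suc s)) (rem1 (suc t)) k≤n _ _ = subst (λ n → 5 + t * 4 ≤ n → Exists2H n (5 + t * 4)) (lemma s)
    (exists-5-even s (suc s) t (λ w → ∑-odd-even w (suc s))) k≤n
  where
  lemma : ∀ s → (suc s + suc s) + (suc s + suc s) ≡ suc s * 4
  lemma = solve-∀
sufficient (rem1 s) (rem1 (suc t)) _ _ nk≢1 = contradiction (%4-≡1 (s + suc t + s * suc t * 4) (lemma s (suc t))) nk≢1
  where
  lemma : ∀ s t → (1 + s * 4) * (1 + t * 4) ≡ 1 + (s + t + s * t * 4) * 4
  lemma = solve-∀
sufficient (rem2 zero) (rem1 (suc t)) (s≤s (s≤s ())) _ _
sufficient (rem2 (suc s)) (rem1 (suc t)) k≤n _ _ = subst (λ n → 5 + t * 4 ≤ n → Exists2H n (5 + t * 4)) (lemma s)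
    (exists-5-even s (suc (suc s)) t (λ w → ∑-odd-even-suc w (suc s))) k≤n
  where
  lemma : ∀ s → (suc (suc s) + suc s) + (suc (suc s) + suc s) ≡ 2 + suc s * 4
  lemma = solve-∀
sufficient (rem3 s) (rem1 (suc t)) k≤n _ _ = exists-5-odd s t k≤n

-- Necessity of the bounds on k

k≤n : ∀ {n k} (A : PFArray (suc n) k) → Is2H (suc n) k A → k ≤ suc n
k≤n {n} {k} A (rows , _) = begin
  k                               ≡⟨ rows fzero ⟨
  length (rowEntries A fzero)     ≤⟨ length-mapMaybe (A fzero) (allFin (suc n)) ⟩
  length (allFin (suc n))         ≡⟨ length-tabulate {n = suc n} (λ i → i) ⟩
  suc n                           ∎
  where open ≤-Reasoning

hit : ∀ {m} → ℕ → Fin (suc m) → ℕ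
hit g x = (if does (toℕ x ≟ g) then 1 else 0) + (if does (negℕ x ≟ g) then 1 else 0)

multiplicity≡sum : ∀ {n k} (A : PFArray n k) g → pmMultiplicity A g ≡ sum (map (hit (toℕ g)) (allEntries A))
multiplicity≡sum A g = trans (cong₂ _+_ (count≡sum (λ x → toℕ x ≟ toℕ g) xs) (count≡sum (λ x → negℕ x ≟ toℕ g) xs))
  (sum-map-+ (λ x → if does (toℕ x ≟ toℕ g) then 1 else 0) (λ x → if does (negℕ x ≟ toℕ g) then 1 else 0) xs)
  where xs = allEntries A

∑F : ∀ {n} → (Fin n → ℕ) → ℕ
∑F {n} f = sum (map f (allFin n))

∑F-suc : ∀ {n} (f : Fin (suc n) → ℕ) → ∑F f ≡ f fzero + ∑F (f ∘ fsuc)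
∑F-suc {n} f = cong (λ t → f fzero + t) (cong sum (trans (map-tabulate {n = n} fsuc f) (sym (map-tabulate {n = n} (λ i → i) (f ∘ fsuc)))))

∑F-mono : ∀ {n} {f g : Fin n → ℕ} → (∀ i → f i ≤ g i) → ∑F f ≤ ∑F g
∑F-mono {n} {f} {g} le = go (allFin n)
  where
  go : ∀ xs → sum (map f xs) ≤ sum (map g xs)
  go []       = z≤n
  go (x ∷ xs) = +-mono-≤ (le x) (go xs)

∑F-+ : ∀ {n} (f g : Fin n → ℕ) → ∑F (λ i → f i + g i) ≡ ∑F f + ∑F g
∑F-+ {n} f g = sym (sum-map-+ f g (allFin n))

∑F-single : ∀ {n} (i : Fin n) v → ∑F (λ j → if does (i Fin.≟ j) then v else 0) ≡ v
∑F-single {suc n} fzero v = trans (∑F-suc {n} (λ j → if does (fzero Fin.≟ j) then v else 0)) (trans (cong (λ t → v + t) (sum-map-0 (allFin n))) (+-identityʳ v))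
∑F-single {suc n} (fsuc i) v = trans (∑F-suc {n} (λ j → if does (fsuc i Fin.≟ j) then v else 0)) (∑F-single i v)

∑F-term : ∀ {n} (f : Fin n → ℕ) i → f i ≤ ∑F f
∑F-term {suc n} f fzero    = subst (f fzero ≤_) (sym (∑F-suc f)) (m≤m+n (f fzero) _)
∑F-term {suc n} f (fsuc i) = subst (f (fsuc i) ≤_) (sym (∑F-suc f)) (≤-trans (∑F-term (f ∘ fsuc) i) (m≤n+m _ (f fzero)))

∑F-positive : ∀ {n} (f : Fin n → ℕ) → 0 < ∑F f → ∃ λ i → 0 < f i
∑F-positive {n} f = go (allFin n)
  where
  go : ∀ xs → 0 < sum (map f xs) → ∃ λ i → 0 < f i
  go (x ∷ xs) p with 0 <? f x
  ... | yes q = x , q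
  ... | no ¬q = go xs (subst (λ t → 0 < t + sum (map f xs)) (n≤0⇒n≡0 (≮⇒≥ ¬q)) p)

-- Row i and column j overlap in one cell only, the one that the left side counts twice.
∑F-cross : ∀ {n} (h : Fin n → Fin n → ℕ) i j → ∑F (h i) + ∑F (λ i′ → h i′ j) ≤ ∑F (λ i′ → ∑F (h i′)) + h i j
∑F-cross h i j = begin
  ∑F (h i) + ∑F (λ i′ → h i′ j)
    ≡⟨ cong (_+ ∑F (λ i′ → h i′ j)) (∑F-single i (∑F (h i))) ⟨
  ∑F (λ i′ → if does (i Fin.≟ i′) then ∑F (h i) else 0) + ∑F (λ i′ → h i′ j)
    ≡⟨ ∑F-+ (λ i′ → if does (i Fin.≟ i′) then ∑F (h i) else 0) (λ i′ → h i′ j) ⟨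
  ∑F (λ i′ → (if does (i Fin.≟ i′) then ∑F (h i) else 0) + h i′ j)
    ≤⟨ ∑F-mono pointwise ⟩
  ∑F (λ i′ → ∑F (h i′) + (if does (i Fin.≟ i′) then h i j else 0))
    ≡⟨ ∑F-+ (λ i′ → ∑F (h i′)) (λ i′ → if does (i Fin.≟ i′) then h i j else 0) ⟩
  ∑F (λ i′ → ∑F (h i′)) + ∑F (λ i′ → if does (i Fin.≟ i′) then h i j else 0)
    ≡⟨ cong (λ t → ∑F (λ i′ → ∑F (h i′)) + t) (∑F-single i (h i j)) ⟩
  ∑F (λ i′ → ∑F (h i′)) + h i j ∎
  where
  open ≤-Reasoning
  pointwise : ∀ i′ → (if does (i Fin.≟ i′) then ∑F (h i) else 0) + h i′ j ≤ ∑F (h i′) + (if does (i Fin.≟ i′) then h i j else 0)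
  pointwise i′ with i Fin.≟ i′
  ... | yes refl = ≤-refl
  ... | no  _    = ≤-trans (∑F-term (h i′) j) (m≤m+n _ 0)

multiplicity-rows : ∀ {n k} (A : PFArray n k) g → pmMultiplicity A g ≡ ∑F (λ i → ∑F (λ j → maybe′ (hit (toℕ g)) 0 (A i j)))
multiplicity-rows {n} A g = trans (multiplicity≡sum A g) (trans (sum-concatMap (hit (toℕ g)) (rowEntries A) (allFin n))
  (sum-map-cong (λ i → sum-mapMaybe (hit (toℕ g)) (A i) (allFin n)) (allFin n)))

-- An entry alone in its row equals the row sum 0, so the residue 1 is never hit.
k≢1 : ∀ {n} (A : PFArray (suc n) 1) → ¬ Is2H (suc n) 1 A
k≢1 {n} A (rows , _ , mult , rowsums , _) = contradiction (trans (sym (mult one (λ ()))) (trans (multiplicity≡sum A one)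
    (trans (sum-concatMap (hit 1) (rowEntries A) (allFin (suc n))) (trans (sum-map-cong no-hit (allFin (suc n))) (sum-map-0 (allFin (suc n))))))) (λ ())
  where
  one : Fin (suc (suc n * 1))
  one = fsuc fzero
  no-hit : ∀ i → sum (map (hit 1) (rowEntries A i)) ≡ 0
  no-hit i with rowEntries A i | rows i | rowsums i
  ... | x ∷ [] | _ | s = cong (_+ 0) (cong₂ _+_
          (cong (λ t → if does (t ≟ 1) then 1 else 0) x≡0)
          (cong (λ t → if does (t ≟ 1) then 1 else 0) (trans (cong (λ t → (M ∸ t) % M) x≡0) (n%n≡0 M))))
    where
    M = suc (suc n * 1)
    x≡0 : toℕ x ≡ 0
    x≡0 = trans (sym (trans (cong (_% M) (+-identityʳ (toℕ x))) (m<n⇒m%n≡m (toℕ<n x)))) s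

-- Two representatives add up to less than twice the modulus, so their sum is 0 or the modulus
-- itself.
opposite : ∀ {m} (x y : Fin (suc m)) → (toℕ x + toℕ y) % suc m ≡ 0 → negℕ x ≡ toℕ y
opposite {m} x y e with toℕ x + toℕ y <? suc m
... | yes lt = trans (cong (λ t → (suc m ∸ t) % suc m) x≡0) (trans (n%n≡0 (suc m)) (sym y≡0))
  where
  sum≡0 : toℕ x + toℕ y ≡ 0
  sum≡0 = trans (sym (m<n⇒m%n≡m lt)) e
  x≡0 = m+n≡0⇒m≡0 (toℕ x) sum≡0
  y≡0 = m+n≡0⇒n≡0 (toℕ x) sum≡0
... | no ¬lt = trans (cong (λ t → (t ∸ toℕ x) % suc m) (sym sum≡M)) (trans (cong (_% suc m) (m+n∸m≡n (toℕ x) (toℕ y))) (m<n⇒m%n≡m (toℕ<n y)))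
  where
  M = suc m
  M≤ : M ≤ toℕ x + toℕ y
  M≤ = ≮⇒≥ ¬lt
  rest = toℕ x + toℕ y ∸ M
  rest<M : rest < M
  rest<M = +-cancelˡ-< M rest M (subst (_< M + M) (sym (m+[n∸m]≡n M≤)) (+-mono-< (toℕ<n x) (toℕ<n y)))
  rest≡0 : rest ≡ 0
  rest≡0 = trans (sym (m<n⇒m%n≡m rest<M)) (trans (sym ([m+n]%n≡m%n rest M)) (trans (cong (_% M) (trans (+-comm rest M) (m+[n∸m]≡n M≤))) e))
  sum≡M : toℕ x + toℕ y ≡ M
  sum≡M = trans (sym (m+[n∸m]≡n M≤)) (trans (cong (λ t → M + t) rest≡0) (+-identityʳ M))

hit-opposite : ∀ {m} g (x y : Fin (suc m)) → (toℕ x + toℕ y) % suc m ≡ 0 → hit g x ≡ hit g y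
hit-opposite {m} g x y e = trans (cong₂ (λ a b → (if does (a ≟ g) then 1 else 0) + (if does (b ≟ g) then 1 else 0))
    (sym (opposite y x (trans (cong (_% suc m) (+-comm (toℕ y) (toℕ x))) e))) (opposite x y e))
  (+-comm (if does (negℕ y ≟ g) then 1 else 0) _)

-- A row of length two is x, -x, and so is a column: an entry ± g forces a second one in its row
-- and a third one in its column.
k≢2 : ∀ {n} (A : PFArray (suc n) 2) → ¬ Is2H (suc n) 2 A
k≢2 {n} A (rows , cols , mult , rowsums , colsums) = contradiction too-many (<⇒≱ ≤-refl)
  where
  one : Fin (suc (suc n * 2))
  one = fsuc fzero
  h : Fin (suc n) → Fin (suc n) → ℕ
  h i j = maybe′ (hit 1) 0 (A i j)
  total : ∑F (λ i → ∑F (h i)) ≡ 2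
  total = trans (sym (multiplicity-rows A one)) (mult one (λ ()))
  pair : ∀ (xs : List (Fin (suc (suc n * 2)))) → length xs ≡ 2 → sumMod xs ≡ 0 → 0 < sum (map (hit 1) xs) → 2 ≤ sum (map (hit 1) xs)
  pair (x ∷ y ∷ []) _ e 0<s = subst (2 ≤_) (cong (λ t → hit 1 x + t) (trans hx≡hy (sym (+-identityʳ _)))) (double-positive (hit 1 x)
      (subst (0 <_) (cong (λ t → hit 1 x + t) (trans (+-identityʳ _) (sym hx≡hy))) 0<s))
    where
    hx≡hy : hit 1 x ≡ hit 1 y
    hx≡hy = hit-opposite 1 x y (trans (cong (λ t → (toℕ x + t) % suc (suc n * 2)) (sym (+-identityʳ (toℕ y)))) e)
    double-positive : ∀ a → 0 < a + a → 2 ≤ a + a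
    double-positive (suc a) _ = s≤s (≤-trans (s≤s z≤n) (m≤n+m (suc a) a))
  row≥2 : ∀ i → 0 < ∑F (h i) → 2 ≤ ∑F (h i)
  row≥2 i p = subst (2 ≤_) e (pair (rowEntries A i) (rows i) (rowsums i) (subst (0 <_) (sym e) p))
    where e = sum-mapMaybe (hit 1) (A i) (allFin (suc n))
  col≥2 : ∀ j → 0 < ∑F (λ i → h i j) → 2 ≤ ∑F (λ i → h i j)
  col≥2 j p = subst (2 ≤_) e (pair (colEntries A j) (cols j) (colsums j) (subst (0 <_) (sym e) p))
    where e = sum-mapMaybe (hit 1) (λ i → A i j) (allFin (suc n))
  -- The modulus is at least 3, so 1 is not its own negative.
  hit≤1 : ∀ (x : Fin (suc (suc n * 2))) → hit 1 x ≤ 1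
  hit≤1 x with toℕ x ≟ 1
  ... | no ¬e rewrite dec-false (toℕ x ≟ 1) ¬e with negℕ x ≟ 1
  ...   | yes e′ rewrite dec-true (negℕ x ≟ 1) e′ = ≤-refl
  ...   | no ¬e′ rewrite dec-false (negℕ x ≟ 1) ¬e′ = z≤n
  hit≤1 x | yes e = ≤-reflexive (cong₂ (λ a b → (if does (a ≟ 1) then 1 else 0) + (if does (b ≟ 1) then 1 else 0)) e
    (trans (cong (λ t → (suc (suc n * 2) ∸ t) % suc (suc n * 2)) e) (m<n⇒m%n≡m {n = suc (suc n * 2)} {m = suc n * 2} ≤-refl)))
  h≤1 : ∀ i j → h i j ≤ 1
  h≤1 i j with A i j
  ... | just x  = hit≤1 x
  ... | nothing = z≤n
  hit-cell : ∃ λ i → ∃ λ j → 0 < h i j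
  hit-cell with ∑F-positive (λ i → ∑F (h i)) (subst (0 <_) (sym total) z<s)
  ... | i , p with ∑F-positive (h i) p
  ...   | j , q = i , j , q
  too-many : 4 ≤ 3
  too-many with hit-cell
  -- The row and the column through a hit contain two each, while `∑F-cross` allows the total 2 and
  -- one for the common cell.
  ... | i , j , p = ≤-trans (+-mono-≤ (row≥2 i (<-≤-trans p (∑F-term (h i) j))) (col≥2 j (<-≤-trans p (∑F-term (λ i′ → h i′ j) i))))
    (≤-trans (∑F-cross h i j) (+-mono-≤ (≤-reflexive total) (h≤1 i j)))

-- Necessity of the congruence

∑-odd-values : ∀ z L → z < L + L → ∑ (λ v → if does (z ≟ suc (v + v)) then 1 else 0) L ≡ z % 2
∑-odd-values zero          L       _  = ∑-zero L
∑-odd-values (suc zero)    (suc L) _  = cong suc (trans (∑-ext L λ v → refl) (∑-zero L))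
∑-odd-values (suc (suc z)) (suc L) lt = trans (∑-ext L λ v → cong (λ t → if does (z ≟ t) then 1 else 0) (+-suc v v))
  (trans (∑-odd-values z L (≤-pred (≤-pred (subst (suc (suc (suc z)) ≤_) (cong suc (+-suc L L)) lt)))) (sym (trans (cong (_% 2) (+-comm 2 z)) ([m+n]%n≡m%n z 2))))

∑-sum-swap : ∀ {A : Set} (ω : ℕ → A → ℕ) L xs → ∑ (λ v → sum (map (ω v) xs)) L ≡ sum (map (λ x → ∑ (λ v → ω v x) L) xs)
∑-sum-swap ω L []       = ∑-zero L
∑-sum-swap ω L (x ∷ xs) = trans (∑-distrib (λ v → ω v x) (λ v → sum (map (ω v) xs)) L) (cong (λ t → ∑ (λ v → ω v x) L + t) (∑-sum-swap ω L xs))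

%2-+ : ∀ {a b} → a % 2 ≡ 0 → b % 2 ≡ 0 → (a + b) % 2 ≡ 0
%2-+ {a} {b} e e′ = trans (%-distribˡ-+ a b 2) (cong₂ (λ x y → (x + y) % 2) e e′)

sum-%2 : ∀ {A : Set} (f : A → ℕ) → (∀ x → f x % 2 ≡ 0) → ∀ xs → sum (map f xs) % 2 ≡ 0
sum-%2 f e []       = refl
sum-%2 f e (x ∷ xs) = %2-+ {f x} (e x) (sum-%2 f e xs)

sum-parity : ∀ {A : Set} (f : A → ℕ) xs → sum (map (λ x → f x % 2) xs) % 2 ≡ sum (map f xs) % 2
sum-parity f []       = refl
sum-parity f (x ∷ xs) = trans (%-distribˡ-+ (f x % 2) (sum (map (λ x → f x % 2) xs)) 2)
  (trans (cong₂ (λ a b → (a + b) % 2) (m%n%n≡m%n (f x) 2) (sum-parity f xs)) (sym (%-distribˡ-+ (f x) (sum (map f xs)) 2)))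

-- If nk = 4c + 1, then the modulus 2(2c + 1) is even, so that each row contains an even number of
-- odd entries. But x and -x have the same parity, so each of the 2c + 1 odd residues accounts
-- for one odd entry.
nk≢1 : ∀ {n k} (A : PFArray n k) → Is2H n k A → ∀ c → ¬ (n * k ≡ 1 + c * 4)
nk≢1 {n} {k} A (_ , _ , mult , rowsums , _) c e = contradiction (trans (sym even-count) (trans (cong (_% 2) odd-count) (lemma c))) (λ ())
  where
  lemma : ∀ c → suc (c + c) % 2 ≡ 1
  lemma c = trans (cong (λ t → suc t % 2) (index c)) ([m+kn]%n≡m%n 1 c 2)
    where
    index : ∀ c → c + c ≡ c * 2
    index = solve-∀
  L M : ℕ
  L = suc (c + c)
  M = suc (n * k)
  M≡ : M ≡ L + L
  M≡ = trans (cong suc e) (index c)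
    where
    index : ∀ c → suc (1 + c * 4) ≡ suc (c + c) + suc (c + c)
    index = solve-∀
  odds : List (Fin M) → ℕ
  odds xs = sum (map (λ x → toℕ x % 2) xs)
  even-M : ∀ {a} q → a ≡ q * M → a % 2 ≡ 0
  even-M q refl = trans (cong (_% 2) (trans (cong (q *_) M≡) (index q L))) (m*n%n≡0 (q * L) 2)
    where
    index : ∀ q l → q * (l + l) ≡ q * l * 2
    index = solve-∀
  row-even : ∀ i → odds (rowEntries A i) % 2 ≡ 0
  row-even i = trans (sum-parity toℕ (rowEntries A i)) (even-M {S} (S / M)
    (trans (m≡m%n+[m/n]*n S M) (cong (_+ S / M * M) (rowsums i))))
    where S = sum (map toℕ (rowEntries A i))
  even-count : odds (allEntries A) % 2 ≡ 0
  even-count = trans (cong (_% 2) (sum-concatMap (λ x → toℕ x % 2) (rowEntries A) (allFin n))) (sum-%2 (λ i → odds (rowEntries A i)) row-even (allFin n))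
  negℕ-parity : ∀ (x : Fin M) → negℕ x % 2 ≡ toℕ x % 2
  negℕ-parity x with toℕ x in eq
  ... | zero  = cong (_% 2) (n%n≡0 M)
  ... | suc a = trans (cong (_% 2) (m<n⇒m%n≡m (s≤s (m∸n≤m (n * k) a)))) (same (M ∸ suc a) (suc a)
      (trans (cong (_% 2) (m∸n+n≡m (subst (_≤ M) eq (<⇒≤ (toℕ<n x))))) (even-M 1 (sym (*-identityˡ M)))))
    where
    same : ∀ a b → (a + b) % 2 ≡ 0 → a % 2 ≡ b % 2
    same a b e = trans (sym ([m+kn]%n≡m%n a b 2)) (trans (cong (_% 2) (index a b)) (trans (%-distribˡ-+ (a + b) b 2)
      (trans (cong (λ t → (t + b % 2) % 2) e) (m%n%n≡m%n b 2))))
      where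
      index : ∀ a b → a + b * 2 ≡ a + b + b
      index = solve-∀
  odd-total : ∑ (λ v → 2) L ≡ L + L
  odd-total = const L
    where
    const : ∀ L → ∑ (λ v → 2) L ≡ L + L
    const zero    = refl
    const (suc L) = trans (cong (λ t → 2 + t) (const L)) (cong suc (sym (+-suc L L)))
  -- Counts in two ways the incidences of entries with odd residues: an odd entry has two, an even
  -- one none, and every odd residue is hit twice.
  double-count : odds (allEntries A) + odds (allEntries A) ≡ L + L
  double-count = begin
    odds xs + odds xs
      ≡⟨ sum-map-+ (λ x → toℕ x % 2) (λ x → toℕ x % 2) xs ⟩
    sum (map (λ x → toℕ x % 2 + toℕ x % 2) xs)
      ≡⟨ sum-map-cong (λ x → sym (odd-hits x)) xs ⟩
    sum (map (λ x → ∑ (λ v → hit (suc (v + v)) x) L) xs)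
      ≡⟨ ∑-sum-swap (λ v → hit (suc (v + v))) L xs ⟨
    ∑ (λ v → sum (map (hit (suc (v + v))) xs)) L
      ≡⟨ ∑-cong L (λ v v<L → class v (subst (suc (v + v) <_) (sym M≡) (small v v<L))) ⟩
    ∑ (λ v → 2) L
      ≡⟨ odd-total ⟩
    L + L ∎
    where
    open ≡-Reasoning
    xs = allEntries A
    small : ∀ v → v < L → suc (v + v) < L + L
    small v v<L = subst (_≤ L + L) (cong suc (+-suc v v)) (+-mono-≤ v<L v<L)
    class : ∀ v → suc (v + v) < M → sum (map (hit (suc (v + v))) xs) ≡ 2
    class v lt = trans (cong (λ g → sum (map (hit g) xs)) (sym (toℕ-fromℕ< lt)))
      (trans (sym (multiplicity≡sum A (fromℕ< lt))) (mult (fromℕ< lt) (λ z → contradiction (trans (sym z) (toℕ-fromℕ< lt)) (λ ()))))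
    odd-hits : ∀ x → ∑ (λ v → hit (suc (v + v)) x) L ≡ toℕ x % 2 + toℕ x % 2
    odd-hits x = trans (∑-distrib (λ v → if does (toℕ x ≟ suc (v + v)) then 1 else 0) (λ v → if does (negℕ x ≟ suc (v + v)) then 1 else 0) L)
      (cong₂ _+_ (∑-odd-values (toℕ x) L (subst (toℕ x <_) M≡ (toℕ<n x)))
                 (trans (∑-odd-values (negℕ x) L (subst (negℕ x <_) M≡ (m%n<n (M ∸ toℕ x) M))) (negℕ-parity x)))
  odd-count : odds (allEntries A) ≡ L
  odd-count = halve (odds (allEntries A)) L double-count
    where
    halve : ∀ a b → a + a ≡ b + b → a ≡ b
    halve a b e = *-cancelˡ-≡ a b 2 (trans (cong (λ t → a + t) (+-identityʳ a)) (trans e (cong (λ t → b + t) (sym (+-identityʳ b)))))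

3≤k : ∀ {n} k → 1 ≤ k → (A : PFArray (suc n) k) → Is2H (suc n) k A → 3 ≤ k
3≤k 1                   _ A is = contradiction is (k≢1 A)
3≤k 2                   _ A is = contradiction is (k≢2 A)
3≤k (suc (suc (suc k))) _ A is = s≤s (s≤s (s≤s z≤n))

necessary : ∀ n k → 1 ≤ n → 1 ≤ k → Exists2H n k → k ≤ n × 3 ≤ k × ¬ ((n * k) % 4 ≡ 1)
necessary (suc n) k _ 1≤k (A , is) = k≤n A is , 3≤k k 1≤k A is ,
  λ e → nk≢1 A is (suc n * k / 4) (trans (m≡m%n+[m/n]*n (suc n * k) 4) (cong (_+ suc n * k / 4 * 4) e))

theorem4p8 : (n k : ℕ) → 1 ≤ n → 1 ≤ k →
    Exists2H n k ⇔ (k ≤ n × 3 ≤ k × ¬ ((n * k) % 4 ≡ 1))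
theorem4p8 n k 1≤n 1≤k = mk⇔ (necessary n k 1≤n 1≤k)
  λ (k≤n , 3≤k , nk≢1) → sufficient (mod4 n) (mod4 k) {{>-nonZero 1≤n}} k≤n 3≤k nk≢1
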